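{- For any integers $q>q_0$ and $1\le a,b\le\rho_C$, if $\gcd(a,\rho_C)\mid \gcd(b,\rho_C)=\gcd(q,\rho_C)$, the integers $\gcd(a,\rho_C)$ and $\gcd(b,\rho_C)$ are combinatorially equivalent with respect to $\mathcal{A}$, and $[\mathbf a_J]_q\in\mathrm{Col}_q(A_J)$ for all $J\subseteq[m]$ with $\bar r(J)=r(J)$, then $$0<w_j(\mathcal{A})=\gamma_j(1)\le\gamma_j(a)\le\gamma_j(b)=\beta_j(q)\quad\text{for all } 0\le j\le s.$$ Moreover, when $\mathbf a=\mathbf 0$, for any integers $q\ge 1$ and $1\le a,b\le\rho_C$, if $\gcd(a,\rho_C)\mid \gcd(b,\rho_C)=\gcd(q,\rho_C)$, then $$0<w_j(\mathcal{A})=\gamma_j(1)\le\gamma_j(a)\le\gamma_j(b)=\beta_j(q)\quad\text{for all } 0\le j\le s.$$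
   Context: Let $A$ be an $m\times n$ integer matrix with nonzero rows $\boldsymbol\alpha_1^T,\dots,\boldsymbol\alpha_m^T$, $\mathbf a=(a_1,\dots,a_m)^T\in\mathbb{Z}^m$, and $[m]=\{1,\dots,m\}$. (Italic $a,b$ are integers, bold $\mathbf a$ is a vector.) Let $\mathcal{A}=\{H_1,\dots,H_m\}$ be the hyperplane arrangement in $\mathbb{R}^n$ with $H_i=\{\mathbf x\in\mathbb{R}^n:\boldsymbol\alpha_i^T\mathbf x=a_i\}$, and let $$\chi(\mathcal{A},t)=\sum_{J\subseteq[m],\ \bigcap_{j\in J}H_j\ne\emptyset}(-1)^{\#J}t^{\dim(\bigcap_{j\in J}H_j)}$$ be its characteristic polynomial (the intersection for $J=\emptyset$ being $\mathbb{R}^n$). Let $s=\operatorname{rank}(A)$. The numbers $w_j(\mathcal{A})$ are defined by $\chi(\mathcal{A},t)=\sum_{j=0}^s(-1)^{j}w_j(\mathcal{A})t^{n-j}$. For a positive integer $q$, $\mathbb{Z}_q=\mathbb{Z}/q\mathbb{Z}$, $[\cdot]_q$ is the entrywise reduction modulo $q$, $\mathrm{Col}_q(N)$ is the $\mathbb{Z}_q$-module generated by the columns of $[N]_q$, and $H_{i,q}=\{\mathbf x\in\mathbb{Z}_q^n:[\boldsymbol\alpha_i^T]_q\mathbf x=[a_i]_q\}$. For $J\subseteq[m]$, let $A_J$ and $\mathbf a_J$ consist of the rows of $A$ and entries of $\mathbf a$ indexed by $J$; $r(J)=\operatorname{rank}A_J$, $\bar r(J)=\operatorname{rank}[A_J\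 \mathbf a_J]$ (ranks over $\mathbb{Q}$). The invariant factors of an integer matrix are the nonzero diagonal entries (taken positive, each dividing the next) of its Smith normal form; let $d_{J,1}\mid\cdots\mid d_{J,r(J)}$ be those of $A_J$ and $\bar d_{J,1}\mid\cdots\mid\bar d_{J,\bar r(J)}$ those of $[A_J\ \mathbf a_J]$. Put $\rho_C=\operatorname{lcm}\{d_{J,r(J)}: J\subseteq[m],\ \bar r(J)=r(J)\}$ and $q_0=\max\{\bar d_{J,\bar r(J)}: J\subseteq[m],\ \bar r(J)=r(J)+1\}$, with $q_0=0$ if no such $J$ exists; $d_{J,0}=1$. For $J$ with $\bar r(J)=r(J)$ and a positive integer $q$, let $\tilde d_J(q)=\prod_{j=1}^{r(J)}\gcd(d_{J,j},q)$ if $\gcd(q,d_{J,j})=\gcd(q,\bar d_{J,j})$ for all $j=1,\dots,r(J)$, and $\tilde d_J(q)=0$ otherwise. For $0\le j\le s$ and a positive integer $q$ set $$\beta_j(q)=(-1)^{j}\sum_{J\subseteq[m],\ \bar r(J)=r(J)=j}(-1)^{\#J}\tilde d_J(q),$$ and for $1\le a\le\rho_C$ let $\gamma_j(a)$ be given by the same formula with $q$ replaced by $a$. These are the unsigned coefficients of the characteristic quasi-polynomial $\chi^{\mathrm{quasi}}(\mathcal{A},q)=\sum_{j=0}^s(-1)^{j}\beta_j(q)q^{n-j}$ and of its $a$-constituent $f_a(\mathcal{A},t)=\sum_{j=0}^s(-1)^{j}\gamma_j(a)t^{n-j}$. Two positive integers $a,b$ are combinatorially equivalent with respect to $\mathcal{A}$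 if for all $J\subseteq[m]$ with $\bar r(J)=r(J)$: $\bigcap_{j\in J}H_{j,a}\ne\emptyset\iff\bigcap_{j\in J}H_{j,b}\ne\emptyset$ (the intersection for $J=\emptyset$ being the whole of $\mathbb{Z}_a^n$, respectively $\mathbb{Z}_b^n$). -}

module Defs where

open import Algebra.Bundles using (CommutativeRing)
import Algebra.Properties.Semiring.Sum as Summation
open import Data.Bool.Base using (if_then_else_)
open import Data.Fin.Base using (Fin; zero; suc)
import Data.Fin.Properties as Fin
open import Data.Fin.Subset using (Subset; inside; outside; ∣_∣; _∈_)
open import Data.Integer.Base as ℤ using (ℤ; +_; -[1+_]; +[1+_]; 0ℤ; 1ℤ; -1ℤ)
open import Data.Integer.Divisibility.Signed as ℤ∣ using (_∣_; divides; _∣?_; ∣⇒∣ᵤ)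
import Data.Integer.DivMod as ℤ
import Data.Integer.Properties as ℤ
import Data.Integer.Solver as ℤS
open import Data.List.Base as List using (List; []; _∷_; length)
open import Data.List.Relation.Unary.All as All using (All; []; _∷_)
open import Data.List.Relation.Unary.Linked using (Linked; []; [-]; _∷_)
open import Data.Nat.Base as ℕ using (ℕ; zero; suc; z≤n; s≤s)
import Data.Nat.Divisibility as ℕ
open import Data.Nat.GCD using (gcd)
open import Data.Nat.Induction using (Acc; acc; <-wellFounded)
open import Data.Nat.LCM using (lcm)
import Data.Nat.Properties as ℕ
open import Data.Product.Base using (Σ; ∃; ∃₂; _×_; _,_; proj₁; proj₂)
open import Data.Rational.Base as ℚ using (ℚ; 0ℚ; 1ℚ; ½)
import Data.Rational.Properties as ℚ
import Data.Rational.Solver as ℚS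
import Data.Rational.Unnormalised.Base as ℚᵘ
import Data.Rational.Unnormalised.Properties as ℚᵘ
open import Data.Sum.Base using (_⊎_; inj₁; inj₂; [_,_]′)
import Data.Vec.Base as Vec
open import Data.Vec.Functional as V using (Vector)
open import Function.Base using (_∘_)
open import Function.Bundles using (_⇔_; mk⇔; module Equivalence)
open import Level using (0ℓ)
open import Relation.Binary.PropositionalEquality as ≡ using (_≡_; _≢_)
open import Relation.Binary.Structures using (IsEquivalence)
open import Relation.Nullary using (¬_; yes; no; does; contradiction; _×-dec_)
open import Relation.Nullary.Decidable using (¬?; decidable-stable)
open import Relation.Unary using (Pred; Empty)

private
  variable
    m n k : ℕ

Matrix : Set → ℕ → ℕ → Set
Matrix X m n = Fin m → Vector X n

module Linear (R : CommutativeRing 0ℓ 0ℓ) where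

  open CommutativeRing R hiding (zero)
  open Summation semiring using (sum)

  infix  4 _≋ᵥ_ _≋_
  infixr 7 _*ᵥ_ _⊗_

  _≋ᵥ_ : ∀ {n} → Vector Carrier n → Vector Carrier n → Set
  v ≋ᵥ w = ∀ i → v i ≈ w i

  _≋_ : ∀ {m n} → Matrix Carrier m n → Matrix Carrier m n → Set
  M ≋ N = ∀ i j → M i j ≈ N i j

  _*ᵥ_ : ∀ {m n} → Matrix Carrier m n → Vector Carrier n → Vector Carrier m
  (M *ᵥ x) i = sum (λ j → M i j * x j)

  _⊗_ : ∀ {m n k} → Matrix Carrier m n → Matrix Carrier n k → Matrix Carrier m k
  (M ⊗ N) i k = sum (λ j → M i j * N j k)

  𝟙 : ∀ {n} → Matrix Carrier n n
  𝟙 zero    zero    = 1#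
  𝟙 zero    (suc j) = 0#
  𝟙 (suc i) zero    = 0#
  𝟙 (suc i) (suc j) = 𝟙 i j

  record Invertible {n} (U : Matrix Carrier n n) : Set where
    field
      inverse  : Matrix Carrier n n
      inverseˡ : inverse ⊗ U ≋ 𝟙
      inverseʳ : U ⊗ inverse ≋ 𝟙

  -- The submodule generated by the columns of N.
  Col : ∀ {m n} → Matrix Carrier m n → Pred (Vector Carrier m) 0ℓ
  Col N v = ∃ λ c → v ≋ᵥ N *ᵥ c

  Independent : ∀ {m n} → Matrix Carrier m n → Set
  Independent N = ∀ c → (∀ i → (N *ᵥ c) i ≈ 0#) → ∀ j → c j ≈ 0#

  -- The columns of B form a basis of the subspace P; over a field this determines d.
  HasDimension : ∀ {n} → Pred (Vector Carrier n) 0ℓ → ℕ → Set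
  HasDimension {n} P d =
    Σ (Matrix Carrier n d) λ B → Independent B × (∀ v → P v ⇔ Col B v)

  -- The dimension of a nonempty affine subspace is that of its translate to the origin.
  HasAffineDimension : ∀ {n} → Pred (Vector Carrier n) 0ℓ → ℕ → Set
  HasAffineDimension S d =
    ∃ λ p → S p × HasDimension (λ v → S (λ k → p k + v k)) d

  Hyperplane : ∀ {n} → Vector Carrier n → Carrier → Pred (Vector Carrier n) 0ℓ
  Hyperplane α a x = sum (λ k → α k * x k) ≈ a

module MatrixProperties (R : CommutativeRing 0ℓ 0ℓ) where

  open CommutativeRing R hiding (zero)
  open Summation semiring
  open Linear R public
  import Relation.Binary.Reasoning.Setoid setoid as SR

  private
    variable p q : ℕ

  infix 4 _∼_

  sum-zero : ∀ n (f : Vector Carrier n) → (∀ i → f i ≈ 0#) → sum f ≈ 0#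
  sum-zero n f f≈0 = trans (sum-cong-≋ f≈0) (sum-replicate-zero n)

  *ᵥ-cong : {M N : Matrix Carrier m n} {x y : Vector Carrier n} →
            M ≋ N → x ≋ᵥ y → M *ᵥ x ≋ᵥ N *ᵥ y
  *ᵥ-cong M≋N x≋y i = sum-cong-≋ (λ j → *-cong (M≋N i j) (x≋y j))

  *ᵥ-assoc : (M : Matrix Carrier m n) (N : Matrix Carrier n p) (x : Vector Carrier p) →
             (M ⊗ N) *ᵥ x ≋ᵥ M *ᵥ (N *ᵥ x)
  *ᵥ-assoc {m} {n} {p} M N x i = begin
    sum (λ k → sum (λ j → M i j * N j k) * x k)
      ≈⟨ sum-cong-≋ (λ k → *-distribʳ-sum (x k) (λ j → M i j * N j k)) ⟩
    sum (λ k → sum (λ j → M i j * N j k * x k))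
      ≈⟨ ∑-comm (λ k j → M i j * N j k * x k) ⟩
    sum (λ j → sum (λ k → M i j * N j k * x k))
      ≈⟨ sum-cong-≋ (λ j → sum-cong-≋ (λ k → *-assoc (M i j) (N j k) (x k))) ⟩
    sum (λ j → sum (λ k → M i j * (N j k * x k)))
      ≈⟨ sum-cong-≋ (λ j → sym (*-distribˡ-sum (M i j) (λ k → N j k * x k))) ⟩
    sum (λ j → M i j * sum (λ k → N j k * x k)) ∎
    where open SR

  𝟙*ᵥ : (x : Vector Carrier n) → 𝟙 *ᵥ x ≋ᵥ x
  𝟙*ᵥ {suc n} x zero    = trans (+-cong (*-identityˡ _) (sum-zero n _ (λ j → zeroˡ (x (suc j))))) (+-identityʳ _)
  𝟙*ᵥ x (suc i) = trans (+-cong (zeroˡ _) (𝟙*ᵥ (x ∘ suc) i)) (+-identityˡ _)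

  ᵥ*𝟙 : (x : Vector Carrier n) (k : Fin n) → sum (λ j → x j * 𝟙 j k) ≈ x k
  ᵥ*𝟙 {suc n} x zero    = trans (+-cong (*-identityʳ _) (sum-zero n _ (λ j → zeroʳ (x (suc j))))) (+-identityʳ _)
  ᵥ*𝟙 x (suc k) = trans (+-cong (zeroʳ _) (ᵥ*𝟙 (x ∘ suc) k)) (+-identityˡ _)

  *ᵥ0 : (M : Matrix Carrier m n) {x : Vector Carrier n} →
        (∀ j → x j ≈ 0#) → ∀ i → (M *ᵥ x) i ≈ 0#
  *ᵥ0 {n = n} M x≈0 i = sum-zero n _ (λ j → trans (*-congˡ (x≈0 j)) (zeroʳ _))

  ≋-refl : {M : Matrix Carrier m n} → M ≋ M
  ≋-refl i j = refl

  ≋-sym : {M N : Matrix Carrier m n} → M ≋ N → N ≋ M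
  ≋-sym e i j = sym (e i j)

  ≋-trans : {M N P : Matrix Carrier m n} → M ≋ N → N ≋ P → M ≋ P
  ≋-trans e f i j = trans (e i j) (f i j)

  ⊗-cong : {M M′ : Matrix Carrier m n} {N N′ : Matrix Carrier n p} →
           M ≋ M′ → N ≋ N′ → M ⊗ N ≋ M′ ⊗ N′
  ⊗-cong e f i k = sum-cong-≋ (λ j → *-cong (e i j) (f j k))

  ⊗-assoc : (M : Matrix Carrier m n) (N : Matrix Carrier n p) (P : Matrix Carrier p q) →
            (M ⊗ N) ⊗ P ≋ M ⊗ (N ⊗ P)
  ⊗-assoc M N P i k = *ᵥ-assoc M N (λ j → P j k) i

  ⊗-identityˡ : (M : Matrix Carrier m n) → 𝟙 ⊗ M ≋ M
  ⊗-identityˡ M i k = 𝟙*ᵥ (λ j → M j k) i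

  ⊗-identityʳ : (M : Matrix Carrier m n) → M ⊗ 𝟙 ≋ M
  ⊗-identityʳ M i k = ᵥ*𝟙 (M i) k

  open Invertible

  cancelˡ : {U V : Matrix Carrier n n} → U ⊗ V ≋ 𝟙 →
            (M : Matrix Carrier n p) → U ⊗ (V ⊗ M) ≋ M
  cancelˡ {U = U} {V} e M =
    ≋-trans (≋-sym (⊗-assoc U V M)) (≋-trans (⊗-cong e ≋-refl) (⊗-identityˡ M))

  cancelʳ : {U V : Matrix Carrier n n} → U ⊗ V ≋ 𝟙 →
            (M : Matrix Carrier p n) → (M ⊗ U) ⊗ V ≋ M
  cancelʳ {U = U} {V} e M =
    ≋-trans (⊗-assoc M U V) (≋-trans (⊗-cong ≋-refl e) (⊗-identityʳ M))

  𝟙-inv : Invertible (𝟙 {n})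
  𝟙-inv .inverse  = 𝟙
  𝟙-inv .inverseˡ = ⊗-identityˡ 𝟙
  𝟙-inv .inverseʳ = ⊗-identityˡ 𝟙

  inv-inv : {U : Matrix Carrier n n} (i : Invertible U) → Invertible (inverse i)
  inv-inv {U = U} i .inverse = U
  inv-inv i .inverseˡ = inverseʳ i
  inv-inv i .inverseʳ = inverseˡ i

  ⊗-inv : {U V : Matrix Carrier n n} → Invertible U → Invertible V → Invertible (U ⊗ V)
  ⊗-inv i j .inverse = inverse j ⊗ inverse i
  ⊗-inv {U = U} {V} i j .inverseˡ =
    ≋-trans (⊗-assoc (inverse j) (inverse i) (U ⊗ V))
      (≋-trans (⊗-cong ≋-refl (cancelˡ (inverseˡ i) V)) (inverseˡ j))
  ⊗-inv {U = U} {V} i j .inverseʳ =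
    ≋-trans (⊗-assoc U V (inverse j ⊗ inverse i))
      (≋-trans (⊗-cong ≋-refl (cancelˡ (inverseʳ j) (inverse i))) (inverseʳ i))

  record _∼_ {m n} (M N : Matrix Carrier m n) : Set where
    constructor equivalence
    field
      {U} : Matrix Carrier m m
      {V} : Matrix Carrier n n
      U-inv : Invertible U
      V-inv : Invertible V
      equation : M ≋ U ⊗ (N ⊗ V)

  ∼-trans : {M N P : Matrix Carrier m n} → M ∼ N → N ∼ P → M ∼ P
  ∼-trans {M = M} {N} {P} (equivalence {U} {V} i j e) (equivalence {U′} {V′} i′ j′ e′) =
    equivalence (⊗-inv i i′) (⊗-inv j′ j) λ x y → begin
      M x y                              ≈⟨ e x y ⟩
      (U ⊗ (N ⊗ V)) x y                  ≈⟨ ⊗-cong {M = U} ≋-refl (⊗-cong {N = V} e′ ≋-refl) x y ⟩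
      (U ⊗ ((U′ ⊗ (P ⊗ V′)) ⊗ V)) x y    ≈⟨ ⊗-cong {M = U} ≋-refl (⊗-assoc U′ (P ⊗ V′) V) x y ⟩
      (U ⊗ (U′ ⊗ ((P ⊗ V′) ⊗ V))) x y    ≈⟨ ⊗-cong {M = U} ≋-refl (⊗-cong {M = U′} ≋-refl (⊗-assoc P V′ V)) x y ⟩
      (U ⊗ (U′ ⊗ (P ⊗ (V′ ⊗ V)))) x y    ≈⟨ sym (⊗-assoc U U′ (P ⊗ (V′ ⊗ V)) x y) ⟩
      ((U ⊗ U′) ⊗ (P ⊗ (V′ ⊗ V))) x y    ∎
    where open SR

  ∼-left : {U : Matrix Carrier m m} → Invertible U →
           (M : Matrix Carrier m n) → M ∼ (U ⊗ M)
  ∼-left {U = U} i M = equivalence (inv-inv i) 𝟙-inv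
    (≋-sym (≋-trans (⊗-cong {M = inverse i} ≋-refl (⊗-identityʳ (U ⊗ M))) (cancelˡ (inverseˡ i) M)))

  ∼-right : {V : Matrix Carrier n n} → Invertible V →
            (M : Matrix Carrier m n) → M ∼ (M ⊗ V)
  ∼-right {V = V} i M = equivalence 𝟙-inv (inv-inv i)
    (≋-sym (≋-trans (⊗-identityˡ _) (cancelʳ (inverseʳ i) M)))

  ∼-reflexive : {M N : Matrix Carrier m n} → M ≋ N → M ∼ N
  ∼-reflexive {N = N} e = equivalence 𝟙-inv 𝟙-inv
    (≋-trans e (≋-sym (≋-trans (⊗-identityˡ _) (⊗-identityʳ N))))

  block : Carrier → Vector Carrier n → Vector Carrier m →
          Matrix Carrier m n → Matrix Carrier (suc m) (suc n)
  block x r c B zero    zero    = x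
  block x r c B zero    (suc j) = r j
  block x r c B (suc i) zero    = c i
  block x r c B (suc i) (suc j) = B i j

  𝟘ᵥ : Vector Carrier n
  𝟘ᵥ _ = 0#

  sum0ˡ : ∀ n (x : Vector Carrier n) → sum (λ k → 0# * x k) ≈ 0#
  sum0ˡ n x = sum-zero n _ (λ k → zeroˡ (x k))

  sum0ʳ : ∀ n (x : Vector Carrier n) → sum (λ k → x k * 0#) ≈ 0#
  sum0ʳ n x = sum-zero n _ (λ k → zeroʳ (x k))

  +0 : ∀ {x y z} → x ≈ y → z ≈ 0# → x + z ≈ y
  +0 e f = trans (+-cong e f) (+-identityʳ _)

  0+ : ∀ {x y z} → z ≈ 0# → x ≈ y → z + x ≈ y
  0+ f e = trans (+-cong f e) (+-identityˡ _)

  diag-inv : {ε ε′ : Carrier} → ε * ε′ ≈ 1# → {U : Matrix Carrier n n} →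
             Invertible U → Invertible (block ε 𝟘ᵥ 𝟘ᵥ U)
  diag-inv {ε = ε} {ε′} e i .inverse = block ε′ 𝟘ᵥ 𝟘ᵥ (inverse i)
  diag-inv {n = n} e i .inverseˡ zero zero = +0 (trans (*-comm _ _) e) (sum0ˡ n _)
  diag-inv {n = n} e i .inverseˡ zero (suc y) = 0+ (zeroʳ _) (sum0ˡ n _)
  diag-inv {n = n} e i .inverseˡ (suc x) zero = 0+ (zeroˡ _) (sum0ʳ n _)
  diag-inv {n = n} e i .inverseˡ (suc x) (suc y) = 0+ (zeroʳ _) (inverseˡ i x y)
  diag-inv {n = n} e i .inverseʳ zero zero = +0 e (sum0ˡ n _)
  diag-inv {n = n} e i .inverseʳ zero (suc y) = 0+ (zeroʳ _) (sum0ˡ n _)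
  diag-inv {n = n} e i .inverseʳ (suc x) zero = 0+ (zeroˡ _) (sum0ʳ n _)
  diag-inv {n = n} e i .inverseʳ (suc x) (suc y) = 0+ (zeroʳ _) (inverseʳ i x y)

  lower-mul : (c c′ : Vector Carrier n) → (∀ i → c i + c′ i ≈ 0#) →
              block 1# 𝟘ᵥ c 𝟙 ⊗ block 1# 𝟘ᵥ c′ 𝟙 ≋ 𝟙
  lower-mul {n} c c′ e zero    zero    = +0 (*-identityˡ _) (sum0ˡ n _)
  lower-mul {n} c c′ e zero    (suc y) = 0+ (zeroʳ _) (sum0ˡ n _)
  lower-mul {n} c c′ e (suc x) zero    = trans (+-cong (*-identityʳ _) (𝟙*ᵥ c′ x)) (e x)
  lower-mul {n} c c′ e (suc x) (suc y) = 0+ (zeroʳ _) (⊗-identityˡ 𝟙 x y)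

  upper-mul : (r r′ : Vector Carrier n) → (∀ i → r i + r′ i ≈ 0#) →
              block 1# r 𝟘ᵥ 𝟙 ⊗ block 1# r′ 𝟘ᵥ 𝟙 ≋ 𝟙
  upper-mul {n} r r′ e zero    zero    = +0 (*-identityˡ _) (sum0ʳ n _)
  upper-mul {n} r r′ e zero    (suc y) =
    trans (+-cong (*-identityˡ _) (ᵥ*𝟙 r y)) (trans (+-comm _ _) (e y))
  upper-mul {n} r r′ e (suc x) zero    = 0+ (zeroˡ _) (sum0ʳ n _)
  upper-mul {n} r r′ e (suc x) (suc y) = 0+ (zeroˡ _) (⊗-identityˡ 𝟙 x y)

  lower-inv : (c : Vector Carrier n) → Invertible (block 1# 𝟘ᵥ c 𝟙)
  lower-inv c .inverse = block 1# 𝟘ᵥ (-_ ∘ c) 𝟙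
  lower-inv c .inverseˡ = lower-mul (-_ ∘ c) c (λ i → -‿inverseˡ (c i))
  lower-inv c .inverseʳ = lower-mul c (-_ ∘ c) (λ i → -‿inverseʳ (c i))

  upper-inv : (r : Vector Carrier n) → Invertible (block 1# r 𝟘ᵥ 𝟙)
  upper-inv r .inverse = block 1# (-_ ∘ r) 𝟘ᵥ 𝟙
  upper-inv r .inverseˡ = upper-mul (-_ ∘ r) r (λ i → -‿inverseˡ (r i))
  upper-inv r .inverseʳ = upper-mul r (-_ ∘ r) (λ i → -‿inverseʳ (r i))

  -- A pivot that divides its row and column can be split off.
  split : (M : Matrix Carrier (suc m) (suc n)) (r : Vector Carrier n) (c : Vector Carrier m) →
          (∀ j → M zero (suc j) ≈ M zero zero * r j) →
          (∀ i → M (suc i) zero ≈ c i * M zero zero) →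
          M ∼ block (M zero zero) 𝟘ᵥ 𝟘ᵥ (λ i j → M (suc i) (suc j) - c i * M zero zero * r j)
  split {m} {n} M r c er ec = equivalence (lower-inv c) (upper-inv r) eq
    where
    pv = M zero zero
    B : Matrix Carrier m n
    B i j = M (suc i) (suc j) - c i * pv * r j
    N = block pv 𝟘ᵥ 𝟘ᵥ B ⊗ block 1# r 𝟘ᵥ 𝟙
    N≋ : N ≋ block pv (λ j → pv * r j) 𝟘ᵥ B
    N≋ zero    zero    = +0 (*-identityʳ _) (sum0ˡ n _)
    N≋ zero    (suc y) = +0 refl (sum0ˡ n _)
    N≋ (suc x) zero    = 0+ (zeroˡ _) (sum0ʳ n _)
    N≋ (suc x) (suc y) = 0+ (zeroˡ _) (⊗-identityʳ B x y)
    eq′ : block 1# 𝟘ᵥ c 𝟙 ⊗ block pv (λ j → pv * r j) 𝟘ᵥ B ≋ M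
    eq′ zero    zero    = +0 (*-identityˡ _) (sum0ʳ m _)
    eq′ zero    (suc y) = +0 (trans (*-identityˡ _) (sym (er y))) (sum0ˡ m _)
    eq′ (suc x) zero    = +0 (sym (ec x)) (sum0ʳ m _)
    eq′ (suc x) (suc y) = begin
      c x * (pv * r y) + sum (λ k → 𝟙 x k * B k y)
        ≈⟨ +-cong (sym (*-assoc _ _ _)) (⊗-identityˡ B x y) ⟩
      c x * pv * r y + (M (suc x) (suc y) + - (c x * pv * r y))  ≈⟨ +-comm _ _ ⟩
      (M (suc x) (suc y) + - (c x * pv * r y)) + c x * pv * r y  ≈⟨ +-assoc _ _ _ ⟩
      M (suc x) (suc y) + (- (c x * pv * r y) + c x * pv * r y)  ≈⟨ +0 refl (-‿inverseˡ _) ⟩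
      M (suc x) (suc y) ∎
      where open SR
    eq : M ≋ block 1# 𝟘ᵥ c 𝟙 ⊗ N
    eq = ≋-sym (≋-trans (⊗-cong {M = block 1# 𝟘ᵥ c 𝟙} ≋-refl N≋) eq′)

  block-∼ : {x ε d : Carrier} → ε * ε ≈ 1# → x ≈ ε * d →
            {M N : Matrix Carrier m n} → M ∼ N →
            block x 𝟘ᵥ 𝟘ᵥ M ∼ block d 𝟘ᵥ 𝟘ᵥ N
  block-∼ {m} {n} {x = x} {ε} {d} εε x≈ {M} {N} (equivalence {U} {V} i j e) =
    equivalence (diag-inv εε i) (diag-inv (*-identityˡ 1#) j) (≋-sym (≋-trans (⊗-cong {M = block ε 𝟘ᵥ 𝟘ᵥ U} ≋-refl s₁) s₂))
    where
    s₁ : block d 𝟘ᵥ 𝟘ᵥ N ⊗ block 1# 𝟘ᵥ 𝟘ᵥ V ≋ block d 𝟘ᵥ 𝟘ᵥ (N ⊗ V)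
    s₁ zero    zero    = +0 (*-identityʳ _) (sum0ˡ n _)
    s₁ zero    (suc y) = +0 (zeroʳ _) (sum0ˡ n _)
    s₁ (suc x) zero    = 0+ (zeroˡ _) (sum0ʳ n _)
    s₁ (suc x) (suc y) = 0+ (zeroˡ _) refl
    s₂ : block ε 𝟘ᵥ 𝟘ᵥ U ⊗ block d 𝟘ᵥ 𝟘ᵥ (N ⊗ V) ≋ block x 𝟘ᵥ 𝟘ᵥ M
    s₂ zero    zero    = +0 (sym x≈) (sum0ˡ m _)
    s₂ zero    (suc y) = +0 (zeroʳ _) (sum0ˡ m _)
    s₂ (suc x) zero    = 0+ (zeroˡ _) (sum0ʳ m _)
    s₂ (suc x) (suc y) = 0+ (zeroˡ _) (sym (e x y))

  𝟙-diag : (k : Fin n) → 𝟙 k k ≈ 1#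
  𝟙-diag zero    = refl
  𝟙-diag (suc k) = 𝟙-diag k

  𝟙-off : {i k : Fin n} → ¬ i ≡ k → 𝟙 i k ≈ 0#
  𝟙-off {i = zero}  {zero}  ne = contradiction ≡.refl ne
  𝟙-off {i = zero}  {suc k} ne = refl
  𝟙-off {i = suc i} {zero}  ne = refl
  𝟙-off {i = suc i} {suc k} ne = 𝟙-off (ne ∘ ≡.cong suc)

  E : Fin n → Fin n → Carrier → Matrix Carrier n n
  E k i c x y = 𝟙 x y + 𝟙 x k * c * 𝟙 i y

  E⊗ : (k i : Fin m) (c : Carrier) (M : Matrix Carrier m n) →
       ∀ x y → (E k i c ⊗ M) x y ≈ M x y + 𝟙 x k * c * M i y
  E⊗ {m} k i c M x y = begin
    sum (λ z → (𝟙 x z + 𝟙 x k * c * 𝟙 i z) * M z y)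
      ≈⟨ sum-cong-≋ {m} (λ z → trans (distribʳ (M z y) (𝟙 x z) (𝟙 x k * c * 𝟙 i z)) (+-congˡ (*-assoc (𝟙 x k * c) (𝟙 i z) (M z y)))) ⟩
    sum (λ z → 𝟙 x z * M z y + 𝟙 x k * c * (𝟙 i z * M z y))
      ≈⟨ ∑-distrib-+ (λ z → 𝟙 x z * M z y) (λ z → 𝟙 x k * c * (𝟙 i z * M z y)) ⟩
    sum (λ z → 𝟙 x z * M z y) + sum (λ z → 𝟙 x k * c * (𝟙 i z * M z y))
      ≈⟨ +-cong (⊗-identityˡ M x y)
           (trans (sym (*-distribˡ-sum (𝟙 x k * c) (λ z → 𝟙 i z * M z y))) (*-congˡ (⊗-identityˡ M i y))) ⟩
    M x y + 𝟙 x k * c * M i y ∎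
    where open SR

  ⊗E : (k i : Fin n) (c : Carrier) (M : Matrix Carrier m n) →
       ∀ x y → (M ⊗ E k i c) x y ≈ M x y + M x k * c * 𝟙 i y
  ⊗E {n} k i c M x y = begin
    sum (λ z → M x z * (𝟙 z y + 𝟙 z k * c * 𝟙 i y))
      ≈⟨ sum-cong-≋ {n} (λ z → trans (distribˡ (M x z) (𝟙 z y) (𝟙 z k * c * 𝟙 i y))
           (+-congˡ (trans (*-congˡ (*-assoc (𝟙 z k) c (𝟙 i y))) (sym (*-assoc (M x z) (𝟙 z k) (c * 𝟙 i y)))))) ⟩
    sum (λ z → M x z * 𝟙 z y + M x z * 𝟙 z k * (c * 𝟙 i y))
      ≈⟨ ∑-distrib-+ (λ z → M x z * 𝟙 z y) (λ z → M x z * 𝟙 z k * (c * 𝟙 i y)) ⟩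
    sum (λ z → M x z * 𝟙 z y) + sum (λ z → M x z * 𝟙 z k * (c * 𝟙 i y))
      ≈⟨ +-cong (⊗-identityʳ M x y)
           (trans (sym (*-distribʳ-sum (c * 𝟙 i y) (λ z → M x z * 𝟙 z k)))
             (trans (*-congʳ (⊗-identityʳ M x k)) (sym (*-assoc _ _ _)))) ⟩
    M x y + M x k * c * 𝟙 i y ∎
    where open SR

  E-mul : {k i : Fin n} → ¬ i ≡ k → {c d : Carrier} → c + d ≈ 0# → E k i c ⊗ E k i d ≋ 𝟙
  E-mul {k = k} {i} ne {c} {d} e x y = begin
    (E k i c ⊗ E k i d) x y   ≈⟨ E⊗ k i c (E k i d) x y ⟩
    𝟙 x y + 𝟙 x k * d * 𝟙 i y + 𝟙 x k * c * (𝟙 i y + 𝟙 i k * d * 𝟙 i y)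
      ≈⟨ +-congˡ (*-congˡ (+0 refl (trans (*-congʳ (trans (*-congʳ (𝟙-off ne)) (zeroˡ _))) (zeroˡ _)))) ⟩
    𝟙 x y + 𝟙 x k * d * 𝟙 i y + 𝟙 x k * c * 𝟙 i y
      ≈⟨ +-assoc _ _ _ ⟩
    𝟙 x y + (𝟙 x k * d * 𝟙 i y + 𝟙 x k * c * 𝟙 i y)
      ≈⟨ +0 refl (trans (sym (distribʳ _ _ _)) (trans (*-congʳ (trans (sym (distribˡ _ _ _))
           (trans (*-congˡ (trans (+-comm _ _) e)) (zeroʳ _)))) (zeroˡ _))) ⟩
    𝟙 x y ∎
    where open SR

  E-inv : {k i : Fin n} → ¬ i ≡ k → (c : Carrier) → Invertible (E k i c)
  E-inv {k = k} {i} ne c .inverse = E k i (- c)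
  E-inv ne c .inverseˡ = E-mul ne (-‿inverseˡ c)
  E-inv ne c .inverseʳ = E-mul ne (-‿inverseʳ c)

  addRow : {k i : Fin m} → ¬ i ≡ k → (c : Carrier) (M : Matrix Carrier m n) →
           M ∼ (λ x y → M x y + 𝟙 x k * c * M i y)
  addRow {k = k} {i} ne c M = ∼-trans (∼-left (E-inv ne c) M) (∼-reflexive (E⊗ k i c M))

  -- Column i gains c times column k.
  addCol : {k i : Fin n} → ¬ i ≡ k → (c : Carrier) (M : Matrix Carrier m n) →
           M ∼ (λ x y → M x y + M x k * c * 𝟙 i y)
  addCol {k = k} {i} ne c M = ∼-trans (∼-right (E-inv ne c) M) (∼-reflexive (⊗E k i c M))

module Smith where

  open ≡ using (refl; sym; trans; cong; cong₂; subst)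
  open MatrixProperties ℤ.+-*-commutativeRing
  open Summation (CommutativeRing.semiring ℤ.+-*-commutativeRing) using (sum)

  diagonal : List ℕ → Matrix ℤ m n
  diagonal []       i       j       = 0ℤ
  diagonal (d ∷ ds) zero    zero    = + d
  diagonal (d ∷ ds) zero    (suc j) = 0ℤ
  diagonal (d ∷ ds) (suc i) zero    = 0ℤ
  diagonal (d ∷ ds) (suc i) (suc j) = diagonal ds i j

  -- Unimodular means invertible over ℤ, so the equation says that the normal form
  -- U⁻¹ M V⁻¹ is diagonal. factors lists its nonzero diagonal entries.
  record SmithNormalForm {m n} (M : Matrix ℤ m n) : Set where
    field
      U : Matrix ℤ m m
      V : Matrix ℤ n n
      U-unimodular : Invertible U
      V-unimodular : Invertible V
      factors : List ℕ
      length≤m : length factors ℕ.≤ m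
      length≤n : length factors ℕ.≤ n
      positive : All (0 ℕ.<_) factors
      chain    : Linked ℕ._∣_ factors
      equation : M ≋ U ⊗ (diagonal factors ⊗ V)

  ∣-sum : ∀ {p} (f : Vector ℤ n) → (∀ i → p ∣ f i) → p ∣ sum f
  ∣-sum {zero}  f h = divides 0ℤ refl
  ∣-sum {suc n} f h = ℤ∣.∣m∣n⇒∣m+n (h zero) (∣-sum (f ∘ suc) (h ∘ suc))

  ∣-⊗ˡ : ∀ {k p} (M : Matrix ℤ m n) (N : Matrix ℤ n k) →
         (∀ i j → p ∣ M i j) → ∀ i j → p ∣ (M ⊗ N) i j
  ∣-⊗ˡ M N h i j = ∣-sum (λ l → M i l ℤ.* N l j) (λ l → ℤ∣.∣m⇒∣m*n (N l j) (h i l))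

  ∣-⊗ʳ : ∀ {k p} (M : Matrix ℤ m n) (N : Matrix ℤ n k) →
         (∀ i j → p ∣ N i j) → ∀ i j → p ∣ (M ⊗ N) i j
  ∣-⊗ʳ M N h i j = ∣-sum (λ l → M i l ℤ.* N l j) (λ l → ℤ∣.∣n⇒∣m*n (M i l) (h l j))

  Entry : (M : Matrix ℤ m n) → ℕ → Set
  Entry {m} {n} M k = ∃₂ λ (i : Fin m) (j : Fin n) → M i j ≢ 0ℤ × ℤ.∣ M i j ∣ ℕ.< k

  Improved : (M : Matrix ℤ m n) → ℕ → Set
  Improved {m} {n} M k = Σ (Matrix ℤ m n) λ N → M ∼ N × Entry N k

  remainder : (p x : ℤ) → p ≢ 0ℤ → ¬ p ∣ x →
              ∃ λ c → x ℤ.+ c ℤ.* p ≢ 0ℤ × ℤ.∣ x ℤ.+ c ℤ.* p ∣ ℕ.< ℤ.∣ p ∣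
  remainder p x p≢0 p∤x = ℤ.- q , ≢0 , subst (λ z → ℤ.∣ z ∣ ℕ.< ℤ.∣ p ∣) (sym eq) (ℤ.n%d<d x p)
    where
    instance _ = ℤ.≢-nonZero p≢0
    q = x ℤ./ p
    r = x ℤ.% p
    open ℤS.+-*-Solver
    eq : x ℤ.+ (ℤ.- q) ℤ.* p ≡ + r
    eq = trans (cong (ℤ._+ (ℤ.- q) ℤ.* p) (ℤ.a≡a%n+[a/n]*n x p))
               (solve 3 (λ r q p → (r :+ q :* p) :+ (:- q) :* p := r) refl (+ r) q p)
    ≢0 : x ℤ.+ (ℤ.- q) ℤ.* p ≢ 0ℤ
    ≢0 e = p∤x (divides q (trans (solve 3 (λ x q p → x := (x :+ (:- q) :* p) :+ q :* p) refl x q p)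
                                 (trans (cong (ℤ._+ q ℤ.* p) e) (ℤ.+-identityˡ _))))

  colStep : (M : Matrix ℤ m n) (i : Fin m) (j l : Fin n) →
            M i j ≢ 0ℤ → ¬ M i j ∣ M i l → Improved M ℤ.∣ M i j ∣
  colStep M i j l p≢0 p∤ = _ , addCol l≢j c M , i , l , subst (_≢ 0ℤ) eq ≢0 ,
      subst (λ z → ℤ.∣ z ∣ ℕ.< ℤ.∣ M i j ∣) eq lt
    where
    rem = remainder (M i j) (M i l) p≢0 p∤
    c   = proj₁ rem
    ≢0  = proj₁ (proj₂ rem)
    lt  = proj₂ (proj₂ rem)
    l≢j : ¬ l ≡ j
    l≢j refl = p∤ ℤ∣.∣-refl
    eq : M i l ℤ.+ c ℤ.* M i j ≡ M i l ℤ.+ M i j ℤ.* c ℤ.* 𝟙 l l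
    eq rewrite 𝟙-diag l | ℤ.*-identityʳ (M i j ℤ.* c) | ℤ.*-comm c (M i j) = refl

  rowStep : (M : Matrix ℤ m n) (i k : Fin m) (j : Fin n) →
            M i j ≢ 0ℤ → ¬ M i j ∣ M k j → Improved M ℤ.∣ M i j ∣
  rowStep M i k j p≢0 p∤ = _ , addRow i≢k c M , k , j , subst (_≢ 0ℤ) eq ≢0 ,
      subst (λ z → ℤ.∣ z ∣ ℕ.< ℤ.∣ M i j ∣) eq lt
    where
    rem = remainder (M i j) (M k j) p≢0 p∤
    c   = proj₁ rem
    ≢0  = proj₁ (proj₂ rem)
    lt  = proj₂ (proj₂ rem)
    i≢k : ¬ i ≡ k
    i≢k refl = p∤ ℤ∣.∣-refl
    eq : M k j ℤ.+ c ℤ.* M i j ≡ M k j ℤ.+ 𝟙 k k ℤ.* c ℤ.* M i j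
    eq rewrite 𝟙-diag k | ℤ.*-identityˡ c = refl

  -- If row k has entry q * p below p, adding 1 - q times row i to it turns that entry into p.
  copyRow : (M : Matrix ℤ m n) (i k : Fin m) (j : Fin n) → ¬ i ≡ k → M i j ∣ M k j →
            ∃ λ c → M k j ℤ.+ 𝟙 k k ℤ.* c ℤ.* M i j ≡ M i j
  copyRow M i k j i≢k (divides q e) = 1ℤ ℤ.- q ,
    trans (cong₂ (λ u v → u ℤ.+ v ℤ.* (1ℤ ℤ.- q) ℤ.* M i j) e (𝟙-diag k))
      (solve 2 (λ p q → q :* p :+ con 1ℤ :* (con 1ℤ :- q) :* p := p) refl (M i j) q)
    where open ℤS.+-*-Solver

  copyCol : (M : Matrix ℤ m n) (i : Fin m) (j l : Fin n) → ¬ l ≡ j → M i j ∣ M i l →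
            ∃ λ c → M i l ℤ.+ M i j ℤ.* c ℤ.* 𝟙 l l ≡ M i j
  copyCol M i j l l≢j (divides q e) = 1ℤ ℤ.- q ,
    trans (cong₂ (λ u v → u ℤ.+ M i j ℤ.* (1ℤ ℤ.- q) ℤ.* v) e (𝟙-diag l))
      (solve 2 (λ p q → q :* p :+ p :* (con 1ℤ :- q) :* con 1ℤ := p) refl (M i j) q)
    where open ℤS.+-*-Solver

  improve : (M : Matrix ℤ m n) (i k : Fin m) (j l : Fin n) →
            M i j ≢ 0ℤ → ¬ M i j ∣ M k l → Improved M ℤ.∣ M i j ∣
  improve {m} {n} M i k j l p≢0 p∤ with M i j ∣? M i l | M i j ∣? M k j
  ... | no p∤il | _       = colStep M i j l p≢0 p∤il
  ... | yes _   | no p∤kj = rowStep M i k j p≢0 p∤kj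
  ... | yes p∣il | yes p∣kj = N′ , ∼-trans M∼N N∼N′ , subst (λ z → Entry N′ ℤ.∣ z ∣) Nkj ent
    where
    p = M i j
    i≢k : ¬ i ≡ k
    i≢k refl = p∤ p∣il
    cp = copyRow M i k j i≢k p∣kj
    c  = proj₁ cp
    Nkj = proj₂ cp
    N : Matrix ℤ m n
    N x y = M x y ℤ.+ 𝟙 x k ℤ.* c ℤ.* M i y
    M∼N : M ∼ N
    M∼N = addRow i≢k c M
    ∤N : ¬ N k j ∣ N k l
    ∤N h = p∤ (ℤ∣.∣m+n∣n⇒∣m (subst (_∣ N k l) Nkj h) (ℤ∣.∣n⇒∣m*n (𝟙 k k ℤ.* c) p∣il))
    st = colStep N k j l (subst (_≢ 0ℤ) (sym Nkj) p≢0) ∤N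
    N′ = proj₁ st
    N∼N′ = proj₁ (proj₂ st)
    ent = proj₂ (proj₂ st)

  Pivoted : Matrix ℤ (suc m) (suc n) → Set
  Pivoted {m} {n} M = Σ (Matrix ℤ (suc m) (suc n)) λ N →
    M ∼ N × N zero zero ≢ 0ℤ × (∀ k l → N zero zero ∣ N k l)

  toCornerRow : (M : Matrix ℤ (suc m) (suc n)) (i : Fin (suc m)) (j : Fin (suc n)) →
                M i j ≢ 0ℤ → (∀ k l → M i j ∣ M k l) →
                Σ (Matrix ℤ (suc m) (suc n)) λ N →
                  M ∼ N × N zero j ≢ 0ℤ × (∀ k l → N zero j ∣ N k l)
  toCornerRow M zero j p≢0 h = M , ∼-reflexive ≋-refl , p≢0 , h
  toCornerRow M i@(suc _) j p≢0 h = _ , addRow {k = zero} {i} (λ ()) c M ,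
      subst (_≢ 0ℤ) (sym eq) p≢0 ,
      λ k l → subst (_∣ (M k l ℤ.+ 𝟙 k zero ℤ.* c ℤ.* M i l)) (sym eq)
        (ℤ∣.∣m∣n⇒∣m+n (h k l) (ℤ∣.∣n⇒∣m*n (𝟙 k zero ℤ.* c) (h i l)))
    where
    cp = copyRow M i zero j (λ ()) (h zero j)
    c  = proj₁ cp
    eq = proj₂ cp

  toCornerCol : (M : Matrix ℤ (suc m) (suc n)) (j : Fin (suc n)) →
                M zero j ≢ 0ℤ → (∀ k l → M zero j ∣ M k l) → Pivoted M
  toCornerCol M zero p≢0 h = M , ∼-reflexive ≋-refl , p≢0 , h
  toCornerCol M j@(suc _) p≢0 h = _ , addCol {k = j} {zero} (λ ()) c M ,
      subst (_≢ 0ℤ) (sym eq) p≢0 ,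
      λ k l → subst (_∣ (M k l ℤ.+ M k j ℤ.* c ℤ.* 𝟙 zero l)) (sym eq)
        (ℤ∣.∣m∣n⇒∣m+n (h k l) (ℤ∣.∣m⇒∣m*n (𝟙 zero l) (ℤ∣.∣m⇒∣m*n c (h k j))))
    where
    cp = copyCol M zero j zero (λ ()) (h zero zero)
    c  = proj₁ cp
    eq = proj₂ cp

  pivot : (M : Matrix ℤ (suc m) (suc n)) (i : Fin (suc m)) (j : Fin (suc n)) →
          M i j ≢ 0ℤ → Acc ℕ._<_ ℤ.∣ M i j ∣ → Pivoted M
  pivot M i j p≢0 (acc rs)
    with Fin.any? (λ k → Fin.any? (λ l → ¬? (M i j ∣? M k l)))
  ... | yes (k , l , p∤) =
    let N , M∼N , i′ , j′ , ≢0 , lt = improve M i k j l p≢0 p∤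
        P , N∼P , rest = pivot N i′ j′ ≢0 (rs lt)
    in P , ∼-trans M∼N N∼P , rest
  ... | no none =
    let N , M∼N , ≢0 , h = toCornerRow M i j p≢0
          (λ k l → decidable-stable (M i j ∣? M k l) (λ p∤ → none (k , l , p∤)))
        P , N∼P , rest = toCornerCol N j ≢0 h
    in P , ∼-trans M∼N N∼P , rest

  sgn : ℤ → ℤ
  sgn (+ _)      = 1ℤ
  sgn (-[1+ _ ]) = -1ℤ

  sgn² : ∀ x → sgn x ℤ.* sgn x ≡ 1ℤ
  sgn² (+ _)      = refl
  sgn² (-[1+ _ ]) = refl

  sgn-abs : ∀ x → x ≡ sgn x ℤ.* + ℤ.∣ x ∣
  sgn-abs (+ n)      = sym (ℤ.*-identityˡ (+ n))
  sgn-abs (-[1+ n ]) = sym (ℤ.-1*i≡-i +[1+ n ])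

  open Invertible

  head-divides : ∀ {d ds} (D : ℤ) (M : Matrix ℤ m n) (s : M ∼ diagonal (d ∷ ds)) →
                 length (d ∷ ds) ℕ.≤ m → length (d ∷ ds) ℕ.≤ n →
                 (∀ i j → D ∣ M i j) → D ∣ + d
  head-divides {suc m} {suc n} {d} {ds} D M (equivalence {U} {V} u v e) _ _ h =
    subst (D ∣_) eq (∣-⊗ˡ (inverse u ⊗ M) (inverse v) (∣-⊗ʳ (inverse u) M h) zero zero)
    where
    Δ : Matrix ℤ (suc m) (suc n)
    Δ = diagonal (d ∷ ds)
    eq : ((inverse u ⊗ M) ⊗ inverse v) zero zero ≡ + d
    eq = trans (⊗-cong {N = inverse v} (≋-trans (⊗-cong {M = inverse u} ≋-refl e)
                         (cancelˡ {U = inverse u} {U} (inverseˡ u) (Δ ⊗ V))) ≋-refl zero zero)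
               (cancelʳ {U = V} {inverse v} (inverseʳ v) Δ zero zero)

  linked : ∀ {d ds} → (∀ {e es} → ds ≡ e ∷ es → d ℕ.∣ e) → Linked ℕ._∣_ ds → Linked ℕ._∣_ (d ∷ ds)
  linked {ds = []}     h l = [-]
  linked {ds = e ∷ es} h l = h refl ∷ l

  fromPivot : {M : Matrix ℤ (suc m) (suc n)} → Pivoted M →
              ((B : Matrix ℤ m n) → SmithNormalForm B) → SmithNormalForm M
  fromPivot {m} {n} {M} (N , M∼N , p≢0 , p∣) smith = record
    { U = _∼_.U M∼Δ ; V = _∼_.V M∼Δ
    ; U-unimodular = _∼_.U-inv M∼Δ ; V-unimodular = _∼_.V-inv M∼Δ
    ; factors = d ∷ factors
    ; length≤m = s≤s length≤m ; length≤n = s≤s length≤n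
    ; positive = ℕ.n≢0⇒n>0 (p≢0 ∘ ℤ.∣i∣≡0⇒i≡0) ∷ positive
    ; chain = linked d∣ chain
    ; equation = _∼_.equation M∼Δ }
    where
    p = N zero zero
    d = ℤ.∣ p ∣
    r : Vector ℤ n
    r j = _∣_.quotient (p∣ zero (suc j))
    c : Vector ℤ m
    c i = _∣_.quotient (p∣ (suc i) zero)
    B : Matrix ℤ m n
    B i j = N (suc i) (suc j) ℤ.- c i ℤ.* p ℤ.* r j
    N∼ : N ∼ block p 𝟘ᵥ 𝟘ᵥ B
    N∼ = split N r c (λ j → trans (_∣_.equality (p∣ zero (suc j))) (ℤ.*-comm (r j) p))
                     (λ i → _∣_.equality (p∣ (suc i) zero))
    p∣B : ∀ i j → p ∣ B i j
    p∣B i j = ℤ∣.∣m∣n⇒∣m-n (p∣ (suc i) (suc j)) (ℤ∣.∣m⇒∣m*n (r j) (ℤ∣.∣n⇒∣m*n (c i) ℤ∣.∣-refl))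
    S = smith B
    open SmithNormalForm S using (factors; length≤m; length≤n; positive; chain)
    B∼ : B ∼ diagonal factors
    B∼ = equivalence (SmithNormalForm.U-unimodular S) (SmithNormalForm.V-unimodular S)
                     (SmithNormalForm.equation S)
    block≋ : block (+ d) 𝟘ᵥ 𝟘ᵥ (diagonal factors) ≋ diagonal {suc m} {suc n} (d ∷ factors)
    block≋ zero    zero    = refl
    block≋ zero    (suc j) = refl
    block≋ (suc i) zero    = refl
    block≋ (suc i) (suc j) = refl
    M∼Δ : M ∼ diagonal (d ∷ factors)
    M∼Δ = ∼-trans {N = N} M∼N (∼-trans {N = block p 𝟘ᵥ 𝟘ᵥ B} N∼
            (∼-trans {N = block (+ d) 𝟘ᵥ 𝟘ᵥ (diagonal factors)} (block-∼ {ε = sgn p} {d = + d} (sgn² p) (sgn-abs p) B∼) (∼-reflexive block≋)))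
    d∣ : ∀ {e es} → factors ≡ e ∷ es → d ℕ.∣ e
    d∣ {e} {es} eq = ∣⇒∣ᵤ (head-divides {ds = es} p B (subst (λ z → B ∼ diagonal z) eq B∼)
      (subst (λ z → length z ℕ.≤ m) eq length≤m) (subst (λ z → length z ℕ.≤ n) eq length≤n) p∣B)

  smithNormalForm : (M : Matrix ℤ m n) → SmithNormalForm M
  smithNormalForm {zero} {n} M = record
    { U = 𝟙 ; V = 𝟙 ; U-unimodular = 𝟙-inv ; V-unimodular = 𝟙-inv
    ; factors = [] ; length≤m = z≤n ; length≤n = z≤n ; positive = [] ; chain = []
    ; equation = λ () }
  smithNormalForm {suc m} {zero} M = record
    { U = 𝟙 ; V = 𝟙 ; U-unimodular = 𝟙-inv ; V-unimodular = 𝟙-inv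
    ; factors = [] ; length≤m = z≤n ; length≤n = z≤n ; positive = [] ; chain = []
    ; equation = λ _ () }
  smithNormalForm {suc m} {suc n} M
    with Fin.any? (λ i → Fin.any? (λ j → ¬? (M i j ℤ.≟ 0ℤ)))
  ... | no none = record
    { U = 𝟙 ; V = 𝟙 ; U-unimodular = 𝟙-inv ; V-unimodular = 𝟙-inv
    ; factors = [] ; length≤m = z≤n ; length≤n = z≤n ; positive = [] ; chain = []
    ; equation = λ i j → trans
        (decidable-stable (M i j ℤ.≟ 0ℤ) (λ ≢0 → none (i , j , ≢0)))
        (sym (trans (⊗-identityˡ (diagonal [] ⊗ 𝟙) i j) (⊗-identityʳ (diagonal []) i j))) }
  ... | yes (i , j , ≢0) = fromPivot (pivot M i j ≢0 (<-wellFounded _)) smithNormalForm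

module IntegersToRationals where

  open ≡ using (refl; sym; trans; cong; cong₂; subst)

  fromℤ : ℤ → ℚ
  fromℤ z = z ℚ./ 1

  private
    toℚᵘ-fromℤ : ∀ z → ℚ.toℚᵘ (fromℤ z) ℚᵘ.≃ ℚᵘ.mkℚᵘ z 0
    toℚᵘ-fromℤ z = ℚ.toℚᵘ-fromℚᵘ (ℚᵘ.mkℚᵘ z 0)

  fromℤ-+ : ∀ x y → fromℤ (x ℤ.+ y) ≡ fromℤ x ℚ.+ fromℤ y
  fromℤ-+ x y = ℚ.toℚᵘ-injective (begin
    ℚ.toℚᵘ (fromℤ (x ℤ.+ y))                   ≈⟨ toℚᵘ-fromℤ (x ℤ.+ y) ⟩
    ℚᵘ.mkℚᵘ (x ℤ.+ y) 0                        ≈⟨ ℚᵘ.*≡* (solve 2 (λ x y → (x :+ y) :* con 1ℤ := (x :* con 1ℤ :+ y :* con 1ℤ) :* con 1ℤ) refl x y) ⟩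
    ℚᵘ.mkℚᵘ x 0 ℚᵘ.+ ℚᵘ.mkℚᵘ y 0               ≈⟨ ℚᵘ.+-cong (toℚᵘ-fromℤ x) (toℚᵘ-fromℤ y) ⟨
    ℚ.toℚᵘ (fromℤ x) ℚᵘ.+ ℚ.toℚᵘ (fromℤ y)     ≈⟨ ℚ.toℚᵘ-homo-+ (fromℤ x) (fromℤ y) ⟨
    ℚ.toℚᵘ (fromℤ x ℚ.+ fromℤ y)               ∎)
    where
    open ℚᵘ.≃-Reasoning
    open ℤS.+-*-Solver

  fromℤ-* : ∀ x y → fromℤ (x ℤ.* y) ≡ fromℤ x ℚ.* fromℤ y
  fromℤ-* x y = ℚ.toℚᵘ-injective (begin
    ℚ.toℚᵘ (fromℤ (x ℤ.* y))                   ≈⟨ toℚᵘ-fromℤ (x ℤ.* y) ⟩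
    ℚᵘ.mkℚᵘ (x ℤ.* y) 0                        ≈⟨ ℚᵘ.*≡* refl ⟩
    ℚᵘ.mkℚᵘ x 0 ℚᵘ.* ℚᵘ.mkℚᵘ y 0               ≈⟨ ℚᵘ.*-cong (toℚᵘ-fromℤ x) (toℚᵘ-fromℤ y) ⟨
    ℚ.toℚᵘ (fromℤ x) ℚᵘ.* ℚ.toℚᵘ (fromℤ y)     ≈⟨ ℚ.toℚᵘ-homo-* (fromℤ x) (fromℤ y) ⟨
    ℚ.toℚᵘ (fromℤ x ℚ.* fromℤ y)               ∎)
    where open ℚᵘ.≃-Reasoning

  fromℤ-inv : ∀ x → x ≢ 0ℤ → ∃ λ y → y ℚ.* fromℤ x ≡ 1ℚ
  fromℤ-inv x x≢0 = ℚ.1/ fromℤ x , ℚ.*-inverseˡ (fromℤ x)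
    where
    ≢0 : fromℤ x ≢ 0ℚ
    ≢0 e with ℚᵘ.≃-trans (ℚᵘ.≃-sym (toℚᵘ-fromℤ x)) (ℚᵘ.≃-reflexive (cong ℚ.toℚᵘ e))
    ... | ℚᵘ.*≡* h = x≢0 (trans (sym (ℤ.*-identityʳ x)) (trans h (ℤ.*-identityʳ 0ℤ)))
    instance _ = ℚ.≢-nonZero ≢0

  -- z i j tends to 0 as i and j both tend to infinity.

module Reals where

  open ≡ using (refl; sym; trans; cong; cong₂; subst)

  Vanishes : (ℕ → ℕ → ℚ) → Set
  Vanishes z = ∀ ε → 0ℚ ℚ.< ε → ∃ λ N → ∀ i j → N ℕ.≤ i → N ℕ.≤ j → ℚ.∣ z i j ∣ ℚ.< ε

  -- Cauchy sequences of rationals, equal when their difference tends to 0.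
  record ℝ : Set where
    no-eta-equality
    constructor real
    field
      seq    : ℕ → ℚ
      cauchy : Vanishes (λ i j → seq i ℚ.- seq j)
  open ℝ

  infix 4 _≈_
  record _≈_ (x y : ℝ) : Set where
    constructor close
    field vanishing : Vanishes (λ i _ → seq x i ℚ.- seq y i)
  open _≈_

  private
    cong-v : ∀ {z w} → (∀ i j → z i j ≡ w i j) → Vanishes z → Vanishes w
    cong-v e v ε ε>0 = let N , h = v ε ε>0 in
      N , λ i j p q → subst (λ t → ℚ.∣ t ∣ ℚ.< ε) (e i j) (h i j p q)

    0-v : Vanishes (λ _ _ → 0ℚ)
    0-v ε ε>0 = 0 , λ _ _ _ _ → ε>0

    half : ∀ ε → ½ ℚ.* ε ℚ.+ ½ ℚ.* ε ≡ ε
    half ε = trans (sym (ℚ.*-distribʳ-+ ε ½ ½)) (ℚ.*-identityˡ ε)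

    +-v : ∀ {z w} → Vanishes z → Vanishes w → Vanishes (λ i j → z i j ℚ.+ w i j)
    +-v {z} {w} v v′ ε ε>0 =
      let δ>0 = subst (ℚ._< ½ ℚ.* ε) (ℚ.*-zeroʳ ½) (ℚ.*-monoʳ-<-pos ½ ε>0)
          N , h = v (½ ℚ.* ε) δ>0
          N′ , h′ = v′ (½ ℚ.* ε) δ>0
      in N ℕ.⊔ N′ , λ i j p q → subst (ℚ.∣ z i j ℚ.+ w i j ∣ ℚ.<_) (half ε)
           (ℚ.≤-<-trans (ℚ.∣p+q∣≤∣p∣+∣q∣ (z i j) (w i j))
             (ℚ.+-mono-< (h i j (ℕ.m⊔n≤o⇒m≤o N N′ p) (ℕ.m⊔n≤o⇒m≤o N N′ q))
                         (h′ i j (ℕ.m⊔n≤o⇒n≤o N N′ p) (ℕ.m⊔n≤o⇒n≤o N N′ q))))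

    neg-v : ∀ {z} → Vanishes z → Vanishes (λ i j → ℚ.- z i j)
    neg-v {z} v ε ε>0 = let N , h = v ε ε>0 in
      N , λ i j p q → subst (ℚ._< ε) (sym (ℚ.∣-p∣≡∣p∣ (z i j))) (h i j p q)

    Bounded : (ℕ → ℕ → ℚ) → Set
    Bounded b = ∃ λ B → 0ℚ ℚ.< B × ∃ λ N → ∀ i j → N ℕ.≤ i → N ℕ.≤ j → ℚ.∣ b i j ∣ ℚ.≤ B

    *-v : ∀ {b z} → Bounded b → Vanishes z → Vanishes (λ i j → b i j ℚ.* z i j)
    *-v {b} {z} (B , B>0 , M , bd) v ε ε>0 =
      let N , h = v δ δ>0
      in M ℕ.⊔ N , λ i j p q → subst (ℚ._< ε) (sym (ℚ.∣p*q∣≡∣p∣*∣q∣ (b i j) (z i j)))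
           (ℚ.≤-<-trans
             (ℚ.*-monoʳ-≤-nonNeg ℚ.∣ z i j ∣ {{ℚ.∣-∣-nonNeg (z i j)}}
               (bd i j (ℕ.m⊔n≤o⇒m≤o M N p) (ℕ.m⊔n≤o⇒m≤o M N q)))
             (subst (B ℚ.* ℚ.∣ z i j ∣ ℚ.<_) Bδ
               (ℚ.*-monoʳ-<-pos B (h i j (ℕ.m⊔n≤o⇒n≤o M N p) (ℕ.m⊔n≤o⇒n≤o M N q)))))
      where
      instance
        B-pos = ℚ.positive B>0
        B-nz  = ℚ.pos⇒nonZero B
        1/B-pos = ℚ.1/pos⇒pos B
      δ = ℚ.1/ B ℚ.* ε
      δ>0 : 0ℚ ℚ.< δ
      δ>0 = subst (ℚ._< δ) (ℚ.*-zeroʳ (ℚ.1/ B)) (ℚ.*-monoʳ-<-pos (ℚ.1/ B) ε>0)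
      Bδ : B ℚ.* δ ≡ ε
      Bδ = trans (sym (ℚ.*-assoc B (ℚ.1/ B) ε))
             (trans (cong (ℚ._* ε) (ℚ.*-inverseʳ B)) (ℚ.*-identityˡ ε))

    0<1 : 0ℚ ℚ.< 1ℚ
    0<1 = ℚ.positive⁻¹ 1ℚ

    bounded : ∀ x → ∃ λ B → 0ℚ ℚ.< B × ∃ λ N → ∀ i → N ℕ.≤ i → ℚ.∣ seq x i ∣ ℚ.≤ B
    bounded x = let N , h = cauchy x 1ℚ 0<1 in
        ℚ.∣ seq x N ∣ ℚ.+ 1ℚ
      , ℚ.+-mono-≤-< (ℚ.0≤∣p∣ (seq x N)) 0<1
      , N , λ i p → subst (λ t → ℚ.∣ t ∣ ℚ.≤ ℚ.∣ seq x N ∣ ℚ.+ 1ℚ)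
          (solve 2 (λ a b → a :+ (b :- a) := b) refl (seq x N) (seq x i))
          (ℚ.≤-trans (ℚ.∣p+q∣≤∣p∣+∣q∣ (seq x N) (seq x i ℚ.- seq x N))
            (ℚ.+-monoʳ-≤ ℚ.∣ seq x N ∣ (ℚ.<⇒≤ (h i N p ℕ.≤-refl))))
      where open ℚS.+-*-Solver

    boundedˡ : ∀ x → Bounded (λ i _ → seq x i)
    boundedˡ x = let B , B>0 , N , h = bounded x in B , B>0 , N , λ i _ p _ → h i p

    boundedʳ : ∀ x → Bounded (λ _ j → seq x j)
    boundedʳ x = let B , B>0 , N , h = bounded x in B , B>0 , N , λ _ j _ q → h j q

    open ℚS.+-*-Solver

    sub-+ : ∀ a b c d → (a ℚ.- b) ℚ.+ (c ℚ.- d) ≡ (a ℚ.+ c) ℚ.- (b ℚ.+ d)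
    sub-+ = solve 4 (λ a b c d → (a :- b) :+ (c :- d) := (a :+ c) :- (b :+ d)) refl

    sub-* : ∀ a b c d → a ℚ.* (b ℚ.- d) ℚ.+ d ℚ.* (a ℚ.- c) ≡ a ℚ.* b ℚ.- c ℚ.* d
    sub-* = solve 4 (λ a b c d → a :* (b :- d) :+ d :* (a :- c) := a :* b :- c :* d) refl

    sub-neg : ∀ a b → ℚ.- (a ℚ.- b) ≡ (ℚ.- a) ℚ.- (ℚ.- b)
    sub-neg = solve 2 (λ a b → :- (a :- b) := (:- a) :- (:- b)) refl

    sub-sym : ∀ a b → ℚ.- (a ℚ.- b) ≡ b ℚ.- a
    sub-sym = solve 2 (λ a b → :- (a :- b) := b :- a) refl

    sub-trans : ∀ a b c → (a ℚ.- b) ℚ.+ (b ℚ.- c) ≡ a ℚ.- c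
    sub-trans = solve 3 (λ a b c → (a :- b) :+ (b :- c) := a :- c) refl

  fromℚ : ℚ → ℝ
  fromℚ p = real (λ _ → p) (cong-v (λ _ _ → sym (ℚ.+-inverseʳ p)) 0-v)

  infixl 6 _+_
  infixl 7 _*_

  _+_ : ℝ → ℝ → ℝ
  seq (x + y) i = seq x i ℚ.+ seq y i
  cauchy (x + y) = cong-v (λ i j → sub-+ (seq x i) (seq x j) (seq y i) (seq y j))
                          (+-v (cauchy x) (cauchy y))

  _*_ : ℝ → ℝ → ℝ
  seq (x * y) i = seq x i ℚ.* seq y i
  cauchy (x * y) = cong-v (λ i j → sub-* (seq x i) (seq y i) (seq x j) (seq y j))
                          (+-v (*-v (boundedˡ x) (cauchy y)) (*-v (boundedʳ y) (cauchy x)))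

  -_ : ℝ → ℝ
  seq (- x) i = ℚ.- seq x i
  cauchy (- x) = cong-v (λ i j → sub-neg (seq x i) (seq x j)) (neg-v (cauchy x))

  pointwise : ∀ {x y} → (∀ i → seq x i ≡ seq y i) → x ≈ y
  pointwise {x} {y} e = close (cong-v (λ i _ → sym (trans (cong (ℚ._- seq y i) (e i)) (ℚ.+-inverseʳ (seq y i)))) 0-v)

  ℝ-commutativeRing : CommutativeRing 0ℓ 0ℓ
  ℝ-commutativeRing = record
    { Carrier = ℝ ; _≈_ = _≈_ ; _+_ = _+_ ; _*_ = _*_ ; -_ = -_
    ; 0# = fromℚ 0ℚ ; 1# = fromℚ 1ℚ
    ; isCommutativeRing = record
      { isRing = record
        { +-isAbelianGroup = record
          { isGroup = record
            { isMonoid = record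
              { isSemigroup = record
                { isMagma = record
                  { isEquivalence = ≈-isEquivalence
                  ; ∙-cong = λ {x} {y} {u} {v} p q →
                      close (cong-v (λ i _ → sub-+ (seq x i) (seq y i) (seq u i) (seq v i))
                             (+-v (vanishing p) (vanishing q))) }
                ; assoc = λ x y z → pointwise (λ i → ℚ.+-assoc (seq x i) (seq y i) (seq z i)) }
              ; identity = (λ x → pointwise (λ i → ℚ.+-identityˡ (seq x i)))
                         , (λ x → pointwise (λ i → ℚ.+-identityʳ (seq x i))) }
            ; inverse = (λ x → pointwise (λ i → ℚ.+-inverseˡ (seq x i)))
                      , (λ x → pointwise (λ i → ℚ.+-inverseʳ (seq x i)))
            ; ⁻¹-cong = λ {x} {y} p → close (cong-v (λ i _ → sub-neg (seq x i) (seq y i)) (neg-v (vanishing p))) }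
          ; comm = λ x y → pointwise (λ i → ℚ.+-comm (seq x i) (seq y i)) }
        ; *-cong = λ {x} {y} {u} {v} p q →
            close (cong-v (λ i _ → sub-* (seq x i) (seq u i) (seq y i) (seq v i))
                   (+-v (*-v (boundedˡ x) (vanishing q)) (*-v (boundedˡ v) (vanishing p))))
        ; *-assoc = λ x y z → pointwise (λ i → ℚ.*-assoc (seq x i) (seq y i) (seq z i))
        ; *-identity = (λ x → pointwise (λ i → ℚ.*-identityˡ (seq x i)))
                     , (λ x → pointwise (λ i → ℚ.*-identityʳ (seq x i)))
        ; distrib = (λ x y z → pointwise (λ i → ℚ.*-distribˡ-+ (seq x i) (seq y i) (seq z i)))
                  , (λ x y z → pointwise (λ i → ℚ.*-distribʳ-+ (seq x i) (seq y i) (seq z i))) }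
      ; *-comm = λ x y → pointwise (λ i → ℚ.*-comm (seq x i) (seq y i)) } }
    where
    ≈-isEquivalence : IsEquivalence _≈_
    ≈-isEquivalence = record
      { refl  = pointwise (λ _ → refl)
      ; sym   = λ {x} {y} p → close (cong-v (λ i _ → sub-sym (seq x i) (seq y i)) (neg-v (vanishing p)))
      ; trans = λ {x} {y} {z} p q →
          close (cong-v (λ i _ → sub-trans (seq x i) (seq y i) (seq z i))
                        (+-v (vanishing p) (vanishing q))) }

  1≉0 : ¬ fromℚ 1ℚ ≈ fromℚ 0ℚ
  1≉0 e = let N , h = vanishing e 1ℚ 0<1 in ℚ.<-irrefl refl (h N N ℕ.≤-refl ℕ.≤-refl)

module Modular where

  open ≡ using (refl; sym; trans; cong; cong₂; subst)

  record _≡_mod_ (x y : ℤ) (q : ℕ) : Set where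
    constructor congruent
    field modulus∣ : + q ∣ x ℤ.- y
  open _≡_mod_

  -- ℤ/qℤ with integers as representatives and congruence as equality.
  ℤ/ : ℕ → CommutativeRing 0ℓ 0ℓ
  ℤ/ q = record
    { Carrier = ℤ ; _≈_ = λ x y → x ≡ y mod q ; _+_ = ℤ._+_ ; _*_ = ℤ._*_ ; -_ = ℤ.-_
    ; 0# = 0ℤ ; 1# = 1ℤ
    ; isCommutativeRing = record
      { isRing = record
        { +-isAbelianGroup = record
          { isGroup = record
            { isMonoid = record
              { isSemigroup = record
                { isMagma = record
                  { isEquivalence = record
                    { refl  = λ {x} → eq (refl {x = x})
                    ; sym   = λ {x} {y} p → via (solve 2 (λ x y → :- (x :- y) := y :- x) refl x y) (ℤ∣.∣m⇒∣-m (modulus∣ p))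
                    ; trans = λ {x} {y} {z} p q → via
                        (solve 3 (λ x y z → (x :- y) :+ (y :- z) := x :- z) refl x y z) (ℤ∣.∣m∣n⇒∣m+n (modulus∣ p) (modulus∣ q)) }
                  ; ∙-cong = λ {x} {y} {u} {v} p q → via
                      (solve 4 (λ x y u v → (x :- y) :+ (u :- v) := (x :+ u) :- (y :+ v)) refl x y u v)
                      (ℤ∣.∣m∣n⇒∣m+n (modulus∣ p) (modulus∣ q)) }
                ; assoc = λ x y z → eq (ℤ.+-assoc x y z) }
              ; identity = (λ x → eq (ℤ.+-identityˡ x)) , (λ x → eq (ℤ.+-identityʳ x)) }
            ; inverse = (λ x → eq (ℤ.+-inverseˡ x)) , (λ x → eq (ℤ.+-inverseʳ x))
            ; ⁻¹-cong = λ {x} {y} p → via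
                (solve 2 (λ x y → :- (x :- y) := (:- x) :- (:- y)) refl x y) (ℤ∣.∣m⇒∣-m (modulus∣ p)) }
          ; comm = λ x y → eq (ℤ.+-comm x y) }
        ; *-cong = λ {x} {y} {u} {v} p q → via
            (solve 4 (λ x y u v → x :* (u :- v) :+ (x :- y) :* v := x :* u :- y :* v) refl x y u v)
            (ℤ∣.∣m∣n⇒∣m+n (ℤ∣.∣n⇒∣m*n x (modulus∣ q)) (ℤ∣.∣m⇒∣m*n v (modulus∣ p)))
        ; *-assoc = λ x y z → eq (ℤ.*-assoc x y z)
        ; *-identity = (λ x → eq (ℤ.*-identityˡ x)) , (λ x → eq (ℤ.*-identityʳ x))
        ; distrib = (λ x y z → eq (ℤ.*-distribˡ-+ x y z)) , (λ x y z → eq (ℤ.*-distribʳ-+ x y z)) }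
      ; *-comm = λ x y → eq (ℤ.*-comm x y) } }
    where
    open ℤS.+-*-Solver
    via : ∀ {x y z} → z ≡ x ℤ.- y → + q ∣ z → x ≡ y mod q
    via e h = congruent (subst (+ q ∣_) e h)
    eq : ∀ {x y} → x ≡ y → x ≡ y mod q
    eq {x} refl = congruent (divides 0ℤ (ℤ.+-inverseʳ x))

-- The common properties of ℚ and ℝ: a nontrivial ring in which nonzero integers are invertible. Over such
-- a ring, integral linear systems are decided by the Smith normal form.
record RationalAlgebra : Set₁ where
  field
    ring : CommutativeRing 0ℓ 0ℓ
  open CommutativeRing ring using (Carrier; _≈_; _+_; _*_; 0#; 1#)
  field
    ι     : ℤ → Carrier
    ι-0   : ι 0ℤ ≈ 0#
    ι-1   : ι 1ℤ ≈ 1#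
    ι-+   : ∀ x y → ι (x ℤ.+ y) ≈ ι x + ι y
    ι-*   : ∀ x y → ι (x ℤ.* y) ≈ ι x * ι y
    ι-inv : ∀ x → x ≢ 0ℤ → ∃ λ y → y * ι x ≈ 1#
    1≉0   : ¬ 1# ≈ 0#

module OverRationals (K : RationalAlgebra) where

  open RationalAlgebra K using (ι; ι-0; ι-1; ι-+; ι-*; ι-inv; 1≉0) renaming (ring to R)
  open CommutativeRing R hiding (zero)
  open Smith
  private module ℤL = MatrixProperties ℤ.+-*-commutativeRing
  open Summation (CommutativeRing.semiring ℤ.+-*-commutativeRing) using () renaming (sum to ∑ℤ)
  open MatrixProperties R
  open Summation semiring
  open Equivalence using (to; from)

  private variable d : ℕ

  cast : Matrix ℤ m n → Matrix Carrier m n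
  cast M i j = ι (M i j)

  ι-sum : (f : Vector ℤ n) → ι (∑ℤ f) ≈ sum (ι ∘ f)
  ι-sum {zero}  f = ι-0
  ι-sum {suc n} f = trans (ι-+ _ _) (+-congˡ (ι-sum (f ∘ suc)))

  ι-*ᵥ : (M : Matrix ℤ m n) (x : Vector ℤ n) (i : Fin m) →
         ι ((M ℤL.*ᵥ x) i) ≈ (cast M *ᵥ (ι ∘ x)) i
  ι-*ᵥ M x i = trans (ι-sum (λ j → M i j ℤ.* x j)) (sum-cong-≋ (λ j → ι-* (M i j) (x j)))

  cast-⊗ : (M : Matrix ℤ m n) (N : Matrix ℤ n k) → cast (M ℤL.⊗ N) ≋ cast M ⊗ cast N
  cast-⊗ M N i l = ι-*ᵥ M (λ j → N j l) i

  cast-𝟙 : cast (ℤL.𝟙 {n}) ≋ 𝟙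
  cast-𝟙 zero    zero    = ι-1
  cast-𝟙 zero    (suc j) = ι-0
  cast-𝟙 (suc i) zero    = ι-0
  cast-𝟙 (suc i) (suc j) = cast-𝟙 i j

  cast-≋ : {M N : Matrix ℤ m n} → M ℤL.≋ N → cast M ≋ cast N
  cast-≋ e i j = reflexive (≡.cong ι (e i j))

  open Invertible

  cast-inv : {U : Matrix ℤ n n} → ℤL.Invertible U → Invertible (cast U)
  cast-inv i .inverse = cast (ℤL.Invertible.inverse i)
  cast-inv {U = U} i .inverseˡ = ≋-trans (≋-sym (cast-⊗ (ℤL.Invertible.inverse i) U))
    (≋-trans (cast-≋ (ℤL.Invertible.inverseˡ i)) cast-𝟙)
  cast-inv {U = U} i .inverseʳ = ≋-trans (≋-sym (cast-⊗ U (ℤL.Invertible.inverse i)))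
    (≋-trans (cast-≋ (ℤL.Invertible.inverseʳ i)) cast-𝟙)

  ᵥ-trans : {u v w : Vector Carrier n} → u ≋ᵥ v → v ≋ᵥ w → u ≋ᵥ w
  ᵥ-trans e f i = trans (e i) (f i)

  ᵥ-sym : {u v : Vector Carrier n} → u ≋ᵥ v → v ≋ᵥ u
  ᵥ-sym e i = sym (e i)

  *ᵥ-congʳ : (M : Matrix Carrier m n) {x y : Vector Carrier n} →
             x ≋ᵥ y → M *ᵥ x ≋ᵥ M *ᵥ y
  *ᵥ-congʳ M e = *ᵥ-cong {M = M} ≋-refl e

  cancelᵥ : (U W : Matrix Carrier n n) → U ⊗ W ≋ 𝟙 → ∀ x → U *ᵥ (W *ᵥ x) ≋ᵥ x
  cancelᵥ U W e x i = trans (sym (*ᵥ-assoc U W x i))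
    (trans (*ᵥ-cong {x = x} e (λ _ → refl) i) (𝟙*ᵥ x i))

  transport : {P Q : Pred (Vector Carrier n) 0ℓ} {U : Matrix Carrier n n} (i : Invertible U) →
              (∀ v → Q v ⇔ P (inverse i *ᵥ v)) → HasDimension P d → HasDimension Q d
  transport {U = U} i Q⇔P (B , ind , span) = U ⊗ B , ind′ , span′
    where
    W = inverse i
    ind′ : Independent (U ⊗ B)
    ind′ c e = ind c λ x → trans
      (sym (cancelᵥ W U (inverseˡ i) (B *ᵥ c) x))
      (*ᵥ0 W (λ y → trans (sym (*ᵥ-assoc U B c y)) (e y)) x)
    span′ : ∀ v → _ ⇔ Col (U ⊗ B) v
    span′ v = mk⇔
      (λ q → let c , e = to (span (W *ᵥ v)) (to (Q⇔P v) q) in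
        c , ᵥ-trans (ᵥ-sym (cancelᵥ U W (inverseʳ i) v))
              (ᵥ-trans (*ᵥ-congʳ U e) (ᵥ-sym (*ᵥ-assoc U B c))))
      (λ (c , e) → from (Q⇔P v) (from (span (W *ᵥ v))
        (c , ᵥ-trans (*ᵥ-congʳ W (ᵥ-trans e (*ᵥ-assoc U B c)))
               (cancelᵥ W U (inverseˡ i) (B *ᵥ c)))))

  relabel : {P Q : Pred (Vector Carrier n) 0ℓ} → (∀ v → Q v ⇔ P v) →
            HasDimension P d → HasDimension Q d
  relabel e (B , ind , span) = B , ind , λ v →
    mk⇔ (to (span v) ∘ to (e v)) (from (e v) ∘ from (span v))

  ι0* : ∀ x → ι 0ℤ * x ≈ 0#
  ι0* x = trans (*-congʳ ι-0) (zeroˡ x)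

  sumι0 : ∀ n (x : Vector Carrier n) → sum (λ k → ι 0ℤ * x k) ≈ 0#
  sumι0 n x = sum-zero n _ (λ k → ι0* (x k))

  row₀ : ∀ d ds (x : Vector Carrier (suc n)) →
         (cast (diagonal {suc m} (d ∷ ds)) *ᵥ x) zero ≈ ι (+ d) * x zero
  row₀ {n} d ds x = +0 refl (sumι0 n (x ∘ suc))

  rows : ∀ d ds (x : Vector Carrier (suc n)) (i : Fin m) →
         (cast (diagonal {suc m} (d ∷ ds)) *ᵥ x) (suc i) ≈ (cast (diagonal ds) *ᵥ (x ∘ suc)) i
  rows d ds x i = 0+ (ι0* (x zero)) refl

  inv₊ : ∀ d → 0 ℕ.< d → ∃ λ y → y * ι (+ d) ≈ 1#
  inv₊ (suc d) _ = ι-inv (+ suc d) (λ ())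

  undo : ∀ {z y c} → y * z ≈ 1# → z * (y * c) ≈ c
  undo e = trans (sym (*-assoc _ _ _)) (trans (*-congʳ (trans (*-comm _ _) e)) (*-identityˡ _))

  colDiagonal : (ds : List ℕ) → All (0 ℕ.<_) ds → length ds ℕ.≤ m → length ds ℕ.≤ n →
                HasDimension (Col (cast (diagonal {m} {n} ds))) (length ds)
  colDiagonal {m} {n} [] _ _ _ = (λ _ ()) , (λ _ _ ()) , λ v → mk⇔
    (λ (c , e) → (λ ()) , λ i → trans (e i) (sumι0 n c))
    (λ (c , e) → 𝟘ᵥ , λ i → trans (e i) (sym (sumι0 n 𝟘ᵥ)))
  colDiagonal {suc m} {suc n} (d ∷ ds) (d>0 ∷ pos) (s≤s le) (s≤s le′)
    with colDiagonal ds pos le le′ | inv₊ d d>0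
  ... | B , ind , span | y , yd = B′ , ind′ , span′
    where
    l = length ds
    B′ = block 1# 𝟘ᵥ 𝟘ᵥ B
    B′₀ : ∀ c → (B′ *ᵥ c) zero ≈ c zero
    B′₀ c = +0 (*-identityˡ _) (sum0ˡ l _)
    B′ₛ : ∀ c i → (B′ *ᵥ c) (suc i) ≈ (B *ᵥ (c ∘ suc)) i
    B′ₛ c i = 0+ (zeroˡ _) refl
    ind′ : Independent B′
    ind′ c e zero    = trans (sym (B′₀ c)) (e zero)
    ind′ c e (suc j) = ind (c ∘ suc) (λ i → trans (sym (B′ₛ c i)) (e (suc i))) j
    span′ : ∀ v → Col (cast (diagonal (d ∷ ds))) v ⇔ Col B′ v
    span′ v = mk⇔
      (λ (c , e) →
        let c′ , e′ = to (span (v ∘ suc)) (c ∘ suc , λ i → trans (e (suc i)) (rows d ds c i))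
            c″ = v zero V.∷ c′
        in c″ , λ { zero → sym (B′₀ c″) ; (suc i) → trans (e′ i) (sym (B′ₛ c″ i)) })
      (λ (c , e) →
        let x , e′ = from (span (v ∘ suc)) (c ∘ suc , λ i → trans (e (suc i)) (B′ₛ c i))
            x′ = (y * c zero) V.∷ x
        in x′ , λ { zero → trans (e zero) (trans (B′₀ c) (trans (sym (undo yd)) (sym (row₀ {m = m} d ds x′))))
                  ; (suc i) → trans (e′ i) (sym (rows d ds x′ i)) })

  Kernel : Matrix Carrier m n → Pred (Vector Carrier n) 0ℓ
  Kernel M x = ∀ i → (M *ᵥ x) i ≈ 0#

  kernelDiagonal : (ds : List ℕ) → All (0 ℕ.<_) ds → length ds ℕ.≤ m → length ds ℕ.≤ n →
                   HasDimension (Kernel (cast (diagonal {m} {n} ds))) (n ℕ.∸ length ds)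
  kernelDiagonal {m} {n} [] _ _ _ = 𝟙 , (λ c e j → trans (sym (𝟙*ᵥ c j)) (e j)) , λ v → mk⇔
    (λ _ → v , ᵥ-sym (𝟙*ᵥ v))
    (λ _ _ → sumι0 n v)
  kernelDiagonal {suc m} {suc n} (d ∷ ds) (d>0 ∷ pos) (s≤s le) (s≤s le′)
    with kernelDiagonal ds pos le le′ | inv₊ d d>0
  ... | B , ind , span | y , yd = 𝟘ᵥ V.∷ B , (λ c e → ind c (e ∘ suc)) , span′
    where
    l = n ℕ.∸ length ds
    span′ : ∀ v → Kernel (cast (diagonal (d ∷ ds))) v ⇔ Col (𝟘ᵥ V.∷ B) v
    span′ v = mk⇔
      (λ e →
        let c , e′ = to (span (v ∘ suc)) (λ i → trans (sym (rows d ds v i)) (e (suc i)))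
            v₀ : v zero ≈ 0#
            v₀ = trans (sym (undo (trans (*-comm _ _) yd)))
                   (trans (*-congˡ (trans (sym (row₀ {m = m} d ds v)) (e zero))) (zeroʳ y))
        in c , λ { zero → trans v₀ (sym (sum0ˡ l c)) ; (suc i) → e′ i })
      (λ (c , e) → λ
        { zero → trans (row₀ {m = m} d ds v) (trans (*-congˡ (trans (e zero) (sum0ˡ l c))) (zeroʳ _))
        ; (suc i) → trans (rows d ds v i) (from (span (v ∘ suc)) (c , e ∘ suc) i) })

  Solves : Matrix Carrier m n → Vector Carrier m → Pred (Vector Carrier n) 0ℓ
  Solves M b x = M *ᵥ x ≋ᵥ b

  ι-nonzero : ∀ {x} → x ≢ 0ℤ → ¬ ι x ≈ 0#
  ι-nonzero x≢0 e = let y , yx = ι-inv _ x≢0 in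
    1≉0 (trans (sym yx) (trans (*-congˡ e) (zeroʳ y)))

  solveDiagonal : (ds : List ℕ) → All (0 ℕ.<_) ds → length ds ℕ.≤ m → length ds ℕ.≤ n →
                  (b : Vector ℤ m) →
                  Empty (Solves (cast (diagonal {m} {n} ds)) (ι ∘ b)) ⊎
                  ∃ (Solves (cast (diagonal {m} {n} ds)) (ι ∘ b))
  solveDiagonal {m} {n} [] _ _ _ b with Fin.any? (λ i → ¬? (b i ℤ.≟ 0ℤ))
  ... | yes (i , bi≢0) = inj₁ λ x e → ι-nonzero bi≢0 (trans (sym (e i)) (sumι0 n x))
  ... | no none = inj₂ (𝟘ᵥ , λ i → trans (sumι0 n 𝟘ᵥ) (sym (trans
          (reflexive (≡.cong ι (decidable-stable (b i ℤ.≟ 0ℤ) (λ ne → none (i , ne))))) ι-0)))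
  solveDiagonal {suc m} {suc n} (d ∷ ds) (d>0 ∷ pos) (s≤s le) (s≤s le′) b
    with solveDiagonal {m} {n} ds pos le le′ (b ∘ suc) | inv₊ d d>0
  ... | inj₁ none | _ = inj₁ λ x e →
          none (x ∘ suc) (λ i → trans (sym (rows d ds x i)) (e (suc i)))
  ... | inj₂ (x , e) | y , yd = let x′ = (y * ι (b zero)) V.∷ x in inj₂ (x′ , λ
          { zero → trans (row₀ {m = m} d ds x′) (undo yd)
          ; (suc i) → trans (rows d ds x′ i) (e i) })

  module _ {m n} (M : Matrix ℤ m n) where
    private
      open SmithNormalForm (smithNormalForm M)
      Δ : Matrix Carrier m n
      Δ = cast (diagonal factors)
      uᵢ = cast-inv U-unimodular
      vᵢ = cast-inv V-unimodular
      Û = cast U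
      V̂ = cast V
      Û⁻¹ = inverse uᵢ
      V̂⁻¹ = inverse vᵢ

      action : ∀ x → cast M *ᵥ x ≋ᵥ Û *ᵥ (Δ *ᵥ (V̂ *ᵥ x))
      action x = ᵥ-trans (*ᵥ-cong {x = x} cast-eq (λ _ → refl))
                   (ᵥ-trans (*ᵥ-assoc Û (Δ ⊗ V̂) x) (*ᵥ-congʳ Û (*ᵥ-assoc Δ V̂ x)))
        where
        cast-eq : cast M ≋ Û ⊗ (Δ ⊗ V̂)
        cast-eq = ≋-trans (cast-≋ equation) (≋-trans (cast-⊗ U (diagonal factors ℤL.⊗ V))
                    (⊗-cong {M = Û} ≋-refl (cast-⊗ (diagonal factors) V)))

      moved : ∀ {x b} → cast M *ᵥ x ≋ᵥ b → Δ *ᵥ (V̂ *ᵥ x) ≋ᵥ Û⁻¹ *ᵥ b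
      moved {x} e = ᵥ-trans (ᵥ-sym (cancelᵥ Û⁻¹ Û (inverseˡ uᵢ) (Δ *ᵥ (V̂ *ᵥ x))))
                      (*ᵥ-congʳ Û⁻¹ (ᵥ-trans (ᵥ-sym (action x)) e))

      back : ∀ {z b} → Δ *ᵥ z ≋ᵥ Û⁻¹ *ᵥ b → cast M *ᵥ (V̂⁻¹ *ᵥ z) ≋ᵥ b
      back {z} {b} e = ᵥ-trans (action (V̂⁻¹ *ᵥ z))
        (ᵥ-trans (*ᵥ-congʳ Û (ᵥ-trans (*ᵥ-congʳ Δ (cancelᵥ V̂ V̂⁻¹ (inverseʳ vᵢ) z)) e))
                 (cancelᵥ Û Û⁻¹ (inverseʳ uᵢ) b))

    columnSpace : HasDimension (Col (cast M)) (length factors)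
    columnSpace = transport uᵢ
      (λ v → mk⇔ (λ (c , e) → V̂ *ᵥ c , ᵥ-sym (moved (ᵥ-sym e)))
                 (λ (c , e) → V̂⁻¹ *ᵥ c , ᵥ-sym (back (ᵥ-sym e))))
      (colDiagonal factors positive length≤m length≤n)

    kernel : HasDimension (Kernel (cast M)) (n ℕ.∸ length factors)
    kernel = transport (inv-inv vᵢ)
      (λ v → mk⇔
        (λ e i → trans (moved e i) (*ᵥ0 Û⁻¹ (λ _ → refl) i))
        (λ e i → trans (action v i) (*ᵥ0 Û e i)))
      (kernelDiagonal factors positive length≤m length≤n)

    solve : (b : Vector ℤ m) → Empty (Solves (cast M) (ι ∘ b)) ⊎ ∃ (Solves (cast M) (ι ∘ b))
    solve b with solveDiagonal factors positive length≤m length≤n (ℤL.Invertible.inverse U-unimodular ℤL.*ᵥ b)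
    ... | inj₁ none = inj₁ λ x e → none (V̂ *ᵥ x)
            (ᵥ-trans (moved e) (ᵥ-sym (ι-*ᵥ (ℤL.Invertible.inverse U-unimodular) b)))
    ... | inj₂ (z , e) = inj₂ (V̂⁻¹ *ᵥ z ,
            back (ᵥ-trans e (ι-*ᵥ (ℤL.Invertible.inverse U-unimodular) b)))

    *ᵥ-+ : ∀ (x y : Vector Carrier n) i →
           (cast M *ᵥ (λ k → x k + y k)) i ≈ (cast M *ᵥ x) i + (cast M *ᵥ y) i
    *ᵥ-+ x y i = trans (sum-cong-≋ (λ j → distribˡ (cast M i j) (x j) (y j)))
      (∑-distrib-+ (λ j → cast M i j * x j) (λ j → cast M i j * y j))

    affine : (b : Vector ℤ m) {S : Pred (Vector Carrier n) 0ℓ} →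
             (∀ x → S x ⇔ Solves (cast M) (ι ∘ b) x) →
             Empty S ⊎ ∃ (HasAffineDimension S)
    affine b {S} S⇔ with solve b
    ... | inj₁ none = inj₁ λ x s → none x (to (S⇔ x) s)
    ... | inj₂ (p , e) = inj₂ (n ℕ.∸ length factors , p , from (S⇔ p) e , relabel
            (λ v → mk⇔
              (λ s i → cancel (e i) (trans (sym (*ᵥ-+ p v i)) (to (S⇔ _) s i)))
              (λ z → from (S⇔ _) (λ i → trans (*ᵥ-+ p v i) (trans (+-cong (e i) (z i)) (+-identityʳ _)))))
            kernel)
      where
      cancel : ∀ {x y b} → x ≈ b → x + y ≈ b → y ≈ 0#
      cancel {x} {y} {b} e₁ e₂ = begin
        y                 ≈⟨ 0+ (-‿inverseˡ x) refl ⟨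
        (- x + x) + y     ≈⟨ +-assoc _ _ _ ⟩
        - x + (x + y)     ≈⟨ +-congˡ (trans e₂ (sym e₁)) ⟩
        - x + x           ≈⟨ -‿inverseˡ x ⟩
        0# ∎
        where open import Relation.Binary.Reasoning.Setoid setoid

open IntegersToRationals using (fromℤ)
open Reals using (ℝ; fromℚ)
open Modular using (ℤ/)

ℚ-algebra : RationalAlgebra
ℚ-algebra = record
  { ring = ℚ.+-*-commutativeRing ; ι = fromℤ ; ι-0 = ≡.refl ; ι-1 = ≡.refl
  ; ι-+ = IntegersToRationals.fromℤ-+ ; ι-* = IntegersToRationals.fromℤ-*
  ; ι-inv = IntegersToRationals.fromℤ-inv ; 1≉0 = λ () }

ℤ⇒ℝ : ℤ → ℝ
ℤ⇒ℝ z = fromℚ (fromℤ z)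

ℝ-algebra : RationalAlgebra
ℝ-algebra = record
  { ring = Reals.ℝ-commutativeRing ; ι = ℤ⇒ℝ
  ; ι-0 = Reals.pointwise (λ _ → ≡.refl) ; ι-1 = Reals.pointwise (λ _ → ≡.refl)
  ; ι-+ = λ x y → Reals.pointwise (λ _ → IntegersToRationals.fromℤ-+ x y)
  ; ι-* = λ x y → Reals.pointwise (λ _ → IntegersToRationals.fromℤ-* x y)
  ; ι-inv = λ x x≢0 →
      let y , e = IntegersToRationals.fromℤ-inv x x≢0 in fromℚ y , Reals.pointwise (λ _ → e)
  ; 1≉0 = Reals.1≉0 }

module Linearℚ = Linear ℚ.+-*-commutativeRing
module Linearℝ = Linear Reals.ℝ-commutativeRing
module Linear/ (q : ℕ) = Linear (ℤ/ q)

invariantFactors : Matrix ℤ m n → List ℕ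
invariantFactors M = Smith.SmithNormalForm.factors (Smith.smithNormalForm M)

-- The dimension over ℚ of the column space; length (invariantFactors M) is only
-- the witness, the type is what determines the number.
rankℚ : (M : Matrix ℤ m n) → ∃ λ r →
        Linearℚ.HasDimension (Linearℚ.Col (λ i j → fromℤ (M i j))) r
rankℚ M = length (invariantFactors M) , OverRationals.columnSpace ℚ-algebra M

rank : Matrix ℤ m n → ℕ
rank M = proj₁ (rankℚ M)

-- One-based indexing, with the convention that the zeroth invariant factor is 1.
-- The value beyond the end of the list is never used.
nth : List ℕ → ℕ → ℕ
nth ds       zero          = 1
nth []       (suc j)       = 0
nth (d ∷ ds) (suc zero)    = d
nth (d ∷ ds) (suc (suc j)) = nth ds (suc j)

subsets : ∀ m → List (Subset m)
subsets zero    = Vec.[] ∷ []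
subsets (suc m) = List.map (inside Vec.∷_) (subsets m) List.++ List.map (outside Vec.∷_) (subsets m)

-- The increasing enumeration of the elements of a subset.
element : (J : Subset m) → Fin ∣ J ∣ → Fin m
element (inside  Vec.∷ J) zero    = zero
element (inside  Vec.∷ J) (suc i) = suc (element J i)
element (outside Vec.∷ J) i       = suc (element J i)

element-∈ : (J : Subset m) (i : Fin ∣ J ∣) → element J i ∈ J
element-∈ (inside  Vec.∷ J) zero    = Vec.here
element-∈ (inside  Vec.∷ J) (suc i) = Vec.there (element-∈ J i)
element-∈ (outside Vec.∷ J) i       = Vec.there (element-∈ J i)

element-surjective : (J : Subset m) {j : Fin m} → j ∈ J → ∃ λ i → element J i ≡ j
element-surjective (inside  Vec.∷ J) Vec.here      = zero , ≡.refl
element-surjective (inside  Vec.∷ J) (Vec.there p) =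
  let i , e = element-surjective J p in suc i , ≡.cong suc e
element-surjective (outside Vec.∷ J) (Vec.there p) =
  let i , e = element-surjective J p in i , ≡.cong suc e

sumOver : ∀ {X : Set} → List X → (X → ℤ) → ℤ
sumOver xs f = List.foldr ℤ._+_ 0ℤ (List.map f xs)

[1⋯_] : ℕ → List ℕ
[1⋯ k ] = List.applyUpTo suc k

sign : ℕ → ℤ
sign k = -1ℤ ℤ.^ k

module Arrangement {m n : ℕ} (A : Matrix ℤ m n) (𝐚 : Vector ℤ m) where

  rows : (J : Subset m) → Matrix ℤ ∣ J ∣ n
  rows J i = A (element J i)

  entries : (J : Subset m) → Vector ℤ ∣ J ∣
  entries J i = 𝐚 (element J i)

  augmentedRows : (J : Subset m) → Matrix ℤ ∣ J ∣ (n ℕ.+ 1)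
  augmentedRows J i = rows J i V.++ (entries J i V.∷ V.[])

  -- The intersection of the real hyperplanes indexed by J.
  Flatℝ : Subset m → Pred (Vector ℝ n) 0ℓ
  Flatℝ J x = ∀ j → j ∈ J →
    Linearℝ.Hyperplane (λ k → ℤ⇒ℝ (A j k)) (ℤ⇒ℝ (𝐚 j)) x

  -- The same intersection over ℤ/ q. Reduction modulo q is the identity on
  -- representatives, since ℤ/ q has carrier ℤ and congruence as its equality.
  Flat/ : ℕ → Subset m → Pred (Vector ℤ n) 0ℓ
  Flat/ q J x = ∀ j → j ∈ J → Linear/.Hyperplane q (A j) (𝐚 j) x

  dimension : (J : Subset m) →
              Empty (Flatℝ J) ⊎ ∃ (Linearℝ.HasAffineDimension (Flatℝ J))
  dimension J = OverRationals.affine ℝ-algebra (rows J) (entries J) λ x → mk⇔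
    (λ h i → h (element J i) (element-∈ J i))
    (λ h j j∈J → let i , e = element-surjective J j∈J in
      ≡.subst (λ j → Linearℝ.Hyperplane (λ k → ℤ⇒ℝ (A j k)) (ℤ⇒ℝ (𝐚 j)) x) e (h i))

  signedMonomial : Subset m → ℕ → ℕ → ℤ
  signedMonomial J dim k = if dim ℕ.≡ᵇ k then sign ∣ J ∣ else 0ℤ

  -- The characteristic polynomial, as the function sending k to the coefficient of t ^ k:
  -- J contributes (-1) ^ ∣ J ∣ t ^ dim if its intersection is nonempty, and nothing otherwise.
  χ : ℕ → ℤ
  χ k = sumOver (subsets m) (λ J → [ (λ _ → 0ℤ) , (λ (dim , _) → signedMonomial J dim k) ]′ (dimension J))

  s : ℕ
  s = rank A

  -- Read off from χ(t) = Σ_{j ≤ s} (-1)^j w_j t^{n-j}; only used for j ≤ s ≤ n.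
  w : ℕ → ℤ
  w j = sign j ℤ.* χ (n ℕ.∸ j)

  r r̄ : Subset m → ℕ
  r J = rank (rows J)
  r̄ J = rank (augmentedRows J)

  d d̄ : Subset m → ℕ → ℕ
  d J = nth (invariantFactors (rows J))
  d̄ J = nth (invariantFactors (augmentedRows J))

  ρC : ℕ
  ρC = List.foldr lcm 1
    (List.map (λ J → d J (r J)) (List.filter (λ J → r̄ J ℕ.≟ r J) (subsets m)))

  q₀ : ℕ
  q₀ = List.foldr ℕ._⊔_ 0
    (List.map (λ J → d̄ J (r̄ J)) (List.filter (λ J → r̄ J ℕ.≟ r J ℕ.+ 1) (subsets m)))

  d̃ : Subset m → ℕ → ℕ
  d̃ J q =
    if does (All.all? (λ j → gcd q (d J j) ℕ.≟ gcd q (d̄ J j)) [1⋯ r J ])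
    then List.foldr ℕ._*_ 1 (List.map (λ j → gcd (d J j) q) [1⋯ r J ])
    else 0

  β : ℕ → ℕ → ℤ
  β j q = sign j ℤ.* sumOver
    (List.filter (λ J → r̄ J ℕ.≟ r J ×-dec r J ℕ.≟ j) (subsets m))
    (λ J → sign ∣ J ∣ ℤ.* + d̃ J q)

  -- The coefficients of the a-constituent, for 1 ≤ a ≤ ρC: the formula of β with a for q.
  γ : ℕ → ℕ → ℤ
  γ j a = β j a

  CombinatoriallyEquivalent : ℕ → ℕ → Set
  CombinatoriallyEquivalent a b = ∀ J → r̄ J ≡ r J → (∃ (Flat/ a J)) ⇔ (∃ (Flat/ b J))

  -- [𝐚_J]_q ∈ Col_q(A_J)
  InColumnSpan : ℕ → Subset m → Set
  InColumnSpan q J = Linear/.Col q (rows J) (entries J)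

{-# OPTIONS --safe #-}
module Submission where

-- For J with r̄(J) = r(J) the numbers d̃_J are products of gcds, because 𝐚_J lies in the column
-- space of A_J modulo q: an augmented column that is a combination of the others modulo q
-- leaves the invariant factors modulo q unchanged. The product ∏ gcd(d_{J,i}, e) counts,
-- up to the factor Q^{n-r(J)} with Q = ρ_C, the points x of (ℤ/Q)ⁿ with A_J x = 0 for which
-- e x lifts to an integral solution of A_J y = 0. For a fixed x, the alternating sum over
-- the J of rank j is localised at the rows vanishing at x; toggling the least element spanned
-- by larger ones cancels all J except those without broken circuits, and these are
-- independent, so that each contributes with sign (-1)^j. Hence Q^{n-j} γ_j(e) is the number of
-- pairs (x , J) with J free of broken circuits, and the condition on (x , J) becomes weaker
-- as e grows under divisibility. At e = 1 the count is w_j, and the lexicographically first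
-- basis of the rows and its subsets show that it is positive.

open import Defs
open import Algebra.Bundles using (CommutativeRing)
import Algebra.Properties.Semiring.Sum as Summation
open import Data.Bool.Base using (if_then_else_)
open import Data.Fin.Base using (Fin; zero; suc; toℕ; fromℕ; fromℕ<; inject≤; _↑ˡ_; _↑ʳ_)
import Data.Fin.Properties as Fin
open import Data.Fin.Subset using (Subset; inside; outside; ∣_∣)
open import Data.Integer.Base as ℤ using (ℤ; +_; 0ℤ; 1ℤ; -1ℤ; _+_; _*_; _-_; -_)
open import Data.Integer.Divisibility.Signed as ℤ∣ using (divides) renaming (_∣_ to _∣ᶻ_; _∣?_ to _∣ᶻ?_)
import Data.Integer.DivMod as ℤ
import Data.Integer.Properties as ℤ
open import Data.Integer.Tactic.RingSolver using (solve-∀)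
open import Data.List.Base as List using (List; []; _∷_; length)
open import Data.List.Membership.Propositional using (_∈_)
open import Data.List.Membership.Propositional.Properties using (∈-map⁺; ∈-++⁺ˡ; ∈-++⁺ʳ; ∈-filter⁺)
import Data.List.Properties as List
open import Data.List.Relation.Unary.All as All using (All; []; _∷_)
import Data.List.Relation.Unary.All.Properties as All
open import Data.List.Relation.Unary.Any using (here; there)
open import Data.List.Relation.Unary.Linked as Linked using (Linked; []; [-]; _∷_)
open import Data.Nat.Base as ℕ using (ℕ; zero; suc; z≤n; s≤s; _≤_; _<_)
open import Data.Nat.Divisibility as ℕ∣ using (_∣_; _∣?_)
open import Data.Nat.GCD as ℕ using (gcd)
open import Data.Nat.LCM as ℕ using (lcm)
open import Data.Nat.ListAction using (product)
import Data.Nat.Properties as ℕ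
open import Data.Product.Base using (Σ; ∃; ∃₂; _×_; _,_; proj₁; proj₂)
open import Data.Sum.Base using (_⊎_; inj₁; inj₂; [_,_]′)
open import Data.Unit.Base using (⊤; tt)
import Data.Vec.Base as Vec
open import Data.Vec.Functional as V using (Vector)
import Data.Vec.Functional.Properties as V
open import Function.Base using (_∘_; id)
open import Function.Bundles using (_⇔_)
open import Level using (0ℓ)
open import Relation.Binary.PropositionalEquality
open import Relation.Nullary using (¬_; Dec; yes; no; does; contradiction; _×-dec_)
open import Relation.Nullary.Decidable using (¬?; decidable-stable; map′)
open import Relation.Unary using (Pred; Decidable)

open Smith using (diagonal; SmithNormalForm; smithNormalForm; ∣-sum)
open MatrixProperties ℤ.+-*-commutativeRing
open Summation (CommutativeRing.semiring ℤ.+-*-commutativeRing)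
  using (sum; sum-cong-≋; ∑-distrib-+; *-distribˡ-sum; *-distribʳ-sum)

-- Up to a power of e, the solutions of A_J x = 0 modulo e are also counted by the product of the
-- gcd(d_{J,i}, e), but their ambient group changes with e, so two values of e could not be compared
-- point by point. One fixed modulus Q divisible by all d_{J,i}, with e moved into the lifting
-- condition, puts every e over the same points.
--
-- The sum runs only over J with r̄(J) = r(J) = j, so a toggle has to preserve both ranks. Circuits
-- are therefore taken among the rows of [A 𝐚]: adding a row spanned there leaves the kernels of
-- [A_J 𝐚_J] and of A_J unchanged. Liftability of e x depends only on the kernel of A_J, but
-- vanishing of a row at x modulo Q does not follow from rational dependence; this is why only rows
-- vanishing at x may be toggled.
--
-- All linear algebra stays over ℤ and avoids determinants. Spans are tested by integer kernels, and
-- ranks and invariant factors are compared by one principle: modulo its k-th invariant factor a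
-- matrix factors through ℤ^(k-1). Modulus 0 gives rank bounds, modulus gcd(d_{J,k}, q) compares A_J
-- with [A_J 𝐚_J].

private
  variable
    k m n p : ℕ
    X Y P Q : Set

-- Smith normal forms

∣0 : ∀ {g} → g ∣ᶻ 0ℤ
∣0 = divides 0ℤ refl

diagonal-transpose : ∀ ds (i : Fin m) (j : Fin n) → diagonal ds i j ≡ diagonal ds j i
diagonal-transpose []       i       j       = refl
diagonal-transpose (d ∷ ds) zero    zero    = refl
diagonal-transpose (d ∷ ds) zero    (suc j) = refl
diagonal-transpose (d ∷ ds) (suc i) zero    = refl
diagonal-transpose (d ∷ ds) (suc i) (suc j) = diagonal-transpose ds i j

diagonal-row-zero : ∀ ds (i : Fin m) (j : Fin n) → length ds ≤ toℕ i → diagonal ds i j ≡ 0ℤ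
diagonal-row-zero []       i       j       _       = refl
diagonal-row-zero (d ∷ ds) (suc i) zero    _       = refl
diagonal-row-zero (d ∷ ds) (suc i) (suc j) (s≤s p) = diagonal-row-zero ds i j p

diagonal-column-zero : ∀ ds (i : Fin m) (j : Fin n) → length ds ≤ toℕ j → diagonal ds i j ≡ 0ℤ
diagonal-column-zero ds i j p = trans (diagonal-transpose ds i j) (diagonal-row-zero ds j i p)

head∣diagonal : ∀ {d ds} → Linked _∣_ (d ∷ ds) → (i : Fin m) (j : Fin n) →
                + d ∣ᶻ diagonal (d ∷ ds) i j
head∣diagonal ch zero    zero    = ℤ∣.∣-refl
head∣diagonal ch zero    (suc j) = ∣0
head∣diagonal ch (suc i) zero    = ∣0
head∣diagonal [-]          (suc i) (suc j) = ∣0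
head∣diagonal (d∣e ∷ ch) (suc i) (suc j) = ℤ∣.∣-trans (ℤ∣.∣ᵤ⇒∣ d∣e) (head∣diagonal ch i j)

nth∣diagonal : ∀ {ds} → Linked _∣_ ds → ∀ k (i : Fin m) (j : Fin n) → k ≤ toℕ i →
               + nth ds (suc k) ∣ᶻ diagonal ds i j
nth∣diagonal {ds = []}     ch k       i       j       _ = ∣0
nth∣diagonal {ds = d ∷ ds} ch zero    i       j       _ = head∣diagonal ch i j
nth∣diagonal {ds = d ∷ ds} ch (suc k) (suc i) zero    _ = ∣0
nth∣diagonal {ds = d ∷ ds} ch (suc k) (suc i) (suc j) (s≤s p) = nth∣diagonal (Linked.tail ch) k i j p

head∣nth : ∀ {d ds} → Linked _∣_ (d ∷ ds) → ∀ k → d ∣ nth (d ∷ ds) (suc k)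
head∣nth ch          zero    = ℕ∣.∣-refl
head∣nth [-]         (suc k) = _ ℕ∣.∣0
head∣nth (d∣e ∷ ch)  (suc k) = ℕ∣.∣-trans d∣e (head∣nth ch k)

nth∣nth : ∀ {ds} → Linked _∣_ ds → ∀ {j k} → 1 ≤ j → j ≤ k → nth ds j ∣ nth ds k
nth∣nth {[]}     ch {suc j}       {suc k}       _ _       = ℕ∣.∣-refl
nth∣nth {d ∷ ds} ch {suc zero}    {suc k}       _ _       = head∣nth ch k
nth∣nth {d ∷ ds} ch {suc (suc j)} {suc (suc k)} _ (s≤s p) = nth∣nth (Linked.tail ch) (s≤s z≤n) p

nth-positive : ∀ {ds} → All (0 <_) ds → ∀ k → k ≤ length ds → 0 < nth ds k
nth-positive _          zero          _       = s≤s z≤n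
nth-positive (d>0 ∷ ps) (suc zero)    _       = d>0
nth-positive (d>0 ∷ ps) (suc (suc k)) (s≤s p) = nth-positive ps (suc k) p

-- By the divisibility chain each of the first k factors divides the k-th; multiplying column j by
-- the quotient makes the leading block scalar.
diagonal-scale : ∀ {ds} → Linked _∣_ ds → ∀ {k} (k≤m : k ≤ m) (k≤n : k ≤ n) → k ≤ length ds →
  Σ (Vector ℤ k) λ q → ∀ i j →
    diagonal ds (inject≤ i k≤m) (inject≤ j k≤n) * q j ≡ + nth ds k * 𝟙 i j
diagonal-scale ch z≤n z≤n _ = (λ ()) , λ ()
diagonal-scale {ds = d ∷ ds} ch {suc zero} (s≤s z≤n) (s≤s z≤n) _ = (λ _ → 1ℤ) , λ { zero zero → refl }
diagonal-scale {ds = d ∷ ds} ch {suc (suc k)} (s≤s p) (s≤s p′) (s≤s l)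
  with diagonal-scale (Linked.tail ch) p p′ l | head∣nth ch (suc k)
... | q , e | ℕ∣.divides c eq = (λ { zero → + c ; (suc j) → q j }) , λ
  { zero    zero    → trans (sym (ℤ.pos-* d c)) (trans (cong +_ (trans (ℕ.*-comm d c) (sym eq)))
      (sym (ℤ.*-identityʳ _)))
  ; zero    (suc j) → trans (ℤ.*-zeroˡ (q j)) (sym (ℤ.*-zeroʳ (+ nth ds (suc k))))
  ; (suc i) zero    → trans (ℤ.*-zeroˡ (+ c)) (sym (ℤ.*-zeroʳ (+ nth ds (suc k))))
  ; (suc i) (suc j) → e i j }

module Snf {m n} (M : Matrix ℤ m n) where

  open SmithNormalForm (smithNormalForm M) public
  open Invertible

  U⁻¹ : Matrix ℤ m m
  U⁻¹ = inverse U-unimodular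

  V⁻¹ : Matrix ℤ n n
  V⁻¹ = inverse V-unimodular

  D : Matrix ℤ m n
  D = diagonal factors

  U⁻¹⊗M : U⁻¹ ⊗ M ≋ D ⊗ V
  U⁻¹⊗M = ≋-trans (⊗-cong {M = U⁻¹} ≋-refl equation) (cancelˡ {U = U⁻¹} {U} (inverseˡ U-unimodular) (D ⊗ V))

  U⁻¹⊗M⊗V⁻¹ : U⁻¹ ⊗ (M ⊗ V⁻¹) ≋ D
  U⁻¹⊗M⊗V⁻¹ = ≋-trans (≋-sym (⊗-assoc U⁻¹ M V⁻¹)) (≋-trans (⊗-cong {N = V⁻¹} U⁻¹⊗M ≋-refl)
            (cancelʳ {U = V} {V⁻¹} (inverseʳ V-unimodular) D))

⊗-scaleʳ : (M : Matrix ℤ m n) (R : Matrix ℤ n k) (q : Vector ℤ k) → ∀ i j →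
           (M ⊗ (λ b c → R b c * q c)) i j ≡ (M ⊗ R) i j * q j
⊗-scaleʳ M R q i j = trans (sum-cong-≋ (λ b → sym (ℤ.*-assoc (M i b) (R b j) (q j))))
  (sym (*-distribʳ-sum (q j) (λ b → M i b * R b j)))

-- Counterpart of `invariantFactor-bound`: the scalar matrix of the k-th factor is attained by
-- two-sided multiplication. The two together replace the description of invariant factors by
-- minors.
diagonalise : (M : Matrix ℤ m n) → ∀ {k} → k ≤ rank M →
  Σ (Matrix ℤ k m) λ P → Σ (Matrix ℤ n k) λ R →
    ∀ i j → (P ⊗ (M ⊗ R)) i j ≡ + nth (invariantFactors M) k * 𝟙 i j
diagonalise {m} {n} M {k} k≤r = (U⁻¹ ∘ inj) , (λ b j → V⁻¹ b (inj′ j) * q j) , λ i j → begin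
  (U⁻¹ ⊗ (M ⊗ (λ b c → V⁻¹ b (inj′ c) * q c))) (inj i) j
    ≡⟨ ⊗-cong {M = U⁻¹} ≋-refl (⊗-scaleʳ M (λ b c → V⁻¹ b (inj′ c)) q) (inj i) j ⟩
  (U⁻¹ ⊗ (λ b c → (M ⊗ V⁻¹) b (inj′ c) * q c)) (inj i) j
    ≡⟨ ⊗-scaleʳ U⁻¹ (λ b c → (M ⊗ V⁻¹) b (inj′ c)) q (inj i) j ⟩
  (U⁻¹ ⊗ (M ⊗ V⁻¹)) (inj i) (inj′ j) * q j
    ≡⟨ cong (_* q j) (U⁻¹⊗M⊗V⁻¹ (inj i) (inj′ j)) ⟩
  D (inj i) (inj′ j) * q j
    ≡⟨ e i j ⟩
  + nth factors k * 𝟙 i j ∎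
  where
  open ≡-Reasoning
  open Snf M
  k≤m = ℕ.≤-trans k≤r length≤m
  k≤n = ℕ.≤-trans k≤r length≤n
  inj : Fin k → Fin m
  inj i = inject≤ i k≤m
  inj′ : Fin k → Fin n
  inj′ i = inject≤ i k≤n
  scaled = diagonal-scale chain k≤m k≤n k≤r
  q = proj₁ scaled
  e = proj₂ scaled

-- A Smith normal form with k columns has at most k factors, so the last of the k + 1 rows of
-- `U⁻¹ X = D V` is zero. The last row of `U⁻¹` pairs to 1 with the last column of `U`.
primitive-annihilator : (X : Matrix ℤ (suc k) k) → ∃₂ λ (u v : Vector ℤ (suc k)) →
  (∀ l → sum (λ i → u i * X i l) ≡ 0ℤ) × sum (λ i → u i * v i) ≡ 1ℤ
primitive-annihilator {k} X = U⁻¹ last , (λ i → U i last) ,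
  (λ l → trans (U⁻¹⊗M last l) (sum-zero _ _ λ c →
     trans (cong (_* V c l) (diagonal-row-zero factors last c
       (subst (length factors ≤_) (sym (Fin.toℕ-fromℕ k)) length≤n))) (ℤ.*-zeroˡ (V c l)))) ,
  trans (Invertible.inverseˡ U-unimodular last last) (𝟙-diag last)
  where
  open Snf X
  last = fromℕ k

-- Extension by zeros, so that "the first k columns" makes sense even for a matrix with fewer
-- columns.
pad : Vector ℤ m → ℕ → ℤ
pad {zero}  v l       = 0ℤ
pad {suc m} v zero    = v zero
pad {suc m} v (suc l) = pad (v ∘ suc) l

pad-toℕ : (v : Vector ℤ m) (i : Fin m) → pad v (toℕ i) ≡ v i
pad-toℕ v zero    = refl
pad-toℕ v (suc i) = pad-toℕ (v ∘ suc) i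

-- Modulo the k-th invariant factor, M factors through ℤ^(k-1), so it cannot
-- dominate a k × k scalar matrix.
invariantFactor-bound : (M : Matrix ℤ m n) (P : Matrix ℤ (suc k) m) (R : Matrix ℤ n (suc k)) {g e : ℤ} →
  g ∣ᶻ + nth (invariantFactors M) (suc k) →
  (∀ i j → g ∣ᶻ (P ⊗ (M ⊗ R)) i j - e * 𝟙 i j) → g ∣ᶻ e
invariantFactor-bound {m} {n} {k} M P R {g} {e} g∣d h =
  -- Once g divides every `e * u j`, it divides e itself because u · v = 1.
  subst (g ∣ᶻ_) eq (∣-sum (λ j → e * u j * v j) (λ j → ℤ∣.∣m⇒∣m*n (v j) (g∣eu j)))
  where
  open Snf M
  A : Matrix ℤ (suc k) m
  A = P ⊗ U
  T : Matrix ℤ m (suc k)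
  T = D ⊗ (V ⊗ R)
  factorise : P ⊗ (M ⊗ R) ≋ A ⊗ T
  factorise = ≋-trans (⊗-cong {M = P} ≋-refl
      (≋-trans (⊗-cong {N = R} equation ≋-refl)
        (≋-trans (⊗-assoc U (D ⊗ V) R) (⊗-cong {M = U} ≋-refl (⊗-assoc D V R)))))
    (≋-sym (⊗-assoc P U T))
  ann = primitive-annihilator {k} (λ i l → pad (A i) (toℕ l))
  u = proj₁ ann
  v = proj₁ (proj₂ ann)
  uX = proj₁ (proj₂ (proj₂ ann))
  uv = proj₂ (proj₂ (proj₂ ann))
  uᵣ : Matrix ℤ 1 (suc k)
  uᵣ _ = u
  small : ∀ t → toℕ t < k → (uᵣ ⊗ A) zero t ≡ 0ℤ
  small t t<k = trans (sum-cong-≋ (λ i → cong (u i *_) (sym (trans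
    (cong (pad (A i)) (Fin.toℕ-fromℕ< t<k)) (pad-toℕ (A i) t))))) (uX (fromℕ< t<k))
  -- The first k columns of `A` are killed by `u`; the rows of `D` from index k on are divisible by
  -- the (k+1)-th factor, hence by g.
  term : ∀ t j → g ∣ᶻ (uᵣ ⊗ A) zero t * T t j
  term t j with toℕ t ℕ.<? k
  ... | yes t<k = subst (λ z → g ∣ᶻ z * T t j) (sym (small t t<k)) ∣0
  ... | no t≮k = ℤ∣.∣n⇒∣m*n ((uᵣ ⊗ A) zero t) (ℤ∣.∣-trans g∣d (∣-sum (λ c → D t c * (V ⊗ R) c j)
          (λ c → ℤ∣.∣m⇒∣m*n ((V ⊗ R) c j) (nth∣diagonal chain k t c (ℕ.≮⇒≥ t≮k)))))
  g∣uPMR : ∀ j → g ∣ᶻ (uᵣ ⊗ (P ⊗ (M ⊗ R))) zero j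
  g∣uPMR j = subst (g ∣ᶻ_) (trans (⊗-assoc uᵣ A T zero j)
      (sym (⊗-cong {M = uᵣ} ≋-refl factorise zero j)))
    (∣-sum (λ t → (uᵣ ⊗ A) zero t * T t j) (λ t → term t j))
  g∣eu : ∀ j → g ∣ᶻ e * u j
  g∣eu j = ℤ∣.∣m+n∣m⇒∣n (subst (g ∣ᶻ_) split-sum (g∣uPMR j))
    (∣-sum (λ i → u i * ((P ⊗ (M ⊗ R)) i j - e * 𝟙 i j)) (λ i → ℤ∣.∣n⇒∣m*n (u i) (h i j)))
    where
    pull : ∀ u e x → u * (e * x) ≡ e * (u * x)
    pull = solve-∀
    rearrange : ∀ u p ex → u * p ≡ u * (p - ex) + u * ex
    rearrange = solve-∀
    N = P ⊗ (M ⊗ R)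
    split-sum : (uᵣ ⊗ N) zero j ≡ sum (λ i → u i * (N i j - e * 𝟙 i j)) + e * u j
    split-sum = trans (sum-cong-≋ (λ i → rearrange (u i) (N i j) (e * 𝟙 i j)))
      (trans (∑-distrib-+ (λ i → u i * (N i j - e * 𝟙 i j)) (λ i → u i * (e * 𝟙 i j)))
        (cong (λ z → sum (λ i → u i * (N i j - e * 𝟙 i j)) + z)
            (trans (sum-cong-≋ (λ i → pull (u i) e (𝟙 i j)))
          (trans (sym (*-distribˡ-sum e (λ i → u i * 𝟙 i j))) (cong (e *_) (ᵥ*𝟙 u j))))))
  eq : sum (λ j → e * u j * v j) ≡ e
  eq = trans (sum-cong-≋ (λ j → ℤ.*-assoc e (u j) (v j)))
    (trans (sym (*-distribˡ-sum e (λ j → u j * v j))) (trans (cong (e *_) uv) (ℤ.*-identityʳ e)))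

-- Ranks and kernels

dot : Vector ℤ n → Vector ℤ n → ℤ
dot α y = sum (λ k → α k * y k)

dot-comm : (α y : Vector ℤ n) → dot α y ≡ dot y α
dot-comm α y = sum-cong-≋ (λ k → ℤ.*-comm (α k) (y k))

dot-+ʳ : (α x y : Vector ℤ n) → dot α (λ k → x k + y k) ≡ dot α x + dot α y
dot-+ʳ α x y = trans (sum-cong-≋ (λ k → ℤ.*-distribˡ-+ (α k) (x k) (y k)))
  (∑-distrib-+ (λ k → α k * x k) (λ k → α k * y k))

dot-scaleʳ : (α x : Vector ℤ n) (t : ℤ) → dot α (λ k → t * x k) ≡ t * dot α x
dot-scaleʳ α x t = trans (sum-cong-≋ (λ k → swap (α k) t (x k))) (sym (*-distribˡ-sum t (λ k → α k * x k)))
  where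
  swap : ∀ a t x → a * (t * x) ≡ t * (a * x)
  swap = solve-∀

dot-zeroʳ : (α : Vector ℤ n) {x : Vector ℤ n} → (∀ k → x k ≡ 0ℤ) → dot α x ≡ 0ℤ
dot-zeroʳ {n} α h = sum-zero n _ (λ k → trans (cong (α k *_) (h k)) (ℤ.*-zeroʳ (α k)))

dot-zeroˡ : {α : Vector ℤ n} (x : Vector ℤ n) → (∀ k → α k ≡ 0ℤ) → dot α x ≡ 0ℤ
dot-zeroˡ {α = α} x h = trans (dot-comm α x) (dot-zeroʳ x h)

nonzero-* : ∀ {x y} → x ≢ 0ℤ → y ≢ 0ℤ → x * y ≢ 0ℤ
nonzero-* {x} {y} x≢0 y≢0 e with ℤ.i*j≡0⇒i≡0∨j≡0 x e
... | inj₁ z = x≢0 z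
... | inj₂ z = y≢0 z

+-nonzero : ∀ {d} → 0 < d → + d ≢ 0ℤ
+-nonzero (s≤s _) ()

nth-beyond : ∀ ds {k} → length ds < k → nth ds k ≡ 0
nth-beyond []       {suc k}       _       = refl
nth-beyond (d ∷ ds) {suc (suc k)} (s≤s p) = nth-beyond ds p

Kernel : Matrix ℤ m n → Vector ℤ n → Set
Kernel M y = ∀ i → (M *ᵥ y) i ≡ 0ℤ

-- This is `invariantFactor-bound` with modulus 0: beyond the rank `nth` takes its default value 0,
-- and 0 divides no nonzero e.
rank-lower : (M : Matrix ℤ m n) (P : Matrix ℤ k m) (R : Matrix ℤ n k) {e : ℤ} → e ≢ 0ℤ →
             (∀ i j → (P ⊗ (M ⊗ R)) i j ≡ e * 𝟙 i j) → k ≤ rank M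
rank-lower {k = zero}  M P R e≢0 h = z≤n
rank-lower {k = suc k} M P R {e} e≢0 h with suc k ℕ.≤? rank M
... | yes p = p
... | no k≰r = contradiction (ℤ∣.0∣⇒≡0 (invariantFactor-bound M P R {0ℤ} {e}
    (subst (λ z → 0ℤ ∣ᶻ + z) (sym (nth-beyond (invariantFactors M) (ℕ.≰⇒> k≰r))) ∣0)
    (λ i j → subst (0ℤ ∣ᶻ_) (sym (ℤ.i≡j⇒i-j≡0 (h i j))) ∣0))) e≢0

nth-nonzero : (M : Matrix ℤ m n) → ∀ {k} → k ≤ rank M → + nth (invariantFactors M) k ≢ 0ℤ
nth-nonzero M {k} k≤r = +-nonzero (nth-positive (SmithNormalForm.positive (smithNormalForm M)) k k≤r)

product-nonzero : ∀ {ds} → All (0 <_) ds → + product ds ≢ 0ℤ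
product-nonzero []         = λ ()
product-nonzero {d ∷ ds} (p ∷ ps) e =
  nonzero-* (+-nonzero p) (product-nonzero ps) (trans (sym (ℤ.pos-* d (product ds))) e)

diagonal-solve : ∀ ds → length ds ≤ n → (b : Vector ℤ m) →
  (∀ i → length ds ≤ toℕ i → b i ≡ 0ℤ) →
  ∃ λ (z : Vector ℤ n) → ∀ i → (diagonal ds *ᵥ z) i ≡ + product ds * b i
diagonal-solve {n} [] _ b b≡0 = 𝟘ᵥ , λ i →
  trans (sum0ˡ n 𝟘ᵥ) (sym (trans (ℤ.*-identityˡ (b i)) (b≡0 i z≤n)))
diagonal-solve {suc n} {zero} (d ∷ ds) _ b _ = 𝟘ᵥ , λ ()
diagonal-solve {suc n} {suc m} (d ∷ ds) (s≤s p) b b≡0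
  with diagonal-solve ds p (b ∘ suc) (λ i q → b≡0 (suc i) (s≤s q))
... | z , e = z′ , λ
  { zero → trans (+0 refl (sum0ˡ n (z′ ∘ suc))) (trans (assoc′ (+ d) π (b zero))
      (cong (_* b zero) (sym (ℤ.pos-* d (product ds)))))
  ; (suc i) → trans (0+ (ℤ.*-zeroˡ (z′ zero)) (dot-scaleʳ (diagonal ds i) z (+ d)))
      (trans (cong (+ d *_) (e i)) (trans (assoc′ (+ d) π (b (suc i)))
          (cong (_* b (suc i)) (sym (ℤ.pos-* d (product ds)))))) }
  where
  π = + product ds
  -- The target is d π b. Cancelling the pivot d leaves π b at the head, while the tail, solved for
  -- π b, is rescaled by d.
  z′ : Vector ℤ (suc n)
  z′ zero    = π * b zero
  z′ (suc i) = + d * z i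
  assoc′ : ∀ d p b → d * (p * b) ≡ d * p * b
  assoc′ = solve-∀

-- A multiplier that clears all denominators of the rational systems with matrix M.
denominator : Matrix ℤ m n → ℤ
denominator M = + product (invariantFactors M)

denominator-nonzero : (M : Matrix ℤ m n) → denominator M ≢ 0ℤ
denominator-nonzero M = product-nonzero (SmithNormalForm.positive (smithNormalForm M))

Combination : Matrix ℤ m n → Vector ℤ n → Set
Combination {m} M β = ∃ λ (c : Vector ℤ m) → ∀ k → sum (λ i → c i * M i k) ≡ denominator M * β k

Separation : Matrix ℤ m n → Vector ℤ n → Set
Separation M β = ∃ λ y → Kernel M y × dot β y ≢ 0ℤ

-- Dual form of "β lies in the rational row space of M". Being free of coefficients, it passes along
-- inclusions of kernels.
Dependent : Matrix ℤ m n → Vector ℤ n → Set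
Dependent M β = ∀ y → Kernel M y → dot β y ≡ 0ℤ

-- In the coordinates β V⁻¹ the row space consists of the vectors vanishing beyond the rank. A
-- nonzero coordinate c there makes column c of V⁻¹ a separating kernel vector; otherwise the
-- diagonal system is solvable after clearing denominators.
combine-or-separate : (M : Matrix ℤ m n) (β : Vector ℤ n) → Combination M β ⊎ Separation M β
combine-or-separate {m} {n} M β
  with Fin.any? (λ c → (length (invariantFactors M) ℕ.≤? toℕ c) ×-dec ¬?
      (dot β (λ b → Snf.V⁻¹ M b c) ℤ.≟ 0ℤ))
... | yes (c , r≤c , ≢0) = inj₂ ((λ b → V⁻¹ b c) , kills , ≢0)
  where
  open Snf M
  kills : Kernel M (λ b → V⁻¹ b c)
  kills i = trans (⊗-cong {N = V⁻¹} equation ≋-refl i c)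
    (trans (⊗-assoc U (D ⊗ V) V⁻¹ i c) (trans (⊗-cong {M = U} ≋-refl
        (cancelʳ {U = V} {V⁻¹} (Invertible.inverseʳ V-unimodular) D) i c)
      (dot-zeroʳ (U i) (λ a → diagonal-column-zero factors a c r≤c))))
... | no none = inj₁ ((λ i → (cᵣ ⊗ U⁻¹) zero i) , λ k → begin
    ((cᵣ ⊗ U⁻¹) ⊗ M) zero k          ≡⟨ ⊗-assoc cᵣ U⁻¹ M zero k ⟩
    (cᵣ ⊗ (U⁻¹ ⊗ M)) zero k          ≡⟨ ⊗-cong {M = cᵣ} ≋-refl U⁻¹⊗M zero k ⟩
    (cᵣ ⊗ (D ⊗ V)) zero k          ≡⟨ ⊗-assoc cᵣ D V zero k ⟨
    ((cᵣ ⊗ D) ⊗ V) zero k          ≡⟨ sum-cong-≋ (λ j → cong (_* V j k) (cD j)) ⟩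
    sum (λ j → π * w j * V j k)    ≡⟨ sum-cong-≋ (λ j → ℤ.*-assoc π (w j) (V j k)) ⟩
    sum (λ j → π * (w j * V j k))  ≡⟨ *-distribˡ-sum π (λ j → w j * V j k) ⟨
    π * ((βᵣ ⊗ V⁻¹) ⊗ V) zero k      ≡⟨ cong (π *_)
        (cancelʳ {U = V⁻¹} {V} (Invertible.inverseˡ V-unimodular) βᵣ zero k) ⟩
    π * β k                        ∎)
  where
  open ≡-Reasoning
  open Snf M
  π = denominator M
  βᵣ : Matrix ℤ 1 n
  βᵣ _ = β
  w : Vector ℤ n
  w j = (βᵣ ⊗ V⁻¹) zero j
  solved = diagonal-solve {m} {n} factors length≤m w
    (λ c r≤c → decidable-stable (w c ℤ.≟ 0ℤ) (λ ≢0 → none (c , r≤c , ≢0)))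
  cᵣ : Matrix ℤ 1 m
  cᵣ _ = proj₁ solved
  cD : ∀ j → (cᵣ ⊗ D) zero j ≡ π * w j
  cD j = trans (sum-cong-≋ (λ t → trans (ℤ.*-comm (proj₁ solved t) (D t j))
    (cong (_* proj₁ solved t) (diagonal-transpose factors t j)))) (proj₂ solved j)

dependent⇒combination : (M : Matrix ℤ m n) {β : Vector ℤ n} → Dependent M β → Combination M β
dependent⇒combination M {β} dep with combine-or-separate M β
... | inj₁ c = c
... | inj₂ (y , My≡0 , βy≢0) = contradiction (dep y My≡0) βy≢0

combination⇒dependent : (M : Matrix ℤ m n) {β : Vector ℤ n} → Combination M β → Dependent M β
combination⇒dependent {m} M {β} (c , e) y My≡0 with ℤ.i*j≡0⇒i≡0∨j≡0 (denominator M) {dot β y} (begin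
    denominator M * dot β y                 ≡⟨ *-distribˡ-sum (denominator M) (λ k → β k * y k) ⟩
    sum (λ k → denominator M * (β k * y k)) ≡⟨ sum-cong-≋ (λ k → ℤ.*-assoc (denominator M) (β k) (y k)) ⟨
    dot (λ k → denominator M * β k) y       ≡⟨ sum-cong-≋ (λ k → cong (_* y k) (e k)) ⟨
    ((cᵣ ⊗ M) *ᵥ y) zero                    ≡⟨ *ᵥ-assoc cᵣ M y zero ⟩
    dot c (M *ᵥ y)                          ≡⟨ dot-zeroʳ c My≡0 ⟩
    0ℤ ∎)
  where
  open ≡-Reasoning
  cᵣ : Matrix ℤ 1 m
  cᵣ _ = c
... | inj₁ z = contradiction z (denominator-nonzero M)
... | inj₂ z = z

-- By duality every row of N, times the denominator of M, is an integer combination of rows of M. A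
-- nonzero scalar matrix obtained from N is thus also obtained, up to that factor, from M.
rank-antitone : (M : Matrix ℤ m n) (N : Matrix ℤ p n) → (∀ y → Kernel M y → Kernel N y) → rank N ≤ rank M
rank-antitone {m} {n} {p} M N ker with diagonalise N {rank N} ℕ.≤-refl
... | P , R , e = rank-lower M (P ⊗ C) R (nonzero-* (denominator-nonzero M)
    (nth-nonzero N {rank N} ℕ.≤-refl)) λ i j → begin
    ((P ⊗ C) ⊗ (M ⊗ R)) i j                ≡⟨ ⊗-assoc P C (M ⊗ R) i j ⟩
    (P ⊗ (C ⊗ (M ⊗ R))) i j                ≡⟨ ⊗-cong {M = P} ≋-refl (≋-sym (⊗-assoc C M R)) i j ⟩
    (P ⊗ ((C ⊗ M) ⊗ R)) i j                ≡⟨ ⊗-cong {M = P} ≋-refl scaled i j ⟩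
    (P ⊗ (λ a b → π * (N ⊗ R) a b)) i j    ≡⟨ dot-scaleʳ (P i) (λ a → (N ⊗ R) a j) π ⟩
    π * (P ⊗ (N ⊗ R)) i j                  ≡⟨ cong (π *_) (e i j) ⟩
    π * (+ nth (invariantFactors N) (rank N) * 𝟙 i j)  ≡⟨ ℤ.*-assoc π _ (𝟙 i j) ⟨
    π * + nth (invariantFactors N) (rank N) * 𝟙 i j    ∎
  where
  open ≡-Reasoning
  π = denominator M
  combination : ∀ i → Combination M (N i)
  combination i = dependent⇒combination M (λ y My≡0 → ker y My≡0 i)
  C : Matrix ℤ p m
  C i = proj₁ (combination i)
  scaled : (C ⊗ M) ⊗ R ≋ (λ a b → π * (N ⊗ R) a b)
  scaled a b = trans (sum-cong-≋ (λ k → trans (cong (_* R k b) (proj₂ (combination a) k))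
      (ℤ.*-assoc π (N a k) (R k b))))
    (sym (*-distribˡ-sum π (λ k → N a k * R k b)))

rank-cong : (M : Matrix ℤ m n) (N : Matrix ℤ p n) →
            (∀ y → Kernel M y → Kernel N y) → (∀ y → Kernel N y → Kernel M y) → rank M ≡ rank N
rank-cong M N f g = ℕ.≤-antisym (rank-antitone N M g) (rank-antitone M N f)

-- The separating vector y kills the lower rows but not the first one, so it supplies one more
-- column for the scalar matrix.
rank-suc : (M : Matrix ℤ (suc m) n) → Separation (M ∘ suc) (M zero) → suc (rank (M ∘ suc)) ≤ rank M
rank-suc {m} {n} M (y , My≡0 , t≢0)
  with diagonalise (M ∘ suc) {rank (M ∘ suc)} ℕ.≤-refl
... | P , R , e = rank-lower M P′ R′ (nonzero-* t≢0 (nth-nonzero (M ∘ suc) {rank (M ∘ suc)} ℕ.≤-refl)) eq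
  where
  r = rank (M ∘ suc)
  β = M zero
  t = dot β y
  d = + nth (invariantFactors (M ∘ suc)) r
  P′ : Matrix ℤ (suc r) (suc m)
  P′ = block 1ℤ 𝟘ᵥ 𝟘ᵥ P
  -- The first column is scaled by d and the old ones by t so that all diagonal entries become t d;
  -- subtracting a multiple of y clears the top row without affecting the lower ones.
  R′ : Matrix ℤ n (suc r)
  R′ b zero    = d * y b
  R′ b (suc j) = t * R b j + - dot β (λ c → R c j) * y b
  column : ∀ α j → dot α (λ b → R′ b (suc j)) ≡ t * dot α (λ b → R b j) + - dot β (λ c → R c j) * dot α y
  column α j = trans (dot-+ʳ α (λ b → t * R b j) (λ b → - dot β (λ c → R c j) * y b))
    (cong₂ _+_ (dot-scaleʳ α (λ b → R b j) t) (dot-scaleʳ α y (- dot β (λ c → R c j))))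
  cancel : ∀ t x → t * x + - x * t ≡ 0ℤ
  cancel = solve-∀
  eq : ∀ i j → (P′ ⊗ (M ⊗ R′)) i j ≡ t * d * 𝟙 i j
  eq zero zero = trans (+0 (ℤ.*-identityˡ _) (sum0ˡ m (λ a → (M ⊗ R′) (suc a) zero)))
    (trans (dot-scaleʳ β y d) (trans (ℤ.*-comm d t) (sym (ℤ.*-identityʳ (t * d)))))
  eq zero (suc j) = trans (+0 (ℤ.*-identityˡ _) (sum0ˡ m (λ a → (M ⊗ R′) (suc a) (suc j))))
    (trans (column β j) (trans (cancel t (dot β (λ c → R c j))) (sym (ℤ.*-zeroʳ (t * d)))))
  eq (suc i) zero = trans (0+ (ℤ.*-zeroˡ ((M ⊗ R′) zero zero)) (dot-zeroʳ (P i) (λ a →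
      trans (dot-scaleʳ (M (suc a)) y d) (trans (cong (d *_) (My≡0 a)) (ℤ.*-zeroʳ d)))))
    (sym (ℤ.*-zeroʳ (t * d)))
  eq (suc i) (suc j) = begin
    0ℤ * (M ⊗ R′) zero (suc j) + dot (P i) (λ a → (M ⊗ R′) (suc a) (suc j))
      ≡⟨ 0+ (ℤ.*-zeroˡ ((M ⊗ R′) zero (suc j))) refl ⟩
    dot (P i) (λ a → (M ⊗ R′) (suc a) (suc j))
      ≡⟨ sum-cong-≋ (λ a → cong (P i a *_) (trans (column (M (suc a)) j)
           (trans (cong (λ z → t * dot (M (suc a)) (λ b → R b j) + - dot β (λ c → R c j) * z) (My≡0 a))
             (trans (cong (ℤ._+_ (t * dot (M (suc a)) (λ b → R b j)))
                 (ℤ.*-zeroʳ (- dot β (λ c → R c j)))) (ℤ.+-identityʳ _))))) ⟩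
    dot (P i) (λ a → t * ((M ∘ suc) ⊗ R) a j)
      ≡⟨ dot-scaleʳ (P i) (λ a → ((M ∘ suc) ⊗ R) a j) t ⟩
    t * (P ⊗ ((M ∘ suc) ⊗ R)) i j
      ≡⟨ cong (t *_) (e i j) ⟩
    t * (d * 𝟙 i j)
      ≡⟨ ℤ.*-assoc t d (𝟙 i j) ⟨
    t * d * 𝟙 i j ∎
    where open ≡-Reasoning

-- Appending a column

augment : Matrix ℤ m n → Vector ℤ m → Matrix ℤ m (n ℕ.+ 1)
augment A b i = A i V.++ (b i V.∷ V.[])

init : Vector ℤ (n ℕ.+ 1) → Vector ℤ n
init y i = y (i ↑ˡ 1)

last : Vector ℤ (n ℕ.+ 1) → ℤ
last {n} y = y (n ↑ʳ zero)

sum-init-last : ∀ n (f : Vector ℤ (n ℕ.+ 1)) → sum f ≡ sum (init f) + last {n} f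
sum-init-last zero    f = ℤ.+-comm (f zero) 0ℤ
sum-init-last (suc n) f = trans (cong (ℤ._+_ (f zero)) (sum-init-last n (f ∘ suc)))
    (sym (ℤ.+-assoc (f zero) _ _))

dot-snocˡ : (α : Vector ℤ n) (a : ℤ) (y : Vector ℤ (n ℕ.+ 1)) →
           dot (α V.++ (a V.∷ V.[])) y ≡ dot α (init y) + a * last {n} y
dot-snocˡ {n} α a y = trans (sum-init-last n (λ k → α′ k * y k)) (cong₂ _+_
    (sum-cong-≋ (λ k → cong (_* y (k ↑ˡ 1)) (V.lookup-++ˡ α (a V.∷ V.[]) k)))
    (cong (_* last {n} y) (V.lookup-++ʳ α (a V.∷ V.[]) zero)))
  where α′ = α V.++ (a V.∷ V.[])

dot-snoc : (α x : Vector ℤ n) (a t : ℤ) →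
           dot (α V.++ (a V.∷ V.[])) (x V.++ (t V.∷ V.[])) ≡ dot α x + a * t
dot-snoc {n} α x a t = trans (dot-snocˡ α a (x V.++ (t V.∷ V.[]))) (cong₂ _+_
  (sum-cong-≋ (λ k → cong (α k *_) (V.lookup-++ˡ x (t V.∷ V.[]) k)))
  (cong (a *_) (V.lookup-++ʳ x (t V.∷ V.[]) zero)))

dot-padʳ : (α x : Vector ℤ n) (a : ℤ) → dot (α V.++ (a V.∷ V.[])) (x V.++ (0ℤ V.∷ V.[])) ≡ dot α x
dot-padʳ α x a = trans (dot-snoc α x a 0ℤ) (trans (cong (ℤ._+_ (dot α x)) (ℤ.*-zeroʳ a)) (ℤ.+-identityʳ _))

module _ (A : Matrix ℤ m n) (b : Vector ℤ m) where

  private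
    Ā = augment A b

    padded : Matrix ℤ n k → Matrix ℤ (n ℕ.+ 1) k
    padded R c j = ((λ a → R a j) V.++ (0ℤ V.∷ V.[])) c

    padded-⊗ : (R : Matrix ℤ n k) → Ā ⊗ padded R ≋ A ⊗ R
    padded-⊗ R i j = dot-padʳ (A i) (λ a → R a j) (b i)

    -- Substitutes c for t times the appended coordinate. If A c = t b this turns `Ā R` into t times
    -- itself over A; in general the error is a multiple of A c - t b.
    mix : ℤ → Vector ℤ n → Matrix ℤ (n ℕ.+ 1) k → Matrix ℤ n k
    mix t c R a j = t * init (λ x → R x j) a + last {n} (λ x → R x j) * c a

    mix-⊗ : ∀ t c (R : Matrix ℤ (n ℕ.+ 1) k) i j →
            (A ⊗ mix t c R) i j ≡ t * (Ā ⊗ R) i j + last {n} (λ x → R x j) * ((A *ᵥ c) i - t * b i)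
    mix-⊗ t c R i j = begin
      (A ⊗ mix t c R) i j
        ≡⟨ dot-+ʳ (A i) (λ a → t * init (λ x → R x j) a) (λ a → l * c a) ⟩
      dot (A i) (λ a → t * init (λ x → R x j) a) + dot (A i) (λ a → l * c a)
        ≡⟨ cong₂ _+_ (dot-scaleʳ (A i) (init (λ x → R x j)) t) (dot-scaleʳ (A i) c l) ⟩
      t * dot (A i) (init (λ x → R x j)) + l * (A *ᵥ c) i
        ≡⟨ regroup t (dot (A i) (init (λ x → R x j))) l ((A *ᵥ c) i) (b i) ⟩
      t * (dot (A i) (init (λ x → R x j)) + b i * l) + l * ((A *ᵥ c) i - t * b i)
        ≡⟨ cong (λ z → t * z + l * ((A *ᵥ c) i - t * b i)) (dot-snocˡ (A i) (b i) (λ x → R x j)) ⟨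
      t * (Ā ⊗ R) i j + l * ((A *ᵥ c) i - t * b i) ∎
      where
      open ≡-Reasoning
      l = last {n} (λ x → R x j)
      regroup : ∀ t x l y b → t * x + l * y ≡ t * (x + b * l) + l * (y - t * b)
      regroup = solve-∀

  -- A scalar matrix obtained from A is obtained from [A b] by padding R with a zero row, so the
  -- bound for [A b], with its own k-th factor as modulus, applies to it.
  augment-∣ : ∀ k → k ≤ rank A → nth (invariantFactors Ā) k ∣ nth (invariantFactors A) k
  augment-∣ zero    _   = ℕ∣.∣-refl
  augment-∣ (suc k) k≤r with diagonalise A k≤r
  ... | P , R , e = ℤ∣.∣⇒∣ᵤ (invariantFactor-bound Ā P (padded R)
      {e = + nth (invariantFactors A) (suc k)} ℤ∣.∣-refl λ i j →
    subst (_ ∣ᶻ_) (sym (ℤ.i≡j⇒i-j≡0 (trans (⊗-cong {M = P} ≋-refl (padded-⊗ R) i j) (e i j)))) ∣0)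

  rank-augment-≥ : rank A ≤ rank Ā
  rank-augment-≥ with diagonalise A {rank A} ℕ.≤-refl
  ... | P , R , e = rank-lower Ā P (padded R) (nth-nonzero A {rank A} ℕ.≤-refl)
    (λ i j → trans (⊗-cong {M = P} ≋-refl (padded-⊗ R) i j) (e i j))

  rank-augment-≤ : ∀ {t c} → t ≢ 0ℤ → (∀ i → (A *ᵥ c) i ≡ t * b i) → rank Ā ≤ rank A
  rank-augment-≤ {t} {c} t≢0 Ac with diagonalise Ā {rank Ā} ℕ.≤-refl
  ... | P , R , e = rank-lower A P (mix t c R) (nonzero-* t≢0 (nth-nonzero Ā {rank Ā} ℕ.≤-refl))
    λ i j → trans (⊗-cong {M = P} ≋-refl AR i j)
      (trans (dot-scaleʳ (P i) (λ a → (Ā ⊗ R) a j) t)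
          (trans (cong (t *_) (e i j)) (sym (ℤ.*-assoc t _ (𝟙 i j)))))
    where
    AR : A ⊗ mix t c R ≋ (λ i j → t * (Ā ⊗ R) i j)
    AR i j = trans (mix-⊗ t c R i j) (trans
      (cong (λ z → t * (Ā ⊗ R) i j + last {n} (λ x → R x j) * z) (ℤ.i≡j⇒i-j≡0 (Ac i)))
      (trans (cong (ℤ._+_ (t * (Ā ⊗ R) i j)) (ℤ.*-zeroʳ (last {n} (λ x → R x j)))) (ℤ.+-identityʳ _)))

  -- Modulo g = gcd(d_k, q) the column b equals A c, so `mix 1ℤ c` carries the scalar matrix of
  -- [A b] over to A with an error divisible by g. The bound for A then makes g divide the k-th
  -- factor of [A b].
  modular-∣ : ∀ {q c} → (∀ i → + q ∣ᶻ (A *ᵥ c) i - b i) → ∀ k → k ≤ rank Ā →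
              gcd (nth (invariantFactors A) k) q ∣ nth (invariantFactors Ā) k
  modular-∣ {q} {c} h zero    _   = ℕ.gcd[m,n]∣m 1 q
  modular-∣ {q} {c} h (suc k) k≤r with diagonalise Ā k≤r
  ... | P , R , e = ℤ∣.∣⇒∣ᵤ (invariantFactor-bound A P R′ {g} {+ nth (invariantFactors Ā) (suc k)}
        (ℤ∣.∣ᵤ⇒∣ (ℕ.gcd[m,n]∣m d q)) λ i j →
          subst (g ∣ᶻ_) (sym (trans (cong (_- _) (PAR i j)) (simplify _ (e i j))))
            (∣-sum (λ a → P i a * (last {n} (λ x → R x j) * ((A *ᵥ c) a - 1ℤ * b a))) λ a →
              ℤ∣.∣n⇒∣m*n (P i a) (ℤ∣.∣n⇒∣m*n (last {n} (λ x → R x j))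
                  (subst (λ z → g ∣ᶻ (A *ᵥ c) a - z) (sym (ℤ.*-identityˡ (b a)))
                (ℤ∣.∣-trans (ℤ∣.∣ᵤ⇒∣ {g} {+ q} (ℕ.gcd[m,n]∣n d q)) (h a))))))
    where
    d = nth (invariantFactors A) (suc k)
    g = + gcd d q
    R′ = mix 1ℤ c R
    S : Matrix ℤ m (suc k)
    S i j = last {n} (λ x → R x j) * ((A *ᵥ c) i - 1ℤ * b i)
    PAR : ∀ i j → (P ⊗ (A ⊗ R′)) i j ≡ (P ⊗ (Ā ⊗ R)) i j + (P ⊗ S) i j
    PAR i j = trans (sum-cong-≋ (λ a → cong (P i a *_)
        (trans (mix-⊗ 1ℤ c R a j) (cong (_+ S a j) (ℤ.*-identityˡ ((Ā ⊗ R) a j))))))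
      (dot-+ʳ (P i) (λ a → (Ā ⊗ R) a j) (λ a → S a j))
    simplify : ∀ {x y} z → x ≡ y → x + z - y ≡ z
    simplify {x} z refl = lemma x z
      where
      lemma : ∀ x z → x + z - x ≡ z
      lemma = solve-∀

-- Consistency of linear systems

_ᵀ : Matrix ℤ m n → Matrix ℤ n m
(A ᵀ) j i = A i j

-- Rational solvability with the denominator cleared: the solution is c / t.
Solvable : Matrix ℤ m n → Vector ℤ m → Set
Solvable A b = ∃₂ λ t c → t ≢ 0ℤ × (∀ i → (A *ᵥ c) i ≡ t * b i)

-- A row vector u with u A = 0 and u · b ≠ 0.
Obstructed : Matrix ℤ m n → Vector ℤ m → Set
Obstructed A b = Separation (A ᵀ) b

solvable-or-obstructed : (A : Matrix ℤ m n) (b : Vector ℤ m) → Solvable A b ⊎ Obstructed A b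
solvable-or-obstructed A b with combine-or-separate (A ᵀ) b
... | inj₁ (c , e) = inj₁ (denominator (A ᵀ) , c , denominator-nonzero (A ᵀ) ,
        λ i → trans (dot-comm (A i) c) (e i))
... | inj₂ s = inj₂ s

-- Pairing [A b] y = 0 with u gives (u · b) times the last coordinate of y, which must therefore
-- vanish. So the last unit vector `e` lies in the row space of [A b], along with the rows of [A 0],
-- from which it is independent.
obstructed⇒rank-< : (A : Matrix ℤ m n) (b : Vector ℤ m) → Obstructed A b → rank A < rank (augment A b)
obstructed⇒rank-< {m} {n} A b (u , uA≡0 , bu≢0) =
  ℕ.≤-trans (s≤s (rank-augment-≥ A 𝟘ᵥ)) (ℕ.≤-trans (rank-suc Z (e , killed , e≢0))
      (rank-antitone (augment A b) Z ker))
  where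
  e : Vector ℤ (n ℕ.+ 1)
  e = 𝟘ᵥ {n} V.++ (1ℤ V.∷ V.[])
  Z : Matrix ℤ (suc m) (n ℕ.+ 1)
  Z zero    = e
  Z (suc i) = augment A 𝟘ᵥ i
  killed : Kernel (augment A 𝟘ᵥ) e
  killed i = trans (dot-snoc (A i) 𝟘ᵥ 0ℤ 1ℤ) (trans (ℤ.+-identityʳ _) (dot-zeroʳ (A i) (λ _ → refl)))
  e≢0 : dot e e ≢ 0ℤ
  e≢0 z with trans (sym (trans (dot-snoc {n} 𝟘ᵥ 𝟘ᵥ 1ℤ 1ℤ) (cong (_+ 1ℤ) (dot-zeroˡ {n} 𝟘ᵥ (λ _ → refl))))) z
  ... | ()
  module _ (y : Vector ℤ (n ℕ.+ 1)) (Āy≡0 : Kernel (augment A b) y) where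
    x = init {n} y
    l = last {n} y
    uᵣ : Matrix ℤ 1 m
    uᵣ _ = u
    row : ∀ i → (A *ᵥ x) i + b i * l ≡ 0ℤ
    row i = trans (sym (dot-snocˡ (A i) (b i) y)) (Āy≡0 i)
    lzero : dot b u * l ≡ 0ℤ
    lzero = begin
      dot b u * l                                        ≡⟨ cong (_* l) (dot-comm b u) ⟩
      dot u b * l                                        ≡⟨ *-distribʳ-sum l (λ i → u i * b i) ⟩
      sum (λ i → u i * b i * l)                          ≡⟨ sum-cong-≋ (λ i → ℤ.*-assoc (u i) (b i) l) ⟩
      dot u (λ i → b i * l)                              ≡⟨ ℤ.+-identityˡ _ ⟨
      0ℤ + dot u (λ i → b i * l)                         ≡⟨ cong (_+ dot u (λ i → b i * l))
          (trans (sym (*ᵥ-assoc uᵣ A x zero))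
                                                              (dot-zeroˡ x (λ j → trans
                                                                  (dot-comm u (λ i → A i j)) (uA≡0 j)))) ⟨
      dot u (A *ᵥ x) + dot u (λ i → b i * l)             ≡⟨ dot-+ʳ u (A *ᵥ x) (λ i → b i * l) ⟨
      dot u (λ i → (A *ᵥ x) i + b i * l)                 ≡⟨ dot-zeroʳ u row ⟩
      0ℤ ∎
      where open ≡-Reasoning
    l≡0 : l ≡ 0ℤ
    l≡0 with ℤ.i*j≡0⇒i≡0∨j≡0 (dot b u) lzero
    ... | inj₁ z = contradiction z bu≢0
    ... | inj₂ z = z
    ker : Kernel Z y
    ker zero    = trans (dot-snocˡ 𝟘ᵥ 1ℤ y) (trans
        (cong₂ _+_ (dot-zeroˡ x (λ _ → refl)) (trans (ℤ.*-identityˡ l) l≡0)) refl)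
    ker (suc i) = trans (dot-snocˡ (A i) 0ℤ y) (trans (cong (ℤ._+_ ((A *ᵥ x) i))
      (trans (ℤ.*-zeroˡ l) (sym (trans (cong (b i *_) l≡0) (ℤ.*-zeroʳ (b i)))))) (row i))

consistent⇒solvable : (A : Matrix ℤ m n) (b : Vector ℤ m) → rank (augment A b) ≡ rank A → Solvable A b
consistent⇒solvable A b e with solvable-or-obstructed A b
... | inj₁ s = s
... | inj₂ o = contradiction (obstructed⇒rank-< A b o) (ℕ.≤⇒≯ (ℕ.≤-reflexive e))

solvable⇒consistent : (A : Matrix ℤ m n) (b : Vector ℤ m) → Solvable A b → rank (augment A b) ≡ rank A
solvable⇒consistent A b (t , c , t≢0 , Ac) = ℕ.≤-antisym (rank-augment-≤ A b t≢0 Ac) (rank-augment-≥ A b)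

-- Integer systems over ℚ and ℝ

module _ (K : RationalAlgebra) where

  open RationalAlgebra K using (ι; ι-0; ι-*; ι-inv) renaming (ring to R)
  private
    module R = CommutativeRing R
    module L = MatrixProperties R
    module S = Summation R.semiring
    module O = OverRationals K

  -- An integral obstruction u survives in K: A x = b would give u · b = 0 there, whereas nonzero
  -- integers stay nonzero.
  solution⇒solvable : (A : Matrix ℤ m n) (b : Vector ℤ m) →
                      ∃ (O.Solves (O.cast A) (ι ∘ b)) → Solvable A b
  solution⇒solvable {m} {n} A b (x , Ax) with solvable-or-obstructed A b
  ... | inj₁ s = s
  ... | inj₂ (u , uA≡0 , bu≢0) = contradiction zeroed (O.ι-nonzero bu≢0)
    where
    uᵣ : Matrix ℤ 1 m
    uᵣ _ = u
    open import Relation.Binary.Reasoning.Setoid R.setoid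
    zeroed : ι (dot b u) R.≈ R.0#
    zeroed = begin
      ι (dot b u)                                        ≈⟨ R.reflexive (cong ι (dot-comm b u)) ⟩
      ι ((uᵣ *ᵥ b) zero)                                 ≈⟨ O.ι-*ᵥ uᵣ b zero ⟩
      (O.cast uᵣ L.*ᵥ (ι ∘ b)) zero                      ≈⟨ L.*ᵥ-cong {M = O.cast uᵣ} L.≋-refl Ax zero ⟨
      (O.cast uᵣ L.*ᵥ (O.cast A L.*ᵥ x)) zero            ≈⟨ L.*ᵥ-assoc (O.cast uᵣ) (O.cast A) x zero ⟨
      ((O.cast uᵣ L.⊗ O.cast A) L.*ᵥ x) zero             ≈⟨ L.sum-zero n _
          (λ j → R.trans (R.*-congʳ (R.trans (R.sym (O.cast-⊗ uᵣ A zero j))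
                                                              (R.trans (R.reflexive
                                                                  (cong ι (trans (dot-comm u
                                                                      (λ i → A i j)) (uA≡0 j)))) ι-0)))
                                                                          (R.zeroˡ (x j))) ⟩
      R.0# ∎

  solvable⇒solution : (A : Matrix ℤ m n) (b : Vector ℤ m) →
                      Solvable A b → ∃ (O.Solves (O.cast A) (ι ∘ b))
  solvable⇒solution A b (t , c , t≢0 , Ac) with ι-inv t t≢0
  ... | y , yt = (λ j → ι (c j) R.* y) , λ i → begin
      S.sum (λ j → ι (A i j) R.* (ι (c j) R.* y))    ≈⟨ S.sum-cong-≋
          (λ j → R.sym (R.*-assoc (ι (A i j)) (ι (c j)) y)) ⟩
      S.sum (λ j → ι (A i j) R.* ι (c j) R.* y)      ≈⟨ S.*-distribʳ-sum y (λ j → ι (A i j) R.* ι (c j)) ⟨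
      (O.cast A L.*ᵥ (ι ∘ c)) i R.* y                ≈⟨ R.*-congʳ (R.sym (O.ι-*ᵥ A c i)) ⟩
      ι ((A *ᵥ c) i) R.* y                           ≈⟨ R.*-congʳ
          (R.trans (R.reflexive (cong ι (Ac i))) (ι-* t (b i))) ⟩
      ι t R.* ι (b i) R.* y                          ≈⟨ R.*-comm _ y ⟩
      y R.* (ι t R.* ι (b i))                        ≈⟨ R.*-assoc y (ι t) (ι (b i)) ⟨
      y R.* ι t R.* ι (b i)                          ≈⟨ R.*-congʳ yt ⟩
      R.1# R.* ι (b i)                               ≈⟨ R.*-identityˡ (ι (b i)) ⟩
      ι (b i) ∎
    where open import Relation.Binary.Reasoning.Setoid R.setoid

  -- Phrased with the very eliminator that `χ` applies, so that splitting on `O.solve` computes it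
  -- and exposes the dimension n - rank A.
  affine-dimension : (A : Matrix ℤ m n) (b : Vector ℤ m) {S : Pred (Vector R.Carrier n) 0ℓ}
    (S⇔ : ∀ x → S x ⇔ O.Solves (O.cast A) (ι ∘ b) x) {X : Set} (f : ℕ → X) (z : X) →
    (Solvable A b × [ (λ _ → z) , (λ (dim , _) → f dim) ]′ (O.affine A b {S} S⇔) ≡ f (n ℕ.∸ rank A)) ⊎
    (¬ Solvable A b × [ (λ _ → z) , (λ (dim , _) → f dim) ]′ (O.affine A b {S} S⇔) ≡ z)
  affine-dimension A b S⇔ f z with O.solve A b
  ... | inj₁ none = inj₂ ((λ s → let x , e = solvable⇒solution A b s in none x e) , refl)
  ... | inj₂ sol  = inj₁ (solution⇒solvable A b sol , refl)

module _ {m n} (A : Matrix ℤ m n) (𝐚 : Vector ℤ m) where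
  open Arrangement A 𝐚

  χ-term : ∀ J k →
    (r̄ J ≡ r J × [ (λ _ → 0ℤ) , (λ (dim , _) → signedMonomial J dim k) ]′ (dimension J) ≡
        signedMonomial J (n ℕ.∸ r J) k) ⊎
    (¬ r̄ J ≡ r J × [ (λ _ → 0ℤ) , (λ (dim , _) → signedMonomial J dim k) ]′ (dimension J) ≡ 0ℤ)
  χ-term J k with affine-dimension ℝ-algebra (rows J) (entries J) _ (λ dim → signedMonomial J dim k) 0ℤ
  ... | inj₁ (s , e) = inj₁ (solvable⇒consistent (rows J) (entries J) s , e)
  ... | inj₂ (¬s , e) = inj₂ (¬s ∘ consistent⇒solvable (rows J) (entries J) , e)

-- Broken circuits

⟦_⟧ : Dec P → ℤ
⟦ d ⟧ = if does d then 1ℤ else 0ℤ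

⟦⟧-true : (d : Dec P) → P → ⟦ d ⟧ ≡ 1ℤ
⟦⟧-true (yes _) _ = refl
⟦⟧-true (no ¬p) p = contradiction p ¬p

⟦⟧-false : (d : Dec P) → ¬ P → ⟦ d ⟧ ≡ 0ℤ
⟦⟧-false (yes p) ¬p = contradiction p ¬p
⟦⟧-false (no _)  _  = refl

⟦⟧-cong : (d : Dec P) (e : Dec Q) → (P → Q) → (Q → P) → ⟦ d ⟧ ≡ ⟦ e ⟧
⟦⟧-cong (yes p) e f g = sym (⟦⟧-true e (f p))
⟦⟧-cong (no ¬p) e f g = sym (⟦⟧-false e (¬p ∘ g))

⟦⟧-× : (d : Dec P) (e : Dec Q) → ⟦ d ×-dec e ⟧ ≡ ⟦ d ⟧ * ⟦ e ⟧
⟦⟧-× (yes _) (yes _) = refl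
⟦⟧-× (yes _) (no _)  = refl
⟦⟧-× (no _)  e       = refl

⟦⟧-mono : (d : Dec P) (e : Dec Q) → (P → Q) → ⟦ d ⟧ ℤ.≤ ⟦ e ⟧
⟦⟧-mono (yes p) e       f = ℤ.≤-reflexive (sym (⟦⟧-true e (f p)))
⟦⟧-mono (no _)  (yes _) f = ℤ.+≤+ z≤n
⟦⟧-mono (no _)  (no _)  f = ℤ.≤-refl

⟦⟧-nonneg : (d : Dec P) → 0ℤ ℤ.≤ ⟦ d ⟧
⟦⟧-nonneg (yes _) = ℤ.+≤+ z≤n
⟦⟧-nonneg (no _)  = ℤ.≤-refl

-- Finite sums over lists and subsets

sumOver-cong : (xs : List X) {f g : X → ℤ} → (∀ x → f x ≡ g x) → sumOver xs f ≡ sumOver xs g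
sumOver-cong []       e = refl
sumOver-cong (x ∷ xs) e = cong₂ _+_ (e x) (sumOver-cong xs e)

sumOver-mono : (xs : List X) {f g : X → ℤ} → (∀ x → f x ℤ.≤ g x) → sumOver xs f ℤ.≤ sumOver xs g
sumOver-mono []       h = ℤ.≤-refl
sumOver-mono (x ∷ xs) h = ℤ.+-mono-≤ (h x) (sumOver-mono xs h)

sumOver-zero : (xs : List X) {f : X → ℤ} → (∀ x → f x ≡ 0ℤ) → sumOver xs f ≡ 0ℤ
sumOver-zero []       e = refl
sumOver-zero (x ∷ xs) e = cong₂ _+_ (e x) (sumOver-zero xs e)

sumOver-+ : (xs : List X) (f g : X → ℤ) → sumOver xs (λ x → f x + g x) ≡ sumOver xs f + sumOver xs g
sumOver-+ []       f g = refl
sumOver-+ (x ∷ xs) f g = trans (cong (ℤ._+_ (f x + g x)) (sumOver-+ xs f g))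
  (interchange (f x) (g x) (sumOver xs f) (sumOver xs g))
  where
  interchange : ∀ a b c d → (a + b) + (c + d) ≡ (a + c) + (b + d)
  interchange = solve-∀

sumOver-* : (c : ℤ) (xs : List X) (f : X → ℤ) → sumOver xs (λ x → c * f x) ≡ c * sumOver xs f
sumOver-* c []       f = sym (ℤ.*-zeroʳ c)
sumOver-* c (x ∷ xs) f = trans (cong (ℤ._+_ (c * f x)) (sumOver-* c xs f))
    (sym (ℤ.*-distribˡ-+ c (f x) (sumOver xs f)))

sumOver-swap : (xs : List X) (ys : List Y) (f : X → Y → ℤ) →
               sumOver xs (λ x → sumOver ys (f x)) ≡ sumOver ys (λ y → sumOver xs (λ x → f x y))
sumOver-swap []       ys f = sym (sumOver-zero ys (λ _ → refl))
sumOver-swap (x ∷ xs) ys f = trans (cong (ℤ._+_ (sumOver ys (f x))) (sumOver-swap xs ys f))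
  (sym (sumOver-+ ys (f x) (λ y → sumOver xs (λ x → f x y))))

sumOver-++ : (xs ys : List X) (f : X → ℤ) → sumOver (xs List.++ ys) f ≡ sumOver xs f + sumOver ys f
sumOver-++ []       ys f = sym (ℤ.+-identityˡ _)
sumOver-++ (x ∷ xs) ys f = trans (cong (ℤ._+_ (f x)) (sumOver-++ xs ys f)) (sym (ℤ.+-assoc (f x) _ _))

sumOver-map : (h : X → Y) (xs : List X) (f : Y → ℤ) → sumOver (List.map h xs) f ≡ sumOver xs (f ∘ h)
sumOver-map h []       f = refl
sumOver-map h (x ∷ xs) f = cong (ℤ._+_ (f (h x))) (sumOver-map h xs f)

sumOver-filter : {R : Pred X 0ℓ} (R? : Decidable R) (xs : List X) (f : X → ℤ) →
                 sumOver (List.filter R? xs) f ≡ sumOver xs (λ x → ⟦ R? x ⟧ * f x)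
sumOver-filter R? []       f = refl
sumOver-filter R? (x ∷ xs) f with R? x
... | yes _ = cong₂ _+_ (sym (ℤ.*-identityˡ (f x))) (sumOver-filter R? xs f)
... | no _  = trans (sumOver-filter R? xs f) (sym (trans
    (cong (_+ sumOver xs (λ x → ⟦ R? x ⟧ * f x)) (ℤ.*-zeroˡ (f x))) (ℤ.+-identityˡ _)))

sumOver-subsets : ∀ m (f : Subset (suc m) → ℤ) →
  sumOver (subsets (suc m)) f ≡ sumOver (subsets m) (λ J → f (inside Vec.∷ J) + f (outside Vec.∷ J))
sumOver-subsets m f = trans (sumOver-++ (List.map (inside Vec.∷_) (subsets m))
    (List.map (outside Vec.∷_) (subsets m)) f)
  (trans (cong₂ _+_ (sumOver-map (inside Vec.∷_) (subsets m) f)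
      (sumOver-map (outside Vec.∷_) (subsets m) f))
    (sym (sumOver-+ (subsets m) (f ∘ (inside Vec.∷_)) (f ∘ (outside Vec.∷_)))))

≤-sumOver-subsets : ∀ {m} (f : Subset m → ℤ) → (∀ J → 0ℤ ℤ.≤ f J) → ∀ J → f J ℤ.≤ sumOver (subsets m) f
≤-sumOver-subsets {zero}  f f≥0 Vec.[] = ℤ.≤-reflexive (sym (ℤ.+-identityʳ (f Vec.[])))
≤-sumOver-subsets {suc m} f f≥0 (b Vec.∷ J) = ℤ.≤-trans (one b)
  (ℤ.≤-trans (≤-sumOver-subsets (λ J → f (inside Vec.∷ J) + f (outside Vec.∷ J))
      (λ J → ℤ.+-mono-≤ (f≥0 _) (f≥0 _)) J)
    (ℤ.≤-reflexive (sym (sumOver-subsets m f))))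
  where
  one : ∀ b → f (b Vec.∷ J) ℤ.≤ f (inside Vec.∷ J) + f (outside Vec.∷ J)
  one inside  = ℤ.≤-trans (ℤ.≤-reflexive (sym (ℤ.+-identityʳ _)))
      (ℤ.+-monoʳ-≤ (f (inside Vec.∷ J)) (f≥0 (outside Vec.∷ J)))
  one outside = ℤ.≤-trans (ℤ.≤-reflexive (sym (ℤ.+-identityˡ _)))
      (ℤ.+-monoˡ-≤ (f (outside Vec.∷ J)) (f≥0 (inside Vec.∷ J)))

-- Dependence and sets without broken circuits

abstract
  dependent? : (M : Matrix ℤ m n) (β : Vector ℤ n) → Dec (Dependent M β)
  dependent? M β with combine-or-separate M β
  ... | inj₁ c = yes (combination⇒dependent M c)
  ... | inj₂ (y , My≡0 , βy≢0) = no (λ dep → βy≢0 (dep y My≡0))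

independent⇒separation : (M : Matrix ℤ m n) (β : Vector ℤ n) → ¬ Dependent M β → Separation M β
independent⇒separation M β ¬dep with combine-or-separate M β
... | inj₁ c = contradiction (combination⇒dependent M c) ¬dep
... | inj₂ s = s

-- J contains no broken circuit of the vector configuration given by those rows
-- of M that satisfy E.
NBC : Matrix ℤ m n → Pred (Fin m) 0ℓ → Subset m → Set
NBC M E Vec.[]      = ⊤
NBC M E (_ Vec.∷ J) = ¬ (E zero × Dependent (M ∘ suc ∘ element J) (M zero)) × NBC (M ∘ suc) (E ∘ suc) J

nbc? : (M : Matrix ℤ m n) {E : Pred (Fin m) 0ℓ} → Decidable E → Decidable (NBC M E)
nbc? M E? Vec.[]      = yes tt
nbc? M E? (_ Vec.∷ J) = ¬? (E? zero ×-dec dependent? (M ∘ suc ∘ element J) (M zero)) ×-dec nbc?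
    (M ∘ suc) (E? ∘ suc) J

-- When J lies in E, each of its elements is outside the span of the larger ones, so each raises the
-- rank by one.
nbc-rank : (M : Matrix ℤ m n) (E : Pred (Fin m) 0ℓ) (J : Subset m) → NBC M E J →
           (∀ i → E (element J i)) → ∣ J ∣ ≤ rank (M ∘ element J)
nbc-rank M E Vec.[]              _         _  = z≤n
nbc-rank M E (outside Vec.∷ J) (_ , nbc) es = nbc-rank (M ∘ suc) (E ∘ suc) J nbc es
nbc-rank M E (inside Vec.∷ J)  (h , nbc) es = ℕ.≤-trans
    (s≤s (nbc-rank (M ∘ suc) (E ∘ suc) J nbc (es ∘ suc)))
  (rank-suc (M ∘ element (inside Vec.∷ J))
    (independent⇒separation (M ∘ suc ∘ element J) (M zero) (λ dep → h (es zero , dep))))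

-- f sees J only through its rational row space and through whether J lies in E. Toggling an element
-- of E spanned by other elements of J changes neither.
Respects : (M : Matrix ℤ m n) (E : Pred (Fin m) 0ℓ) → (Subset m → ℤ) → Set
Respects M E f = ∀ J J′ →
  (∀ y → Kernel (M ∘ element J) y → Kernel (M ∘ element J′) y) →
  (∀ y → Kernel (M ∘ element J′) y → Kernel (M ∘ element J) y) →
  ((∀ i → E (element J i)) → (∀ i → E (element J′ i))) →
  ((∀ i → E (element J′ i)) → (∀ i → E (element J i))) → f J ≡ f J′

private
  sign-factor : ∀ s x → -1ℤ * s * x ≡ -1ℤ * (s * x)
  sign-factor = solve-∀

  cancelling : ∀ s b x → -1ℤ * s * (b * x) + s * (b * x) ≡ 0ℤ
  cancelling = solve-∀

  -- If h holds, the two terms cancel both before and after the extra test; if it fails, the extra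
  -- test is vacuous.
  toggle : (h : Dec P) (d : Dec Q) → ∀ s {x y} → (P → x ≡ y) →
    -1ℤ * s * (⟦ d ⟧ * x) + s * (⟦ d ⟧ * y) ≡
    -1ℤ * s * (⟦ ¬? h ×-dec d ⟧ * x) + s * (⟦ ¬? h ×-dec d ⟧ * y)
  toggle (no _)  d s {x}     e = refl
  toggle (yes p) d s {x} {y} e with e p
  ... | refl = trans (cancelling s ⟦ d ⟧ x) (sym (cancelling s 0ℤ x))

-- Toggling the least element that some larger elements of J span preserves f but not
-- the sign, so that only the sets without broken circuits survive.
nbc-sum : (M : Matrix ℤ m n) {E : Pred (Fin m) 0ℓ} (E? : Decidable E) (f : Subset m → ℤ) → Respects M E f →
  sumOver (subsets m) (λ J → sign ∣ J ∣ * f J) ≡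
  sumOver (subsets m) (λ J → sign ∣ J ∣ * (⟦ nbc? M E? J ⟧ * f J))
nbc-sum {zero}  M E? f resp = cong (λ z → 1ℤ * z + 0ℤ) (sym (ℤ.*-identityˡ (f Vec.[])))
nbc-sum {suc m} M {E} E? f resp = begin
  sumOver (subsets (suc m)) (λ J → sign ∣ J ∣ * f J)
    ≡⟨ sumOver-subsets m _ ⟩
  ∑ (λ J → -1ℤ * sign ∣ J ∣ * fᵢ J + sign ∣ J ∣ * fₒ J)
    ≡⟨ sumOver-+ (subsets m) _ _ ⟩
  ∑ (λ J → -1ℤ * sign ∣ J ∣ * fᵢ J) + ∑ (λ J → sign ∣ J ∣ * fₒ J)
    ≡⟨ cong₂ _+_ (factor fᵢ) (IH fₒ respₒ) ⟩
  -1ℤ * ∑ (λ J → sign ∣ J ∣ * fᵢ J) + ∑ (λ J → sign ∣ J ∣ * (b J * fₒ J))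
    ≡⟨ cong (λ z → -1ℤ * z + ∑ (λ J → sign ∣ J ∣ * (b J * fₒ J))) (IH fᵢ respᵢ) ⟩
  -1ℤ * ∑ (λ J → sign ∣ J ∣ * (b J * fᵢ J)) + ∑ (λ J → sign ∣ J ∣ * (b J * fₒ J))
    ≡⟨ cong (_+ ∑ (λ J → sign ∣ J ∣ * (b J * fₒ J))) (factor (λ J → b J * fᵢ J)) ⟨
  ∑ (λ J → -1ℤ * sign ∣ J ∣ * (b J * fᵢ J)) + ∑ (λ J → sign ∣ J ∣ * (b J * fₒ J))
    ≡⟨ sumOver-+ (subsets m) _ _ ⟨
  ∑ (λ J → -1ℤ * sign ∣ J ∣ * (b J * fᵢ J) + sign ∣ J ∣ * (b J * fₒ J))
    ≡⟨ sumOver-cong (subsets m) pointwise ⟩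
  ∑ (λ J → -1ℤ * sign ∣ J ∣ * (⟦ nbc? M E? (inside Vec.∷ J) ⟧ * fᵢ J) + sign ∣ J ∣ *
      (⟦ nbc? M E? (outside Vec.∷ J) ⟧ * fₒ J))
    ≡⟨ sumOver-subsets m _ ⟨
  sumOver (subsets (suc m)) (λ J → sign ∣ J ∣ * (⟦ nbc? M E? J ⟧ * f J)) ∎
  where
  open ≡-Reasoning
  ∑ = sumOver (subsets m)
  fᵢ = λ J → f (inside Vec.∷ J)
  fₒ = λ J → f (outside Vec.∷ J)
  b = λ J → ⟦ nbc? (M ∘ suc) (E? ∘ suc) J ⟧
  IH = nbc-sum (M ∘ suc) (E? ∘ suc)
  respᵢ : Respects (M ∘ suc) (E ∘ suc) fᵢ
  respᵢ J J′ k k′ e e′ = resp (inside Vec.∷ J) (inside Vec.∷ J′)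
    (λ y h → Fin.∀-cons (h zero) (k y (h ∘ suc))) (λ y h → Fin.∀-cons (h zero) (k′ y (h ∘ suc)))
    (λ h → Fin.∀-cons (h zero) (e (h ∘ suc))) (λ h → Fin.∀-cons (h zero) (e′ (h ∘ suc)))
  respₒ : Respects (M ∘ suc) (E ∘ suc) fₒ
  respₒ J J′ = resp (outside Vec.∷ J) (outside Vec.∷ J′)
  factor : ∀ g → ∑ (λ J → -1ℤ * sign ∣ J ∣ * g J) ≡ -1ℤ * ∑ (λ J → sign ∣ J ∣ * g J)
  factor g = trans (sumOver-cong (subsets m) (λ J → sign-factor (sign ∣ J ∣) (g J)))
      (sumOver-* -1ℤ (subsets m) _)
  pointwise : ∀ J → -1ℤ * sign ∣ J ∣ * (b J * fᵢ J) + sign ∣ J ∣ * (b J * fₒ J) ≡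
    -1ℤ * sign ∣ J ∣ * (⟦ nbc? M E? (inside Vec.∷ J) ⟧ * fᵢ J) + sign ∣ J ∣ *
        (⟦ nbc? M E? (outside Vec.∷ J) ⟧ * fₒ J)
  pointwise J = toggle (E? zero ×-dec dependent? (M ∘ suc ∘ element J) (M zero))
      (nbc? (M ∘ suc) (E? ∘ suc) J) (sign ∣ J ∣)
    λ (e₀ , dep) → resp (inside Vec.∷ J) (outside Vec.∷ J) (λ y h → h ∘ suc)
      (λ y h → Fin.∀-cons (dep y h) h) (λ h → h ∘ suc) (λ h → Fin.∀-cons e₀ h)

-- For empty B these are the subsets of the lexicographically first basis of the rows of A.
Pivotal : Matrix ℤ p n → Matrix ℤ m n → Subset m → Set
Pivotal B A Vec.[]              = ⊤
Pivotal B A (inside  Vec.∷ J) = Separation B (A zero) × Pivotal (A zero V.∷ B) (A ∘ suc) J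
Pivotal B A (outside Vec.∷ J) = Pivotal (A zero V.∷ B) (A ∘ suc) J

-- Greedy choice: a row is taken exactly when it is outside the span of `B` and of all rows before
-- it. `B` collects rejected rows too, which does not enlarge that span.
maximal-pivotal : (B : Matrix ℤ p n) (A : Matrix ℤ m n) → ∃ λ J → Pivotal B A J ×
                  (∀ y → Kernel B y → Kernel (A ∘ element J) y → Kernel A y)
maximal-pivotal {m = zero}  B A = Vec.[] , tt , λ y _ _ ()
maximal-pivotal {m = suc m} B A with maximal-pivotal (A zero V.∷ B) (A ∘ suc) | combine-or-separate B
    (A zero)
... | J , piv , ker | inj₁ c = outside Vec.∷ J , piv , λ y By≡0 h →
        let A₀y≡0 = combination⇒dependent B c y By≡0 in
        Fin.∀-cons A₀y≡0 (ker y (Fin.∀-cons A₀y≡0 By≡0) h)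
... | J , piv , ker | inj₂ s = inside Vec.∷ J , (s , piv) , λ y By≡0 h →
        Fin.∀-cons (h zero) (ker y (Fin.∀-cons (h zero) By≡0) (h ∘ suc))

-- `Pivotal` tests each chosen row against all earlier rows, chosen or not, so dropping elements
-- preserves it.
shrink-pivotal : (B : Matrix ℤ p n) (A : Matrix ℤ m n) (J : Subset m) → Pivotal B A J → ∀ {j} → j ≤ ∣ J ∣ →
                 ∃ λ T → Pivotal B A T × ∣ T ∣ ≡ j
shrink-pivotal B A Vec.[] piv {zero} z≤n = Vec.[] , tt , refl
shrink-pivotal B A (outside Vec.∷ J) piv j≤ with shrink-pivotal (A zero V.∷ B) (A ∘ suc) J piv j≤
... | T , piv′ , e = outside Vec.∷ T , piv′ , e
shrink-pivotal B A (inside Vec.∷ J) (s , piv) {j} j≤ with j ℕ.≤? ∣ J ∣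
... | no j≰ = inside Vec.∷ J , (s , piv) , ℕ.≤-antisym (ℕ.≰⇒> j≰) j≤
... | yes p with shrink-pivotal (A zero V.∷ B) (A ∘ suc) J piv p
...   | T , piv′ , e = outside Vec.∷ T , piv′ , e

-- Gaussian elimination on the dual side. A chosen row comes with a vector z that kills all earlier
-- rows but not this one; subtracting a multiple of z makes the row vanish at y and only rescales
-- the values on the span of `B`.
eliminate : (B : Matrix ℤ p n) (A : Matrix ℤ m n) (J : Subset m) → Pivotal B A J → ∀ y₀ →
  ∃₂ λ y t → t ≢ 0ℤ × Kernel (A ∘ element J) y × (∀ β → Dependent B β → dot β y ≡ t * dot β y₀)
eliminate B A Vec.[] piv y₀ = y₀ , 1ℤ , (λ ()) , (λ ()) , λ β _ → sym (ℤ.*-identityˡ (dot β y₀))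
eliminate B A (outside Vec.∷ J) piv y₀ with eliminate (A zero V.∷ B) (A ∘ suc) J piv y₀
... | y , t , t≢0 , ker , agree = y , t , t≢0 , ker , λ β dep → agree β (λ z h → dep z (h ∘ suc))
eliminate B A (inside Vec.∷ J) ((z , Bz≡0 , a≢0) , piv) y₀ = step
    (eliminate (A zero V.∷ B) (A ∘ suc) J piv y₁)
  where
  a = dot (A zero) z
  b = dot (A zero) y₀
  y₁ = λ k → a * y₀ k + - b * z k
  dot-y₁ : ∀ β → dot β y₁ ≡ a * dot β y₀ + - b * dot β z
  dot-y₁ β = trans (dot-+ʳ β (λ k → a * y₀ k) (λ k → - b * z k))
      (cong₂ _+_ (dot-scaleʳ β y₀ a) (dot-scaleʳ β z (- b)))
  vanish : ∀ t a b → t * (a * b + - b * a) ≡ 0ℤ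
  vanish = solve-∀
  drop : ∀ t a b x → t * (a * x + - b * 0ℤ) ≡ t * a * x
  drop = solve-∀
  step : (∃₂ λ y t → t ≢ 0ℤ × Kernel (A ∘ suc ∘ element J) y ×
           (∀ β → Dependent (A zero V.∷ B) β → dot β y ≡ t * dot β y₁)) →
         ∃₂ λ y t → t ≢ 0ℤ × Kernel (A ∘ element (inside Vec.∷ J)) y ×
             (∀ β → Dependent B β → dot β y ≡ t * dot β y₀)
  step (y , t , t≢0 , ker , agree) = y , t * a , nonzero-* t≢0 a≢0 ,
    Fin.∀-cons (trans (agree (A zero) (λ w h → h zero))
        (trans (cong (t *_) (dot-y₁ (A zero))) (vanish t a b))) ker ,
    λ β dep → trans (agree β (λ w h → dep w (h ∘ suc)))
      (trans (cong (t *_) (dot-y₁ β)) (trans (cong (λ v → t * (a * dot β y₀ + - b * v)) (dep z Bz≡0))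
          (drop t a b (dot β y₀))))

nonzero-entry : (β : Vector ℤ n) → ¬ (∀ k → β k ≡ 0ℤ) → ∃ λ k → β k ≢ 0ℤ
nonzero-entry {n} β h = Fin.¬∀⟶∃¬ n _ (λ k → β k ℤ.≟ 0ℤ) h

-- If row zero were spanned by later elements of J, the last of these with nonzero coefficient would
-- be spanned by rows before it, contrary to pivotality; and a relation without coefficients would
-- make the row zero. Accordingly, elimination starts from a unit vector at a nonzero entry of the
-- row.
pivotal-separation : (B : Matrix ℤ p n) (A : Matrix ℤ (suc m) n) (J : Subset m) → ¬ (∀ k → A zero k ≡ 0ℤ) →
                     Pivotal (A zero V.∷ B) (A ∘ suc) J → Separation (A ∘ suc ∘ element J) (A zero)
pivotal-separation B A J A₀≢0 piv with nonzero-entry (A zero) A₀≢0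
... | k , Ak≢0 with eliminate (A zero V.∷ B) (A ∘ suc) J piv (λ j → 𝟙 j k)
...   | y , t , t≢0 , ker , agree = y , ker , λ e → nonzero-* t≢0 Ak≢0
        (trans (cong (t *_) (sym (ᵥ*𝟙 (A zero) k))) (trans (sym (agree (A zero) (λ w h → h zero))) e))

pivotal-rank : (B : Matrix ℤ p n) (A : Matrix ℤ m n) → (∀ i → ¬ (∀ k → A i k ≡ 0ℤ)) → (J : Subset m) →
    Pivotal B A J →
               ∣ J ∣ ≤ rank (A ∘ element J)
pivotal-rank B A A≢0 Vec.[] piv = z≤n
pivotal-rank B A A≢0 (outside Vec.∷ J) piv = pivotal-rank (A zero V.∷ B) (A ∘ suc) (A≢0 ∘ suc) J piv
pivotal-rank B A A≢0 (inside Vec.∷ J) (_ , piv) = ℕ.≤-trans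
    (s≤s (pivotal-rank (A zero V.∷ B) (A ∘ suc) (A≢0 ∘ suc) J piv))
  (rank-suc (A ∘ element (inside Vec.∷ J)) (pivotal-separation B A J (A≢0 zero) piv))

-- Separating vectors for rows of A, extended by a zero coordinate, also separate the rows of [A b].
pivotal-nbc : (B : Matrix ℤ p n) (A : Matrix ℤ m n) (b : Vector ℤ m) (E : Pred (Fin m) 0ℓ) →
    (∀ i → ¬ (∀ k → A i k ≡ 0ℤ)) →
              (J : Subset m) → Pivotal B A J → NBC (augment A b) E J
pivotal-nbc B A b E A≢0 Vec.[] piv = tt
pivotal-nbc {m = suc m} B A b E A≢0 (s Vec.∷ J) piv = independent , pivotal-nbc (A zero V.∷ B) (A ∘ suc)
    (b ∘ suc) (E ∘ suc) (A≢0 ∘ suc) J (tail s piv)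
  where
  tail : ∀ s → Pivotal B A (s Vec.∷ J) → Pivotal (A zero V.∷ B) (A ∘ suc) J
  tail inside  = proj₂
  tail outside = λ z → z
  independent : ¬ (E zero × Dependent (augment A b ∘ suc ∘ element J) (augment A b zero))
  independent (_ , dep) with pivotal-separation B A J (A≢0 zero) (tail s piv)
  ... | y , ker , ≢0 = ≢0 (trans (sym (dot-padʳ (A zero) y (b zero))) (dep (y V.++ (0ℤ V.∷ V.[]))
        (λ i → trans (dot-padʳ (A (suc (element J i))) y (b (suc (element J i)))) (ker i))))

-- Points modulo Q

sumOver-cartesian : {Z : Set} (h : X → Y → Z) (xs : List X) (ys : List Y) (f : Z → ℤ) →
  sumOver (List.cartesianProductWith h xs ys) f ≡ sumOver xs (λ x → sumOver ys (λ y → f (h x y)))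
sumOver-cartesian h []       ys f = refl
sumOver-cartesian h (x ∷ xs) ys f = trans (sumOver-++ (List.map (h x) ys)
    (List.cartesianProductWith h xs ys) f)
  (cong₂ _+_ (sumOver-map (h x) ys f) (sumOver-cartesian h xs ys f))

sumOver-applyUpTo-cong : ∀ k {h : ℕ → X} {h′ : ℕ → Y} {f : X → ℤ} {g : Y → ℤ} → (∀ i → f (h i) ≡ g (h′ i)) →
  sumOver (List.applyUpTo h k) f ≡ sumOver (List.applyUpTo h′ k) g
sumOver-applyUpTo-cong zero    e = refl
sumOver-applyUpTo-cong (suc k) e = cong₂ _+_ (e 0) (sumOver-applyUpTo-cong k (e ∘ suc))

sumOver-applyUpTo-+ : ∀ k l (h : ℕ → X) (f : X → ℤ) → sumOver (List.applyUpTo h (k ℕ.+ l)) f ≡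
  sumOver (List.applyUpTo h k) f + sumOver (List.applyUpTo (λ i → h (k ℕ.+ i)) l) f
sumOver-applyUpTo-+ zero    l h f = sym (ℤ.+-identityˡ _)
sumOver-applyUpTo-+ (suc k) l h f = trans (cong (ℤ._+_ (f (h 0))) (sumOver-applyUpTo-+ k l (h ∘ suc) f))
    (sym (ℤ.+-assoc (f (h 0)) _ _))

sumOver-applyUpTo-zero : ∀ k (h : ℕ → X) (f : X → ℤ) → (∀ i → i < k → f (h i) ≡ 0ℤ) → sumOver
    (List.applyUpTo h k) f ≡ 0ℤ
sumOver-applyUpTo-zero zero    h f e = refl
sumOver-applyUpTo-zero (suc k) h f e = cong₂ _+_ (e 0 (s≤s z≤n))
    (sumOver-applyUpTo-zero k (h ∘ suc) f (λ i i<k → e (suc i) (s≤s i<k)))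

sumOver-applyUpTo-single : ∀ k (h : ℕ → X) (f : X → ℤ) {c} → c < k → (∀ i → i < k → i ≢ c → f (h i) ≡ 0ℤ) →
  sumOver (List.applyUpTo h k) f ≡ f (h c)
sumOver-applyUpTo-single (suc k) h f {zero} c<k e = trans (cong (ℤ._+_ (f (h 0)))
  (sumOver-applyUpTo-zero k (h ∘ suc) f (λ i i<k → e (suc i) (s≤s i<k) (λ ())))) (ℤ.+-identityʳ _)
sumOver-applyUpTo-single (suc k) h f {suc c} (s≤s c<k) e = trans (cong₂ _+_ (e 0 (s≤s z≤n) (λ ()))
  (sumOver-applyUpTo-single k (h ∘ suc) f c<k (λ i i<k i≢c → e (suc i) (s≤s i<k)
      (i≢c ∘ ℕ.suc-injective)))) (ℤ.+-identityˡ _)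

residues : ℕ → List ℤ
residues Q = List.applyUpTo +_ Q

points : ℕ → ∀ n → List (Vector ℤ n)
points Q zero    = V.[] ∷ []
points Q (suc n) = List.cartesianProductWith V._∷_ (residues Q) (points Q n)

sumOver-points : ∀ Q n (f : Vector ℤ (suc n) → ℤ) → sumOver (points Q (suc n)) f ≡
  sumOver (residues Q) (λ r → sumOver (points Q n) (λ v → f (r V.∷ v)))
sumOver-points Q n f = sumOver-cartesian V._∷_ (residues Q) (points Q n) f

Congruent : ℕ → Vector ℤ n → Vector ℤ n → Set
Congruent Q x y = ∀ k → + Q ∣ᶻ x k - y k

congruent? : ∀ Q (x y : Vector ℤ n) → Dec (Congruent Q x y)
congruent? Q x y = Fin.all? (λ k → + Q ∣ᶻ? (x k - y k))

∣-refl- : ∀ {q} x → q ∣ᶻ x - x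
∣-refl- x = subst (_ ∣ᶻ_) (sym (ℤ.+-inverseʳ x)) ∣0

∣-sym- : ∀ {q} x y → q ∣ᶻ x - y → q ∣ᶻ y - x
∣-sym- x y h = subst (_ ∣ᶻ_) (flip x y) (ℤ∣.∣m⇒∣-m h)
  where
  flip : ∀ x y → - (x - y) ≡ y - x
  flip = solve-∀

∣-trans- : ∀ {q} x y z → q ∣ᶻ x - y → q ∣ᶻ y - z → q ∣ᶻ x - z
∣-trans- x y z h h′ = subst (_ ∣ᶻ_) (link x y z) (ℤ∣.∣m∣n⇒∣m+n h h′)
  where
  link : ∀ x y z → (x - y) + (y - z) ≡ x - z
  link = solve-∀

∣-resp- : ∀ {q} x y → q ∣ᶻ x - y → q ∣ᶻ y → q ∣ᶻ x
∣-resp- x y h h′ = subst (_ ∣ᶻ_) (restore x y) (ℤ∣.∣m∣n⇒∣m+n h h′)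
  where
  restore : ∀ x y → (x - y) + y ≡ x
  restore = solve-∀

∣-scale- : ∀ {q} c x y → q ∣ᶻ x - y → q ∣ᶻ c * x - c * y
∣-scale- c x y h = subst (_ ∣ᶻ_) (distrib c x y) (ℤ∣.∣n⇒∣m*n c h)
  where
  distrib : ∀ c x y → c * (x - y) ≡ c * x - c * y
  distrib = solve-∀

*ᵥ-congruent : ∀ {Q} (M : Matrix ℤ m n) {x y} → Congruent Q x y → Congruent Q (M *ᵥ x) (M *ᵥ y)
*ᵥ-congruent M {x} {y} h i = subst (_ ∣ᶻ_) eq (∣-sum (λ k → M i k * (x k - y k))
    (λ k → ℤ∣.∣n⇒∣m*n (M i k) (h k)))
  where
  neg : ∀ m → - m ≡ -1ℤ * m
  neg = solve-∀
  eq : dot (M i) (λ k → x k - y k) ≡ (M *ᵥ x) i - (M *ᵥ y) i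
  eq = trans (dot-+ʳ (M i) x (λ k → - y k)) (cong (ℤ._+_ ((M *ᵥ x) i)) (trans
    (trans (sum-cong-≋ (λ k → cong (M i k *_) (neg (y k)))) (dot-scaleʳ (M i) y -1ℤ))
        (sym (neg ((M *ᵥ y) i)))))

*ᵥ-cancel : (A B : Matrix ℤ n n) → A ⊗ B ≋ 𝟙 → ∀ x k → (A *ᵥ (B *ᵥ x)) k ≡ x k
*ᵥ-cancel A B e x k = trans (sym (*ᵥ-assoc A B x k)) (trans (*ᵥ-cong {x = x} e (λ _ → refl) k) (𝟙*ᵥ x k))

residue-unique : ∀ {Q i c} → i < Q → c < Q → + Q ∣ᶻ + i - + c → i ≡ c
residue-unique {Q} {i} {c} i<Q c<Q h with ℤ.∣ + i - + c ∣ in eq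
... | zero  = ℤ.+-injective (ℤ.i-j≡0⇒i≡j (+ i) (+ c) (ℤ.∣i∣≡0⇒i≡0 eq))
... | suc t = contradiction (ℕ∣.∣⇒≤ (subst (Q ℕ∣.∣_) eq (ℤ∣.∣⇒∣ᵤ h))) (ℕ.<⇒≱
      (subst (_< Q) (trans (cong ℤ.∣_∣ (sym (ℤ.m-n≡m⊖n i c))) eq)
        (ℕ.≤-<-trans (ℤ.∣m⊝n∣≤m⊔n i c) (ℕ.⊔-lub i<Q c<Q))))

residues-δ : ∀ {Q} → 0 < Q → (g : ℤ → ℤ) → (∀ x y → + Q ∣ᶻ x - y → g x ≡ g y) → ∀ z →
  sumOver (residues Q) (λ r → ⟦ + Q ∣ᶻ? (r - z) ⟧ * g r) ≡ g z
residues-δ {Q@(suc _)} Q>0 g resp z = trans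
  (sumOver-applyUpTo-single Q +_ (λ r → ⟦ + Q ∣ᶻ? (r - z) ⟧ * g r) {c} c<Q (λ i i<Q i≢c →
    trans (cong (_* g (+ i)) (⟦⟧-false (+ Q ∣ᶻ? (+ i - z))
        (λ h → i≢c (residue-unique i<Q c<Q (∣-trans- (+ i) z (+ c) h z≡c)))))
      (ℤ.*-zeroˡ (g (+ i)))))
  (trans (cong (_* g (+ c)) (⟦⟧-true (+ Q ∣ᶻ? (+ c - z)) (∣-sym- z (+ c) z≡c)))
    (trans (ℤ.*-identityˡ (g (+ c))) (sym (resp z (+ c) z≡c))))
  where
  c = z ℤ.%ℕ Q
  c<Q = ℤ.n%ℕd<d z Q
  z≡c : + Q ∣ᶻ z - + c
  z≡c = divides (z ℤ./ℕ Q) (trans (cong (_- + c) (ℤ.a≡a%ℕn+[a/ℕn]*n z Q)) (cancel (+ c) (z ℤ./ℕ Q * + Q)))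
    where
    cancel : ∀ a b → a + b - a ≡ b
    cancel = solve-∀

-- The list contains exactly one representative of each class modulo Q. Congruence stands in for
-- equality throughout, whence the condition on g.
points-δ : ∀ {Q} → 0 < Q → (g : Vector ℤ n → ℤ) → (∀ x y → Congruent Q x y → g x ≡ g y) → ∀ z →
  sumOver (points Q n) (λ y → ⟦ congruent? Q y z ⟧ * g y) ≡ g z
points-δ {zero}  {Q} Q>0 g resp z = trans (ℤ.+-identityʳ _) (trans
  (cong (_* g V.[]) (⟦⟧-true (congruent? Q V.[] z) (λ ())))
      (trans (ℤ.*-identityˡ (g V.[])) (resp V.[] z (λ ()))))
points-δ {suc n} {Q} Q>0 g resp z = begin
  sumOver (points Q (suc n)) (λ y → ⟦ congruent? Q y z ⟧ * g y)
    ≡⟨ sumOver-points Q n _ ⟩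
  sumOver (residues Q) (λ r → sumOver (points Q n) (λ v → ⟦ congruent? Q (r V.∷ v) z ⟧ * g (r V.∷ v)))
    ≡⟨ sumOver-cong (residues Q) (λ r → sumOver-cong (points Q n) (λ v →
         trans (cong (_* g (r V.∷ v)) (separate r v))
             (ℤ.*-assoc ⟦ + Q ∣ᶻ? (r - z zero) ⟧ ⟦ congruent? Q v (z ∘ suc) ⟧ (g (r V.∷ v))))) ⟩
  sumOver (residues Q) (λ r → sumOver (points Q n)
      (λ v → ⟦ + Q ∣ᶻ? (r - z zero) ⟧ * (⟦ congruent? Q v (z ∘ suc) ⟧ * g (r V.∷ v))))
    ≡⟨ sumOver-cong (residues Q) (λ r → trans (sumOver-* ⟦ + Q ∣ᶻ? (r - z zero) ⟧ (points Q n) _)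
         (cong (⟦ + Q ∣ᶻ? (r - z zero) ⟧ *_) (points-δ Q>0 (λ v → g (r V.∷ v))
           (λ x y h → resp (r V.∷ x) (r V.∷ y) (Fin.∀-cons (∣-refl- r) h)) (z ∘ suc)))) ⟩
  sumOver (residues Q) (λ r → ⟦ + Q ∣ᶻ? (r - z zero) ⟧ * g (r V.∷ (z ∘ suc)))
    ≡⟨ residues-δ Q>0 (λ r → g (r V.∷ (z ∘ suc)))
         (λ x y h → resp (x V.∷ (z ∘ suc)) (y V.∷ (z ∘ suc)) (Fin.∀-cons h (λ k → ∣-refl- (z (suc k)))))
             (z zero) ⟩
  g (z zero V.∷ (z ∘ suc))
    ≡⟨ resp (z zero V.∷ (z ∘ suc)) z (Fin.∀-cons (∣-refl- (z zero)) (λ k → ∣-refl- (z (suc k)))) ⟩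
  g z ∎
  where
  open ≡-Reasoning
  separate : ∀ r v → ⟦ congruent? Q (r V.∷ v) z ⟧ ≡ ⟦ + Q ∣ᶻ? (r - z zero) ⟧ * ⟦ congruent? Q v (z ∘ suc) ⟧
  separate r v = trans (⟦⟧-cong (congruent? Q (r V.∷ v) z)
      ((+ Q ∣ᶻ? (r - z zero)) ×-dec congruent? Q v (z ∘ suc))
    (λ h → h zero , h ∘ suc) (λ (h , h′) → Fin.∀-cons h h′))
        (⟦⟧-× (+ Q ∣ᶻ? (r - z zero)) (congruent? Q v (z ∘ suc)))

-- Inserting the delta sum and exchanging the sums reduces this to y ≡ U x being equivalent to x ≡
-- U⁻¹ y.
points-substitute : ∀ {Q} → 0 < Q → {U : Matrix ℤ n n} → Invertible U → (f : Vector ℤ n → ℤ) →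
  (∀ x y → Congruent Q x y → f x ≡ f y) → sumOver (points Q n) (λ x → f (U *ᵥ x)) ≡ sumOver (points Q n) f
points-substitute {n} {Q} Q>0 {U} inv f resp = begin
  ∑ (λ x → f (U *ᵥ x))
    ≡⟨ sumOver-cong (points Q n) (λ x → sym (points-δ Q>0 f resp (U *ᵥ x))) ⟩
  ∑ (λ x → ∑ (λ y → ⟦ congruent? Q y (U *ᵥ x) ⟧ * f y))
    ≡⟨ sumOver-swap (points Q n) (points Q n) _ ⟩
  ∑ (λ y → ∑ (λ x → ⟦ congruent? Q y (U *ᵥ x) ⟧ * f y))
    ≡⟨ sumOver-cong (points Q n) (λ y → trans (sumOver-cong (points Q n) (λ x → cong (_* f y)
         (⟦⟧-cong (congruent? Q y (U *ᵥ x)) (congruent? Q x (W *ᵥ y)) (move y x) (move′ y x))))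
         (points-δ Q>0 (λ _ → f y) (λ _ _ _ → refl) (W *ᵥ y))) ⟩
  ∑ f ∎
  where
  open ≡-Reasoning
  ∑ = sumOver (points Q n)
  W = Invertible.inverse inv
  move : ∀ y x → Congruent Q y (U *ᵥ x) → Congruent Q x (W *ᵥ y)
  move y x h k = subst (λ z → + Q ∣ᶻ z - (W *ᵥ y) k) (*ᵥ-cancel W U (Invertible.inverseˡ inv) x k)
    (∣-sym- ((W *ᵥ y) k) ((W *ᵥ (U *ᵥ x)) k) (*ᵥ-congruent W {y} {U *ᵥ x} h k))
  move′ : ∀ y x → Congruent Q x (W *ᵥ y) → Congruent Q y (U *ᵥ x)
  move′ y x h k = subst (λ z → + Q ∣ᶻ z - (U *ᵥ x) k) (*ᵥ-cancel U W (Invertible.inverseʳ inv) y k)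
    (∣-sym- ((U *ᵥ x) k) ((U *ᵥ (W *ᵥ y)) k) (*ᵥ-congruent U {x} {W *ᵥ y} h k))

-- Counting torsion points

multiples-count : ∀ {h} → 0 < h → ∀ g → sumOver (List.applyUpTo id (g ℕ.* h)) (λ i → ⟦ h ∣? i ⟧) ≡ + g
multiples-count         h>0 zero    = refl
multiples-count {h} h>0 (suc g) = trans (sumOver-applyUpTo-+ h (g ℕ.* h) id (λ i → ⟦ h ∣? i ⟧)) (cong₂ _+_
  (trans (sumOver-applyUpTo-single h id (λ i → ⟦ h ∣? i ⟧) {0} h>0
    (λ i i<h i≢0 → ⟦⟧-false (h ∣? i) (ℕ∣.>⇒∤ {{ℕ.≢-nonZero i≢0}} i<h))) (⟦⟧-true (h ∣? 0) (h ℕ∣.∣0)))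
  (trans (sumOver-applyUpTo-cong (g ℕ.* h) {λ i → h ℕ.+ i} {id} {λ i → ⟦ h ∣? i ⟧} {λ i → ⟦ h ∣? i ⟧}
    (λ i → ⟦⟧-cong (h ∣? (h ℕ.+ i)) (h ∣? i) (λ d → ℕ∣.∣m+n∣m⇒∣n d ℕ∣.∣-refl) (ℕ∣.∣m∣n⇒∣m+n ℕ∣.∣-refl)))
    (multiples-count h>0 g)))

-- With g = gcd(d, e) and Q = h g, both conditions together say that Q divides g r, that is h ∣ r;
-- below Q there are g such r.
annihilator-count : ∀ {Q d} e → 0 < Q → d ∣ Q →
  sumOver (residues Q) (λ r → ⟦ (+ Q ∣ᶻ? (+ d * r)) ×-dec (+ Q ∣ᶻ? (+ e * r)) ⟧) ≡ + gcd d e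
annihilator-count {Q} {d} e Q>0 d∣Q with ℕ∣.∣-trans (ℕ.gcd[m,n]∣m d e) d∣Q
... | ℕ∣.divides h refl = trans (cong (λ z → sumOver (residues z) F) (ℕ.*-comm h g))
    (trans (sumOver-applyUpTo-cong (g ℕ.* h) {+_} {id} {F} {λ i → ⟦ h ∣? i ⟧} (λ i →
      ⟦⟧-cong ((+ (h ℕ.* g) ∣ᶻ? (+ d * + i)) ×-dec (+ (h ℕ.* g) ∣ᶻ? (+ e * + i))) (h ∣? i) (fwd i) (bwd i)))
      (multiples-count (ℕ.>-nonZero⁻¹ h {{ℕ.m*n≢0⇒m≢0 h {g} {{ℕ.>-nonZero Q>0}}}}) g))
  where
  g = gcd d e
  F : ℤ → ℤ
  F r = ⟦ (+ (h ℕ.* g) ∣ᶻ? (+ d * r)) ×-dec (+ (h ℕ.* g) ∣ᶻ? (+ e * r)) ⟧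
  g≢0 : ℕ.NonZero g
  g≢0 = ℕ.m*n≢0⇒n≢0 h {g} {{ℕ.>-nonZero Q>0}}
  fwd : ∀ i → (+ (h ℕ.* g) ∣ᶻ + d * + i) × (+ (h ℕ.* g) ∣ᶻ + e * + i) → h ∣ i
  fwd i (p , q) = ℕ∣.*-cancelˡ-∣ g {{g≢0}} (subst₂ _∣_ (ℕ.*-comm h g)
    (trans (sym (ℕ.c*gcd[m,n]≡gcd[cm,cn] i d e)) (ℕ.*-comm i g))
    (ℕ.gcd-greatest (subst (h ℕ.* g ℕ∣.∣_) (trans (ℤ.abs-* (+ d) (+ i)) (ℕ.*-comm d i)) (ℤ∣.∣⇒∣ᵤ p))
                    (subst (h ℕ.* g ℕ∣.∣_) (trans (ℤ.abs-* (+ e) (+ i)) (ℕ.*-comm e i)) (ℤ∣.∣⇒∣ᵤ q))))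
  bwd : ∀ i → h ∣ i → (+ (h ℕ.* g) ∣ᶻ + d * + i) × (+ (h ℕ.* g) ∣ᶻ + e * + i)
  bwd i h∣i = lift d (ℕ.gcd[m,n]∣m d e) , lift e (ℕ.gcd[m,n]∣n d e)
    where
    lift : ∀ d → g ∣ d → + (h ℕ.* g) ∣ᶻ + d * + i
    lift d g∣d = subst (+ (h ℕ.* g) ∣ᶻ_) (ℤ.pos-* d i)
      (ℤ∣.∣ᵤ⇒∣ (subst (_∣ d ℕ.* i) (ℕ.*-comm g h) (ℕ∣.*-pres-∣ g∣d h∣i)))

-- In the coordinates of the Smith normal form: z is a solution modulo Q whose
-- class modulo the identity component of the solution group is killed by e.
DiagonalTorsion : ℕ → ℕ → List ℕ → Vector ℤ n → Set
DiagonalTorsion             Q e []       z = ⊤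
DiagonalTorsion {zero}  Q e (d ∷ ds) z = ⊤
DiagonalTorsion {suc n} Q e (d ∷ ds) z = ((+ Q ∣ᶻ + d * z zero) × (+ Q ∣ᶻ + e * z zero)) ×
    DiagonalTorsion Q e ds (z ∘ suc)

diagonalTorsion? : ∀ Q e ds (z : Vector ℤ n) → Dec (DiagonalTorsion Q e ds z)
diagonalTorsion?             Q e []       z = yes tt
diagonalTorsion? {zero}  Q e (d ∷ ds) z = yes tt
diagonalTorsion? {suc n} Q e (d ∷ ds) z = ((+ Q ∣ᶻ? (+ d * z zero)) ×-dec (+ Q ∣ᶻ? (+ e * z zero)))
    ×-dec diagonalTorsion? Q e ds (z ∘ suc)

diagonalTorsion-resp : ∀ {Q e} ds {x y : Vector ℤ n} → Congruent Q x y → DiagonalTorsion Q e ds x →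
    DiagonalTorsion Q e ds y
diagonalTorsion-resp             []       h _ = tt
diagonalTorsion-resp {zero}  (d ∷ ds) h _ = tt
diagonalTorsion-resp {suc n} {e = e} (d ∷ ds) {x} {y} h ((p , q) , rest) = (scaled d p , scaled e q) ,
    diagonalTorsion-resp ds (h ∘ suc) rest
  where
  scaled : ∀ c → _ ∣ᶻ + c * x zero → _ ∣ᶻ + c * y zero
  scaled c = ∣-resp- (+ c * y zero) (+ c * x zero)
      (∣-scale- (+ c) (y zero) (x zero) (∣-sym- (x zero) (y zero) (h zero)))

-- The coordinates are independent: gcd(d, e) choices for a coordinate with factor d, and Q choices
-- for each of the others.
diagonalTorsion-count : ∀ {Q} e → 0 < Q → ∀ {ds} → All (_∣ Q) ds → length ds ≤ n →
  sumOver (points Q n) (λ z → ⟦ diagonalTorsion? Q e ds z ⟧) ≡ +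
      (Q ℕ.^ (n ℕ.∸ length ds) ℕ.* product (List.map (λ d → gcd d e) ds))
diagonalTorsion-count {zero}      e Q>0 {[]} _ _ = refl
diagonalTorsion-count {suc n} {Q} e Q>0 {[]} _ _ = begin
  sumOver (points Q (suc n)) (λ _ → 1ℤ)                             ≡⟨ sumOver-points Q n _ ⟩
  sumOver (residues Q) (λ _ → sumOver (points Q n) (λ _ → 1ℤ))      ≡⟨ sumOver-cong (residues Q)
      (λ _ → diagonalTorsion-count {n} e Q>0 {[]} [] z≤n) ⟩
  sumOver (residues Q) (λ _ → + (Q ℕ.^ n ℕ.* 1))                    ≡⟨ constant Q +_ (+ (Q ℕ.^ n ℕ.* 1)) ⟩
  + Q * + (Q ℕ.^ n ℕ.* 1)                                           ≡⟨ ℤ.pos-* Q (Q ℕ.^ n ℕ.* 1) ⟨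
  + (Q ℕ.* (Q ℕ.^ n ℕ.* 1))                                         ≡⟨ cong +_ (ℕ.*-assoc Q (Q ℕ.^ n) 1) ⟨
  + (Q ℕ.* Q ℕ.^ n ℕ.* 1)                                           ∎
  where
  open ≡-Reasoning
  constant : ∀ k (h : ℕ → ℤ) c → sumOver (List.applyUpTo h k) (λ _ → c) ≡ + k * c
  constant zero    h c = refl
  constant (suc k) h c = trans (cong (ℤ._+_ c) (constant k (h ∘ suc) c)) (sym (ℤ.suc-* (+ k) c))
diagonalTorsion-count {suc n} {Q} e Q>0 {d ∷ ds} (d∣Q ∷ ds∣Q) (s≤s l≤n) = begin
  sumOver (points Q (suc n)) (λ z → ⟦ diagonalTorsion? Q e (d ∷ ds) z ⟧)
    ≡⟨ sumOver-points Q n _ ⟩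
  sumOver (residues Q) (λ r → sumOver (points Q n) (λ v → ⟦ a? r ×-dec diagonalTorsion? Q e ds v ⟧))
    ≡⟨ sumOver-cong (residues Q) (λ r → trans (sumOver-cong (points Q n)
        (λ v → ⟦⟧-× (a? r) (diagonalTorsion? Q e ds v)))
         (trans (sumOver-* ⟦ a? r ⟧ (points Q n) _) (ℤ.*-comm ⟦ a? r ⟧ T))) ⟩
  sumOver (residues Q) (λ r → T * ⟦ a? r ⟧)
    ≡⟨ sumOver-* T (residues Q) _ ⟩
  T * sumOver (residues Q) (λ r → ⟦ a? r ⟧)
    ≡⟨ cong₂ _*_ (diagonalTorsion-count e Q>0 ds∣Q l≤n) (annihilator-count e Q>0 d∣Q) ⟩
  + (Q^ ℕ.* π) * + gcd d e
    ≡⟨ ℤ.pos-* (Q^ ℕ.* π) (gcd d e) ⟨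
  + (Q^ ℕ.* π ℕ.* gcd d e)
    ≡⟨ cong +_ (trans (ℕ.*-assoc Q^ π (gcd d e)) (cong (Q^ ℕ.*_) (ℕ.*-comm π (gcd d e)))) ⟩
  + (Q^ ℕ.* (gcd d e ℕ.* π)) ∎
  where
  open ≡-Reasoning
  a? = λ r → (+ Q ∣ᶻ? (+ d * r)) ×-dec (+ Q ∣ᶻ? (+ e * r))
  T = sumOver (points Q n) (λ v → ⟦ diagonalTorsion? Q e ds v ⟧)
  Q^ = Q ℕ.^ (n ℕ.∸ length ds)
  π = product (List.map (λ d → gcd d e) ds)

-- Solutions modulo Q, taken modulo those that lift to integer solutions, form the direct sum of the
-- ℤ/d_i when all d_i divide Q. The condition selects the classes killed by e.
Torsion : Matrix ℤ m n → ℕ → ℕ → Vector ℤ n → Set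
Torsion M Q e x = (∀ i → + Q ∣ᶻ (M *ᵥ x) i) × ∃ λ y → Kernel M y × Congruent Q (λ k → + e * x k) y

torsion-mono : ∀ (M : Matrix ℤ m n) {Q e f x} → e ∣ f → Torsion M Q e x → Torsion M Q f x
torsion-mono M {Q} {e} {f} {x} (ℕ∣.divides c refl) (s , y , My≡0 , h) = s , (λ k → + c * y k) ,
  (λ i → trans (dot-scaleʳ (M i) y (+ c)) (trans (cong (+ c *_) (My≡0 i)) (ℤ.*-zeroʳ (+ c)))) ,
  λ k → subst (λ z → + Q ∣ᶻ z - + c * y k) (trans (sym (ℤ.*-assoc (+ c) (+ e) (x k)))
      (cong (_* x k) (sym (ℤ.pos-* c e))))
    (∣-scale- (+ c) (+ e * x k) (y k) (h k))

diagonalTorsion⇒torsion : ∀ {Q e} ds (z : Vector ℤ n) → length ds ≤ n →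
                          DiagonalTorsion Q e ds z → Torsion {m} (diagonal ds) Q e z
diagonalTorsion⇒torsion {n} {Q = Q} {e} [] z _ _ = (λ i → subst (+ Q ∣ᶻ_) (sym (sum0ˡ n z)) ∣0) ,
  (λ k → + e * z k) , (λ i → sum0ˡ n (λ k → + e * z k)) , λ k → ∣-refl- (+ e * z k)
diagonalTorsion⇒torsion {suc n} {zero}  {Q} {e} (d ∷ ds) z (s≤s l) t = (λ ()) , (λ k → + e * z k) ,
    (λ ()) , λ k → ∣-refl- (+ e * z k)
diagonalTorsion⇒torsion {suc n} {suc m} {Q} {e} (d ∷ ds) z (s≤s l) ((p , q) , t)
  with diagonalTorsion⇒torsion {n} {m} ds (z ∘ suc) l t
... | s , y , ker , h = (λ { zero → subst (+ Q ∣ᶻ_) (sym (+0 refl (sum0ˡ n (z ∘ suc)))) p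
                           ; (suc i) → subst (+ Q ∣ᶻ_) (sym (0+ (ℤ.*-zeroˡ (z zero)) refl)) (s i) }) ,
    (0ℤ V.∷ y) , (λ { zero → +0 (ℤ.*-zeroʳ (+ d)) (sum0ˡ n y) ; (suc i) → 0+ refl (ker i) }) ,
    Fin.∀-cons (subst (+ Q ∣ᶻ_) (sym (ℤ.+-identityʳ (+ e * z zero))) q) h

torsion⇒diagonalTorsion : ∀ {Q e ds} (z : Vector ℤ n) → All (0 <_) ds → length ds ≤ m →
                          Torsion {m} (diagonal ds) Q e z → DiagonalTorsion Q e ds z
torsion⇒diagonalTorsion {ds = []} z _ _ _ = tt
torsion⇒diagonalTorsion {zero}  {ds = d ∷ ds} z _ _ _ = tt
torsion⇒diagonalTorsion {suc n} {suc m} {Q} {e} {d ∷ ds} z (d>0 ∷ ds>0) (s≤s l) (s , y , ker , h) =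
  (subst (+ Q ∣ᶻ_) (+0 refl (sum0ˡ n (z ∘ suc))) (s zero) ,
   subst (+ Q ∣ᶻ_) (trans (cong (_-_ (+ e * z zero)) y₀≡0) (ℤ.+-identityʳ (+ e * z zero))) (h zero)) ,
  torsion⇒diagonalTorsion {n} {m} (z ∘ suc) ds>0 l
    ((λ i → subst (+ Q ∣ᶻ_) (0+ (ℤ.*-zeroˡ (z zero)) refl) (s (suc i))) , y ∘ suc ,
     (λ i → trans (sym (0+ (ℤ.*-zeroˡ (y zero)) refl)) (ker (suc i))) , h ∘ suc)
  where
  -- An integer kernel vector of the diagonal matrix vanishes where the factor is positive, so the
  -- lifting condition reduces to Q dividing e times that coordinate.
  y₀≡0 : y zero ≡ 0ℤ
  y₀≡0 with ℤ.i*j≡0⇒i≡0∨j≡0 (+ d) (trans (sym (+0 refl (sum0ˡ n (y ∘ suc)))) (ker zero))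
  ... | inj₁ d≡0 = contradiction d≡0 (+-nonzero d>0)
  ... | inj₂ e₀  = e₀

-- Used with M = U D V and with D = U⁻¹ M V⁻¹, it yields the two directions of the passage to Smith
-- coordinates.
torsion-transport : ∀ {Q e} {M N : Matrix ℤ m n} {P : Matrix ℤ m m} {V V⁻¹ : Matrix ℤ n n} →
  (∀ x → M *ᵥ x ≋ᵥ P *ᵥ (N *ᵥ (V *ᵥ x))) → V ⊗ V⁻¹ ≋ 𝟙 → V⁻¹ ⊗ V ≋ 𝟙 →
  ∀ {x} → Torsion N Q e (V *ᵥ x) → Torsion M Q e x
torsion-transport {Q = Q} {e} {M} {N} {P} {V} {V⁻¹} act VV⁻¹ V⁻¹V {x} (s , y , ker , h) =
  (λ i → subst (+ Q ∣ᶻ_) (sym (act x i)) (∣-sum (λ k → P i k * (N *ᵥ (V *ᵥ x)) k)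
      (λ k → ℤ∣.∣n⇒∣m*n (P i k) (s k)))) ,
  V⁻¹ *ᵥ y ,
  (λ i → trans (act (V⁻¹ *ᵥ y) i) (dot-zeroʳ (P i)
      (λ k → trans (sum-cong-≋ (λ j → cong (N k j *_) (*ᵥ-cancel V V⁻¹ VV⁻¹ y j))) (ker k)))) ,
  λ k → subst (λ z → + Q ∣ᶻ z - (V⁻¹ *ᵥ y) k)
    (trans (dot-scaleʳ (V⁻¹ k) (V *ᵥ x) (+ e)) (cong (+ e *_) (*ᵥ-cancel V⁻¹ V V⁻¹V x k)))
    (*ᵥ-congruent V⁻¹ {λ j → + e * (V *ᵥ x) j} {y} h k)

module _ (M : Matrix ℤ m n) where
  private
    open module S = Snf M using (U; V; U⁻¹; V⁻¹; D; factors)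
    open Invertible

    act : ∀ x → M *ᵥ x ≋ᵥ U *ᵥ (D *ᵥ (V *ᵥ x))
    act x i = trans (*ᵥ-cong {x = x} S.equation (λ _ → refl) i) (trans (*ᵥ-assoc U (D ⊗ V) x i)
      (sum-cong-≋ (λ k → cong (U i k *_) (*ᵥ-assoc D V x k))))

    act⁻¹ : ∀ z → D *ᵥ z ≋ᵥ U⁻¹ *ᵥ (M *ᵥ (V⁻¹ *ᵥ z))
    act⁻¹ z i = trans (*ᵥ-cong {x = z} (≋-sym S.U⁻¹⊗M⊗V⁻¹) (λ _ → refl) i)
        (trans (*ᵥ-assoc U⁻¹ (M ⊗ V⁻¹) z i)
      (sum-cong-≋ (λ k → cong (U⁻¹ i k *_) (*ᵥ-assoc M V⁻¹ z k))))

    to : ∀ {Q e x} → DiagonalTorsion Q e factors (V *ᵥ x) → Torsion M Q e x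
    to {e = e} {x} t = torsion-transport {e = e} {M} {D} {U} {V} {V⁻¹} act (inverseʳ S.V-unimodular)
        (inverseˡ S.V-unimodular)
      (diagonalTorsion⇒torsion factors (V *ᵥ x) S.length≤n t)

    from : ∀ {Q e x} → Torsion M Q e x → DiagonalTorsion Q e factors (V *ᵥ x)
    from {Q} {e} {x} (s , y , ker , h) = torsion⇒diagonalTorsion (V *ᵥ x) S.positive S.length≤m
      (torsion-transport {e = e} {D} {M} {U⁻¹} {V⁻¹} {V} act⁻¹ (inverseˡ S.V-unimodular)
          (inverseʳ S.V-unimodular) {V *ᵥ x}
        ((λ i → subst (+ Q ∣ᶻ_) (sym (dot-cong i)) (s i)) , y , ker , λ k → subst
            (λ z → + Q ∣ᶻ + e * z - y k) (sym (undo k)) (h k)))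
      where
      undo : ∀ k → (V⁻¹ *ᵥ (V *ᵥ x)) k ≡ x k
      undo = *ᵥ-cancel V⁻¹ V (inverseˡ S.V-unimodular) x
      dot-cong : ∀ i → (M *ᵥ (V⁻¹ *ᵥ (V *ᵥ x))) i ≡ (M *ᵥ x) i
      dot-cong i = sum-cong-≋ (λ k → cong (M i k *_) (undo k))

  abstract
    torsion? : ∀ Q e x → Dec (Torsion M Q e x)
    torsion? Q e x = map′ to from (diagonalTorsion? Q e factors (V *ᵥ x))

    torsion-count : ∀ {Q} e → 0 < Q → All (_∣ Q) (invariantFactors M) →
      sumOver (points Q n) (λ x → ⟦ torsion? Q e x ⟧) ≡
      + (Q ℕ.^ (n ℕ.∸ rank M) ℕ.* product (List.map (λ d → gcd d e) (invariantFactors M)))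
    torsion-count {Q} e Q>0 ds∣Q = trans
      (points-substitute Q>0 S.V-unimodular (λ z → ⟦ diagonalTorsion? Q e factors z ⟧)
        (λ x y h → ⟦⟧-cong (diagonalTorsion? Q e factors x) (diagonalTorsion? Q e factors y)
          (diagonalTorsion-resp factors h) (diagonalTorsion-resp factors (λ k → ∣-sym- (x k) (y k) (h k)))))
      (diagonalTorsion-count e Q>0 ds∣Q S.length≤n)

-- The arrangement

sign-square : ∀ k → sign k * sign k ≡ 1ℤ
sign-square zero    = refl
sign-square (suc k) = trans (square (sign k)) (sign-square k)
  where
  square : ∀ s → -1ℤ * s * (-1ℤ * s) ≡ s * s
  square = solve-∀

-- The sets without broken circuits are independent, hence all of size j here.
nbc-count : (M : Matrix ℤ m n) {E : Pred (Fin m) 0ℓ} (E? : Decidable E)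
  {L : Subset m → Set} (L? : Decidable L) → Respects M E (λ J → ⟦ L? J ⟧) → ∀ j →
  (∀ J → L J → (∀ i → E (element J i)) × rank (M ∘ element J) ≡ j) →
  sign j * sumOver (subsets m) (λ J → sign ∣ J ∣ * ⟦ L? J ⟧) ≡
  sumOver (subsets m) (λ J → ⟦ nbc? M E? J ⟧ * ⟦ L? J ⟧)
nbc-count {m} M {E} E? {L} L? resp j h = trans (cong (sign j *_) (nbc-sum M E? (λ J → ⟦ L? J ⟧) resp))
  (trans (sym (sumOver-* (sign j) (subsets m) _)) (sumOver-cong (subsets m) term))
  where
  unsign : ∀ s x → s * (s * x) ≡ s * s * x
  unsign = solve-∀
  zeroes : ∀ s t x → s * (t * (x * 0ℤ)) ≡ x * 0ℤ
  zeroes = solve-∀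
  zeroes′ : ∀ s t x → s * (t * (0ℤ * x)) ≡ 0ℤ * x
  zeroes′ = solve-∀
  term : ∀ J → sign j * (sign ∣ J ∣ * (⟦ nbc? M E? J ⟧ * ⟦ L? J ⟧)) ≡ ⟦ nbc? M E? J ⟧ * ⟦ L? J ⟧
  term J with nbc? M E? J | L? J
  ... | no _    | l     = zeroes′ (sign j) (sign ∣ J ∣) ⟦ l ⟧
  ... | yes _   | no _  = zeroes (sign j) (sign ∣ J ∣) 1ℤ
  ... | yes nbc | yes l with h J l
  ...   | es , r≡j = trans (cong (λ k → sign j * (sign k * 1ℤ)) J≡j)
          (trans (unsign (sign j) 1ℤ) (cong (_* 1ℤ) (sign-square j)))
    where
    J≡j : ∣ J ∣ ≡ j
    J≡j = ℕ.≤-antisym (ℕ.≤-trans (nbc-rank M E J nbc es) (ℕ.≤-reflexive r≡j))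
      (ℕ.≤-trans (ℕ.≤-reflexive (sym r≡j)) (SmithNormalForm.length≤m (smithNormalForm (M ∘ element J))))

∈-subsets : (J : Subset m) → J ∈ subsets m
∈-subsets Vec.[]              = here refl
∈-subsets (inside Vec.∷ J)  = ∈-++⁺ˡ (∈-map⁺ (inside Vec.∷_) (∈-subsets J))
∈-subsets {suc m} (outside Vec.∷ J) = ∈-++⁺ʳ (List.map (inside Vec.∷_) (subsets m))
    (∈-map⁺ (outside Vec.∷_) (∈-subsets J))

∣-foldr-lcm : ∀ {x} xs → x ∈ xs → x ∣ List.foldr lcm 1 xs
∣-foldr-lcm (x ∷ xs) (here refl)  = ℕ.m∣lcm[m,n] x (List.foldr lcm 1 xs)
∣-foldr-lcm (y ∷ xs) (there x∈xs) = ℕ∣.∣-trans (∣-foldr-lcm xs x∈xs) (ℕ.n∣lcm[m,n] y (List.foldr lcm 1 xs))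

all-∣-last : ∀ {ds} → Linked _∣_ ds → All (_∣ nth ds (length ds)) ds
all-∣-last []           = []
all-∣-last [-]          = ℕ∣.∣-refl ∷ []
all-∣-last {d ∷ e ∷ ds} ch@(_ ∷ ch′) = head∣nth ch (suc (length ds)) ∷ all-∣-last ch′

if-true : (d : Dec P) → P → {x y : X} → (if does d then x else y) ≡ x
if-true (yes _) _ = refl
if-true (no ¬p) p = contradiction p ¬p

applyUpTo-nth : ∀ ds → List.applyUpTo (λ i → nth ds (suc i)) (length ds) ≡ ds
applyUpTo-nth []       = refl
applyUpTo-nth (d ∷ ds) = cong (d ∷_) (applyUpTo-nth ds)

map-nth : (g : ℕ → X) → ∀ ds → List.map (λ j → g (nth ds j)) [1⋯ length ds ] ≡ List.map g ds
map-nth g ds = trans (List.map-∘ {g = g} {f = nth ds} [1⋯ length ds ])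
  (cong (List.map g) (trans (List.map-applyUpTo suc (nth ds) (length ds)) (applyUpTo-nth ds)))

gcd-absorb : ∀ {d ρ} e → d ∣ ρ → gcd e d ≡ gcd (gcd e ρ) d
gcd-absorb {d} {ρ} e d∣ρ = ℕ∣.∣-antisym
  (ℕ.gcd-greatest (ℕ.gcd-greatest (ℕ.gcd[m,n]∣m e d) (ℕ∣.∣-trans (ℕ.gcd[m,n]∣n e d) d∣ρ))
      (ℕ.gcd[m,n]∣n e d))
  (ℕ.gcd-greatest (ℕ∣.∣-trans (ℕ.gcd[m,n]∣m (gcd e ρ) d) (ℕ.gcd[m,n]∣m e ρ)) (ℕ.gcd[m,n]∣n (gcd e ρ) d))

gcd-restrict : ∀ {a q} d → a ∣ q → gcd a d ≡ gcd a (gcd q d)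
gcd-restrict {a} {q} d a∣q = ℕ∣.∣-antisym
  (ℕ.gcd-greatest (ℕ.gcd[m,n]∣m a d) (ℕ.gcd-greatest (ℕ∣.∣-trans (ℕ.gcd[m,n]∣m a d) a∣q)
      (ℕ.gcd[m,n]∣n a d)))
  (ℕ.gcd-greatest (ℕ.gcd[m,n]∣m a (gcd q d)) (ℕ∣.∣-trans (ℕ.gcd[m,n]∣n a (gcd q d)) (ℕ.gcd[m,n]∣n q d)))

-- The kernel of M is the part of the augmented kernel with last coordinate 0. Equal augmented
-- kernels thus force equal r as well as equal r̄.
kernel-unaugment : (M : Matrix ℤ k n) (b : Vector ℤ k) (N : Matrix ℤ p n) (c : Vector ℤ p) →
  (∀ y → Kernel (augment M b) y → Kernel (augment N c) y) → ∀ x → Kernel M x → Kernel N x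
kernel-unaugment M b N c h x Mx≡0 i = trans (sym (dot-padʳ (N i) x (c i)))
  (h (x V.++ (0ℤ V.∷ V.[])) (λ k → trans (dot-padʳ (M k) x (b k)) (Mx≡0 k)) i)

module _ {m n : ℕ} (A : Matrix ℤ m n) (𝐚 : Vector ℤ m) where

  open Arrangement A 𝐚

  Ā : Matrix ℤ m (n ℕ.+ 1)
  Ā = augment A 𝐚

  Level : ℕ → Subset m → Set
  Level j J = r̄ J ≡ r J × r J ≡ j

  level? : ∀ j J → Dec (Level j J)
  level? j J = r̄ J ℕ.≟ r J ×-dec r J ℕ.≟ j

  factors∣ρC : ∀ J → r̄ J ≡ r J → All (_∣ ρC) (invariantFactors (rows J))
  factors∣ρC J c = All.map (λ h → ℕ∣.∣-trans h
      (∣-foldr-lcm _ (∈-map⁺ (λ J → d J (r J)) (∈-filter⁺ (λ J → r̄ J ℕ.≟ r J) (∈-subsets J) c))))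
    (all-∣-last (SmithNormalForm.chain (smithNormalForm (rows J))))

  d∣ρC : ∀ J → r̄ J ≡ r J → ∀ {k} → 1 ≤ k → k ≤ r J → d J k ∣ ρC
  d∣ρC J c 1≤k k≤r = ℕ∣.∣-trans (nth∣nth (SmithNormalForm.chain (smithNormalForm (rows J))) 1≤k k≤r)
    (∣-foldr-lcm _ (∈-map⁺ (λ J → d J (r J)) (∈-filter⁺ (λ J → r̄ J ℕ.≟ r J) (∈-subsets J) c)))

  -- The order of the e-torsion of ℤⁿ modulo the rows of A_J.
  torsionOrder : Subset m → ℕ → ℕ
  torsionOrder J e = product (List.map (λ d → gcd d e) (invariantFactors (rows J)))

  d̃-torsionOrder : ∀ J q → (∀ k → 1 ≤ k → k ≤ r J → gcd q (d J k) ≡ gcd q (d̄ J k)) → d̃ J q ≡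
      torsionOrder J q
  d̃-torsionOrder J q h = trans
    (if-true (All.all? (λ j → gcd q (d J j) ℕ.≟ gcd q (d̄ J j)) [1⋯ r J ])
      (All.applyUpTo⁺₁ suc (r J) (λ {i} i<r → h (suc i) (s≤s z≤n) i<r)))
    (cong (List.foldr ℕ._*_ 1) (map-nth (λ d → gcd d q) (invariantFactors (rows J))))

  torsionOrder-gcd : ∀ J → r̄ J ≡ r J → ∀ e → torsionOrder J e ≡ torsionOrder J (gcd e ρC)
  torsionOrder-gcd J c e = cong product (List.map-cong-local (All.map
    (λ {d} d∣ρ → trans (ℕ.gcd-comm d e) (trans (gcd-absorb e d∣ρ) (ℕ.gcd-comm (gcd e ρC) d)))
        (factors∣ρC J c)))

  torsionOrder-1 : ∀ J → torsionOrder J 1 ≡ 1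
  torsionOrder-1 J = ones (invariantFactors (rows J))
    where
    ones : ∀ ds → product (List.map (λ d → gcd d 1) ds) ≡ 1
    ones []       = refl
    ones (d ∷ ds) = cong₂ ℕ._*_ (ℕ∣.∣1⇒≡1 (ℕ.gcd[m,n]∣n d 1)) (ones ds)

  torsionSum : ℕ → ℕ → ℤ
  torsionSum j e = sign j * sumOver (subsets m) (λ J → ⟦ level? j J ⟧ * (sign ∣ J ∣ * + torsionOrder J e))

  level-cong : ∀ {j} {f g : Subset m → ℤ} → (∀ J → Level j J → f J ≡ g J) →
    ∀ J → ⟦ level? j J ⟧ * f J ≡ ⟦ level? j J ⟧ * g J
  level-cong {j} {f} {g} e J = by-cases (level? j J) (e J)
    where
    by-cases : (d : Dec P) → (P → f J ≡ g J) → ⟦ d ⟧ * f J ≡ ⟦ d ⟧ * g J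
    by-cases (yes p) e = cong (1ℤ *_) (e p)
    by-cases (no _)  e = refl

  β-torsionSum : ∀ j q → (∀ J → r̄ J ≡ r J → ∀ k → 1 ≤ k → k ≤ r J → gcd q (d J k) ≡ gcd q (d̄ J k)) →
                 β j q ≡ torsionSum j q
  β-torsionSum j q h = cong (sign j *_) (trans
    (sumOver-filter (level? j) (subsets m) (λ J → sign ∣ J ∣ * + d̃ J q))
    (sumOver-cong (subsets m) (level-cong (λ J (c , _) → cong (λ t → sign ∣ J ∣ * + t)
        (d̃-torsionOrder J q (h J c))))))

  torsionSum-gcd : ∀ j e → torsionSum j e ≡ torsionSum j (gcd e ρC)
  torsionSum-gcd j e = cong (sign j *_) (sumOver-cong (subsets m)
    (level-cong (λ J (c , _) → cong (λ t → sign ∣ J ∣ * + t) (torsionOrder-gcd J c e))))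

  -- Always d̄_{J,k} ∣ d_{J,k}; conversely gcd(d_{J,k}, q) ∣ d̄_{J,k}, since modulo q the appended
  -- column is a combination of the others.
  gcd-agree : ∀ {q} J → r̄ J ≡ r J → InColumnSpan q J → ∀ k → 1 ≤ k → k ≤ r J → gcd q (d J k) ≡ gcd q
      (d̄ J k)
  gcd-agree {q} J cons (c , h) k 1≤k k≤r = ℕ∣.∣-antisym
    (ℕ.gcd-greatest (ℕ.gcd[m,n]∣m q (d J k)) (subst (_∣ d̄ J k) (ℕ.gcd-comm (d J k) q)
      (modular-∣ (rows J) (entries J) {q} {c} (λ i → ∣-sym- (entries J i) ((rows J *ᵥ c) i)
          (Modular._≡_mod_.modulus∣ (h i)))
        k (ℕ.≤-trans k≤r (ℕ.≤-reflexive (sym cons))))))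
    (ℕ.gcd-greatest (ℕ.gcd[m,n]∣m q (d̄ J k)) (ℕ∣.∣-trans (ℕ.gcd[m,n]∣n q (d̄ J k))
        (augment-∣ (rows J) (entries J) k k≤r)))

  -- Carries the hypothesis at q over to 1, a and b: all factors involved divide ρ_C, so e may be
  -- replaced by gcd(e, ρ_C), and agreement at q descends to divisors of q.
  gcd-agree-divisor : ∀ {q} → (∀ J → r̄ J ≡ r J → InColumnSpan q J) → ∀ e → gcd e ρC ∣ q →
    ∀ J → r̄ J ≡ r J → ∀ k → 1 ≤ k → k ≤ r J → gcd e (d J k) ≡ gcd e (d̄ J k)
  gcd-agree-divisor {q} span e e′∣q J c k 1≤k k≤r = begin
    gcd e (d J k)              ≡⟨ gcd-absorb e (d∣ρC J c 1≤k k≤r) ⟩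
    gcd e′ (d J k)             ≡⟨ gcd-restrict (d J k) e′∣q ⟩
    gcd e′ (gcd q (d J k))     ≡⟨ cong (gcd e′) (gcd-agree J c (span J c) k 1≤k k≤r) ⟩
    gcd e′ (gcd q (d̄ J k))     ≡⟨ gcd-restrict (d̄ J k) e′∣q ⟨
    gcd e′ (d̄ J k)             ≡⟨ gcd-absorb e (ℕ∣.∣-trans (augment-∣ (rows J) (entries J) k k≤r)
        (d∣ρC J c 1≤k k≤r)) ⟨
    gcd e (d̄ J k)              ∎
    where
    open ≡-Reasoning
    e′ = gcd e ρC

  level-resp : ∀ {j} J J′ → (∀ y → Kernel (Ā ∘ element J) y → Kernel (Ā ∘ element J′) y) →
               (∀ y → Kernel (Ā ∘ element J′) y → Kernel (Ā ∘ element J) y) → Level j J → Level j J′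
  level-resp J J′ f g (c , e) = trans (sym r̄≡) (trans c r≡) , trans (sym r≡) e
    where
    r̄≡ : r̄ J ≡ r̄ J′
    r̄≡ = rank-cong (Ā ∘ element J) (Ā ∘ element J′) f g
    r≡ : r J ≡ r J′
    r≡ = rank-cong (rows J) (rows J′) (kernel-unaugment (rows J) (entries J) (rows J′) (entries J′) f)
      (kernel-unaugment (rows J′) (entries J′) (rows J) (entries J) g)

  module _ (Q : ℕ) (Q>0 : 0 < Q) (factors∣Q : ∀ J → r̄ J ≡ r J → All (_∣ Q) (invariantFactors (rows J))) where

    Through : Vector ℤ n → Pred (Fin m) 0ℓ
    Through x i = + Q ∣ᶻ (A *ᵥ x) i

    through? : ∀ x → Decidable (Through x)
    through? x i = + Q ∣ᶻ? (A *ᵥ x) i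

    LevelTorsion : ℕ → ℕ → Vector ℤ n → Subset m → Set
    LevelTorsion j e x J = Level j J × Torsion (rows J) Q e x

    levelTorsion? : ∀ j e x J → Dec (LevelTorsion j e x J)
    levelTorsion? j e x J = level? j J ×-dec torsion? (rows J) Q e x

    levelTorsion-resp : ∀ {j e x} J J′ → (∀ y → Kernel (Ā ∘ element J) y → Kernel (Ā ∘ element J′) y) →
      (∀ y → Kernel (Ā ∘ element J′) y → Kernel (Ā ∘ element J) y) →
      ((∀ i → Through x (element J i)) → (∀ i → Through x (element J′ i))) →
      LevelTorsion j e x J → LevelTorsion j e x J′
    levelTorsion-resp J J′ f g es (l , s , y , ker , h) = level-resp J J′ f g l ,
      es s , y , kernel-unaugment (rows J) (entries J) (rows J′) (entries J′) f y ker , h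

    torsionSum-count : ∀ j e → + (Q ℕ.^ (n ℕ.∸ j)) * torsionSum j e ≡
      sumOver (points Q n) (λ x → sumOver (subsets m)
          (λ J → ⟦ nbc? Ā (through? x) J ⟧ * ⟦ levelTorsion? j e x J ⟧))
    torsionSum-count j e = begin
      N * (sign j * ∑ (λ J → ⟦ level? j J ⟧ * (sign ∣ J ∣ * + torsionOrder J e)))
        ≡⟨ commute N (sign j) _ ⟩
      sign j * (N * ∑ (λ J → ⟦ level? j J ⟧ * (sign ∣ J ∣ * + torsionOrder J e)))
        ≡⟨ cong (sign j *_) (sumOver-* N (subsets m) _) ⟨
      sign j * ∑ (λ J → N * (⟦ level? j J ⟧ * (sign ∣ J ∣ * + torsionOrder J e)))
        ≡⟨ cong (sign j *_) (sumOver-cong (subsets m) term) ⟩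
      sign j * ∑ (λ J → ∑ₓ (λ x → sign ∣ J ∣ * ⟦ levelTorsion? j e x J ⟧))
        ≡⟨ cong (sign j *_) (sumOver-swap (subsets m) (points Q n) _) ⟩
      sign j * ∑ₓ (λ x → ∑ (λ J → sign ∣ J ∣ * ⟦ levelTorsion? j e x J ⟧))
        ≡⟨ sumOver-* (sign j) (points Q n) _ ⟨
      ∑ₓ (λ x → sign j * ∑ (λ J → sign ∣ J ∣ * ⟦ levelTorsion? j e x J ⟧))
        ≡⟨ sumOver-cong (points Q n) (λ x → nbc-count Ā (through? x) (levelTorsion? j e x)
             (λ J J′ f g es es′ → ⟦⟧-cong (levelTorsion? j e x J) (levelTorsion? j e x J′)
               (levelTorsion-resp {j} {e} {x} J J′ f g es) (levelTorsion-resp {j} {e} {x} J′ J g f es′)) j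
             -- Circuits live in `Ā`, so the rank asked for here is r̄(J), which equals r(J) = j on
             -- this level.
             (λ J ((c , l) , s , _) → s , trans c l)) ⟩
      ∑ₓ (λ x → ∑ (λ J → ⟦ nbc? Ā (through? x) J ⟧ * ⟦ levelTorsion? j e x J ⟧)) ∎
      where
      open ≡-Reasoning
      N = + (Q ℕ.^ (n ℕ.∸ j))
      ∑ = sumOver (subsets m)
      ∑ₓ = sumOver (points Q n)
      commute : ∀ a b c → a * (b * c) ≡ b * (a * c)
      commute = solve-∀
      shuffle : ∀ N l s t → N * (l * (s * t)) ≡ l * (s * (N * t))
      shuffle = solve-∀
      shuffle′ : ∀ l s t → l * (s * t) ≡ s * l * t
      shuffle′ = solve-∀
      term : ∀ J → N * (⟦ level? j J ⟧ * (sign ∣ J ∣ * + torsionOrder J e)) ≡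
                   ∑ₓ (λ x → sign ∣ J ∣ * ⟦ levelTorsion? j e x J ⟧)
      term J = begin
        N * (⟦ level? j J ⟧ * (sign ∣ J ∣ * + torsionOrder J e))
          ≡⟨ shuffle N ⟦ level? j J ⟧ (sign ∣ J ∣) (+ torsionOrder J e) ⟩
        ⟦ level? j J ⟧ * (sign ∣ J ∣ * (N * + torsionOrder J e))
          ≡⟨ level-cong {j} (λ J (c , l) → cong (sign ∣ J ∣ *_)
              (trans (sym (ℤ.pos-* (Q ℕ.^ (n ℕ.∸ j)) (torsionOrder J e)))
               (trans (cong (λ k → + (Q ℕ.^ (n ℕ.∸ k) ℕ.* torsionOrder J e)) (sym l))
                 (sym (torsion-count (rows J) e Q>0 (factors∣Q J c)))))) J ⟩
        ⟦ level? j J ⟧ * (sign ∣ J ∣ * ∑ₓ (λ x → ⟦ torsion? (rows J) Q e x ⟧))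
          ≡⟨ shuffle′ ⟦ level? j J ⟧ (sign ∣ J ∣) _ ⟩
        sign ∣ J ∣ * ⟦ level? j J ⟧ * ∑ₓ (λ x → ⟦ torsion? (rows J) Q e x ⟧)
          ≡⟨ sumOver-* (sign ∣ J ∣ * ⟦ level? j J ⟧) (points Q n) _ ⟨
        ∑ₓ (λ x → sign ∣ J ∣ * ⟦ level? j J ⟧ * ⟦ torsion? (rows J) Q e x ⟧)
          ≡⟨ sumOver-cong (points Q n) (λ x → trans
              (ℤ.*-assoc (sign ∣ J ∣) ⟦ level? j J ⟧ ⟦ torsion? (rows J) Q e x ⟧)
               (cong (sign ∣ J ∣ *_) (sym (⟦⟧-× (level? j J) (torsion? (rows J) Q e x))))) ⟩
        ∑ₓ (λ x → sign ∣ J ∣ * ⟦ levelTorsion? j e x J ⟧) ∎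

    torsionSum-mono : ∀ j {e f} → e ∣ f → torsionSum j e ℤ.≤ torsionSum j f
    torsionSum-mono j {e} {f} e∣f = ℤ.*-cancelˡ-≤-pos (torsionSum j e) (torsionSum j f)
        (+ (Q ℕ.^ (n ℕ.∸ j)))
      {{ℤ.positive (ℤ.+<+ (ℕ.m^n>0 Q {{ℕ.>-nonZero Q>0}} (n ℕ.∸ j)))}}
      (subst₂ ℤ._≤_ (sym (torsionSum-count j e)) (sym (torsionSum-count j f))
        (sumOver-mono (points Q n) λ x → sumOver-mono (subsets m) λ J →
          ℤ.*-monoˡ-≤-nonNeg ⟦ nbc? Ā (through? x) J ⟧ {{ℤ.nonNegative (⟦⟧-nonneg (nbc? Ā (through? x) J))}}
            (⟦⟧-mono (levelTorsion? j e x J) (levelTorsion? j f x J)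
              (λ (l , t) → l , torsion-mono (rows J) {Q} {e} {f} {x} e∣f t))))

  torsionSum-1 : ∀ j → torsionSum j 1 ≡ sign j * sumOver (subsets m) (λ J → sign ∣ J ∣ * ⟦ level? j J ⟧)
  torsionSum-1 j = cong (sign j *_) (sumOver-cong (subsets m) (λ J →
    trans (cong (λ t → ⟦ level? j J ⟧ * (sign ∣ J ∣ * + t)) (torsionOrder-1 J))
        (commute ⟦ level? j J ⟧ (sign ∣ J ∣))))
    where
    commute : ∀ l s → l * (s * 1ℤ) ≡ s * l
    commute = solve-∀

  rank≤n : (M : Matrix ℤ k n) → rank M ≤ n
  rank≤n M = SmithNormalForm.length≤n (smithNormalForm M)

  w-torsionSum : ∀ {j} → j ≤ s → w j ≡ torsionSum j 1
  w-torsionSum {j} j≤s = trans (cong (sign j *_) (sumOver-cong (subsets m) term)) (sym (torsionSum-1 j))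
    where
    j≤n = ℕ.≤-trans j≤s (rank≤n A)
    monomial : ∀ J → r̄ J ≡ r J → signedMonomial J (n ℕ.∸ r J) (n ℕ.∸ j) ≡ sign ∣ J ∣ * ⟦ level? j J ⟧
    monomial J c = by-cases (level? j J) (n ℕ.∸ r J ℕ.≟ n ℕ.∸ j)
      where
      by-cases : (l : Dec (Level j J)) (e : Dec (n ℕ.∸ r J ≡ n ℕ.∸ j)) →
          (if does e then sign ∣ J ∣ else 0ℤ) ≡ sign ∣ J ∣ * ⟦ l ⟧
      by-cases (yes _)       (yes _)  = sym (ℤ.*-identityʳ (sign ∣ J ∣))
      by-cases (no _)        (no _)   = sym (ℤ.*-zeroʳ (sign ∣ J ∣))
      by-cases (yes (_ , l)) (no ≢)   = contradiction (cong (n ℕ.∸_) l) ≢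
      -- Truncated subtraction from n is injective here, as r(J) and j are both at most n.
      by-cases (no ¬l)       (yes e)  = contradiction (c , ℕ.∸-cancelˡ-≡ (rank≤n (rows J)) j≤n e) ¬l
    term : ∀ J → [ (λ _ → 0ℤ) , (λ (dim , _) → signedMonomial J dim (n ℕ.∸ j)) ]′ (dimension J) ≡ sign ∣
        J ∣ * ⟦ level? j J ⟧
    term J with χ-term A 𝐚 J (n ℕ.∸ j)
    ... | inj₁ (c , e)  = trans e (monomial J c)
    ... | inj₂ (¬c , e) = trans e (sym (trans (cong (sign ∣ J ∣ *_)
        (⟦⟧-false (level? j J) (¬c ∘ proj₁))) (ℤ.*-zeroʳ (sign ∣ J ∣))))

  torsionSum-positive : (∀ i → ¬ (∀ k → A i k ≡ 0ℤ)) → ∀ {j} → j ≤ s → 0ℤ ℤ.< torsionSum j 1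
  torsionSum-positive A≢0 {j} j≤s with maximal-pivotal {p = 0} (λ ()) A
  ... | J , piv , ker with shrink-pivotal (λ ()) A J piv
      (ℕ.≤-trans j≤s (ℕ.≤-trans (rank-antitone (rows J) A (λ y → ker y (λ ())))
                             (SmithNormalForm.length≤m (smithNormalForm (rows J)))))
  ...   | T , piv-T , T≡j = subst (0ℤ ℤ.<_) (sym (trans (torsionSum-1 j) (nbc-count Ā all? (level? j)
            (λ J J′ f g _ _ → ⟦⟧-cong (level? j J) (level? j J′) (level-resp J J′ f g)
                (level-resp J′ J g f)) j
            (λ J (c , l) → (λ _ → tt) , trans c l))))
          (ℤ.<-≤-trans (ℤ.+<+ (s≤s z≤n)) (ℤ.≤-trans (ℤ.≤-reflexive (sym one))
            (≤-sumOver-subsets (λ J → ⟦ nbc? Ā all? J ⟧ * ⟦ level? j J ⟧)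
              (λ J → nonneg (nbc? Ā all? J) (level? j J)) T)))
    where
    all? : Decidable {A = Fin m} (λ _ → ⊤)
    all? _ = yes tt
    nonneg : ∀ {P R : Set} (d : Dec P) (e : Dec R) → 0ℤ ℤ.≤ ⟦ d ⟧ * ⟦ e ⟧
    nonneg d e = subst (0ℤ ℤ.≤_) (⟦⟧-× d e) (⟦⟧-nonneg (d ×-dec e))
    T≤r : ∣ T ∣ ≤ r T
    T≤r = pivotal-rank (λ ()) A A≢0 T piv-T
    -- Independence of the rows of A forces consistency: r̄(T) ≤ |T| ≤ r(T) ≤ r̄(T).
    level : Level j T
    level = ℕ.≤-antisym (ℕ.≤-trans (SmithNormalForm.length≤m (smithNormalForm (augmentedRows T))) T≤r)
        (rank-augment-≥ (rows T) (entries T)) ,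
      trans (ℕ.≤-antisym (SmithNormalForm.length≤m (smithNormalForm (rows T))) T≤r) T≡j
    one : ⟦ nbc? Ā all? T ⟧ * ⟦ level? j T ⟧ ≡ 1ℤ
    one = cong₂ _*_ (⟦⟧-true (nbc? Ā all? T) (pivotal-nbc (λ ()) A 𝐚 (λ _ → ⊤) A≢0 T piv-T))
        (⟦⟧-true (level? j T) level)

  -- All three comparisons come from 1 ∣ gcd(a, ρ_C) ∣ gcd(b, ρ_C) = gcd(q, ρ_C). Each of these
  -- divides q, so the coefficients in question are torsion sums.
  inequalities : (∀ i → ¬ (∀ k → A i k ≡ 0ℤ)) → ∀ {q a b} → 1 ≤ a → a ≤ ρC →
    gcd a ρC ∣ gcd b ρC → gcd b ρC ≡ gcd q ρC → (∀ J → r̄ J ≡ r J → InColumnSpan q J) →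
    ∀ j → j ≤ s → (0ℤ ℤ.< w j) × (w j ≡ γ j 1) × (γ j 1 ℤ.≤ γ j a) × (γ j a ℤ.≤ γ j b) × (γ j b ≡ β j q)
  inequalities A≢0 {q} {a} {b} 1≤a a≤ρ a∣b b≡q span j j≤s =
    subst (0ℤ ℤ.<_) (sym (w-torsionSum j≤s)) (torsionSum-positive A≢0 j≤s) ,
    trans (w-torsionSum j≤s) (sym (β-torsionSum j 1 (agree 1 (ℕ∣.∣-trans (ℕ.gcd[m,n]∣m 1 ρC) (ℕ∣.1∣ q))))) ,
    subst₂ ℤ._≤_ (sym (reduce 1 (ℕ∣.∣-trans (ℕ.gcd[m,n]∣m 1 ρC) (ℕ∣.1∣ q)))) (sym (reduce a a′∣q))
      (mono (ℕ∣.∣-trans (ℕ.gcd[m,n]∣m 1 ρC) (ℕ∣.1∣ gcd a ρC))) ,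
    subst₂ ℤ._≤_ (sym (reduce a a′∣q)) (sym (reduce b b′∣q)) (mono a∣b) ,
    trans (reduce b b′∣q) (trans (cong (torsionSum j) b≡q) (sym (reduce q (ℕ.gcd[m,n]∣m q ρC))))
    where
    b′∣q : gcd b ρC ∣ q
    b′∣q = subst (_∣ q) (sym b≡q) (ℕ.gcd[m,n]∣m q ρC)
    a′∣q : gcd a ρC ∣ q
    a′∣q = ℕ∣.∣-trans a∣b b′∣q
    agree = gcd-agree-divisor {q} span
    reduce : ∀ e → gcd e ρC ∣ q → β j e ≡ torsionSum j (gcd e ρC)
    reduce e e∣q = trans (β-torsionSum j e (agree e e∣q)) (torsionSum-gcd j e)
    mono : ∀ {e f} → e ∣ f → torsionSum j e ℤ.≤ torsionSum j f
    -- The modulus Q is ρ_C, a common multiple of all invariant factors involved; it is positive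
    -- because 1 ≤ a ≤ ρ_C.
    mono = torsionSum-mono ρC (ℕ.≤-trans 1≤a a≤ρ) factors∣ρC j

corollary3p9 : ∀ {m n : ℕ} (A : Matrix ℤ m n) (𝐚 : Vector ℤ m) →
    (∀ (i : Fin m) → ¬ (∀ (k : Fin n) → A i k ≡ 0ℤ)) →
    let open Arrangement A 𝐚 in
    (∀ (q a b : ℕ) → q₀ < q → 1 ≤ a → a ≤ ρC → 1 ≤ b → b ≤ ρC →
    gcd a ρC ∣ gcd b ρC → gcd b ρC ≡ gcd q ρC →
    CombinatoriallyEquivalent (gcd a ρC) (gcd b ρC) →
    (∀ (J : Subset m) → r̄ J ≡ r J → InColumnSpan q J) →
    ∀ (j : ℕ) → j ≤ s →
    (0ℤ ℤ.< w j) × (w j ≡ γ j 1) × (γ j 1 ℤ.≤ γ j a) × (γ j a ℤ.≤ γ j b) × (γ j b ≡ β j q))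
    ×
    ((∀ (i : Fin m) → 𝐚 i ≡ 0ℤ) →
    ∀ (q a b : ℕ) → 1 ≤ q → 1 ≤ a → a ≤ ρC → 1 ≤ b → b ≤ ρC →
    gcd a ρC ∣ gcd b ρC → gcd b ρC ≡ gcd q ρC →
    ∀ (j : ℕ) → j ≤ s →
    (0ℤ ℤ.< w j) × (w j ≡ γ j 1) × (γ j 1 ℤ.≤ γ j a) × (γ j a ℤ.≤ γ j b) × (γ j b ≡ β j q))
corollary3p9 {n = n} A 𝐚 A≢0 =
  (λ q a b _ 1≤a a≤ρ _ _ a∣b b≡q _ span → inequalities A 𝐚 A≢0 1≤a a≤ρ a∣b b≡q span) ,
  (λ 𝐚≡0 q a b _ 1≤a a≤ρ _ _ a∣b b≡q → inequalities A 𝐚 A≢0 1≤a a≤ρ a∣b b≡q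
    -- For 𝐚 = 0 the zero combination of the columns shows membership in the column span modulo
    -- every q.
    (λ J _ → 𝟘ᵥ , λ i → CommutativeRing.reflexive (Modular.ℤ/ q)
      (trans (𝐚≡0 (element J i)) (sym (sum0ʳ n (A (element J i)))))))
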